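{- Let $p$ be an odd prime and let $A$ be a set in $\mathbb{F}_p$ with $|A|\le p^{2/3}$. Then $g_2(A)\gg |A|^{3/2}$.
   Context: For a positive integer $d$, $M_d(A)$ denotes the set of $d\times d$ matrices all of whose entries lie in $A$. The permanent of a $d\times d$ matrix $M=[a_{ij}]$ is $\mathrm{Per}(M)=\sum_{\sigma\in S_d}\prod_{i=1}^d a_{i\sigma(i)}$, and $g_d(A)$ denotes the number of distinct values $\mathrm{Per}(M)$ for $M\in M_d(A)$ (computed in $\mathbb{F}_p$). $U\gg V$ means $V\le cU$ for some absolute constant $c>0$. -}

module Defs where

open import Data.Nat using (ℕ; _+_; _*_; _%_; NonZero)
open import Data.Nat.Properties using (_≟_)
open import Data.Fin using (Fin; toℕ)
open import Data.Fin.Subset using (Subset; _∈_)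
open import Data.Fin.Subset.Properties using (_∈?_)
open import Data.List using (List; filter; length; deduplicate; concatMap; map)
open import Data.List using (allFin) public

elems : ∀ {p} → Subset p → List (Fin p)
elems {p} A = filter (λ i → i ∈? A) (allFin p)

-- Permanent of the 2x2 matrix [[a , b] , [c , d]] computed in 𝔽_p:
-- Per = a*d + b*c  (mod p).
per2 : (p : ℕ) → .{{NonZero p}} → Fin p → Fin p → Fin p → Fin p → ℕ
per2 p a b c d = (toℕ a * toℕ d + toℕ b * toℕ c) % p

perValues : (p : ℕ) → .{{NonZero p}} → Subset p → List ℕ
perValues p A =
  concatMap (λ a → concatMap (λ b → concatMap (λ c → map (λ d → per2 p a b c d)
    (elems A)) (elems A)) (elems A)) (elems A)

g2 : (p : ℕ) → .{{NonZero p}} → Subset p → ℕ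
g2 p A = length (deduplicate _≟_ (perValues p A))

{-# OPTIONS --safe #-}

-- Over K = 𝔽_p(λ), λ² a nonresidue, let ℓ(x , y , z) be the line {(z + x v , v , w) : v = y + x w}. Two lines with
-- x ≠ x′ meet iff z + x y′ = z′ + x′ y, so that coincidences a d + c z = a′ d′ + c z′ in A are incidences between the
-- lines (a + λ , d′ , c z) and (a′ , d , c z′ + λ d); the shift by λ ∉ 𝔽_p makes the incidences with d ≠ d′ on a
-- fixed line occur at distinct points. If AA + AA were small, a nonempty family of n ≤ 2 |A|³ such lines would survive in which every line
-- meets more than C √n others. Take a polynomial of degree O(√n) vanishing on all lines. The directions (x² , x , 1)
-- lie on a cone, so at a point where two of the lines meet the tangent plane meets the cone in just their directions.
-- Second-order contact then gives a polynomial relation that holds on whole lines, and differentiating it along the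
-- second line shows that along the first one the direction of the transversal satisfies (1 / (x′ - x))″ = 0. As all
-- degrees are below p, 1 / (x′ - x) is affine on the line, whose neighbours therefore have collinear (x′ , y′) and
-- number at most |A|: a contradiction, unless the gradient vanishes on all lines. But then so do all iterated
-- derivatives, and the polynomial is zero.

module Submission where

open import Defs
open import Algebra.Bundles using (CommutativeRing)
import Algebra.Properties.AbelianGroup
import Algebra.Properties.Ring
import Algebra.Properties.Semiring.Exp
import Algebra.Properties.Semiring.Mult.TCOptimised
import Algebra.Solver.Ring
open import Algebra.Solver.Ring.AlmostCommutativeRing
open import Algebra.Structures using (IsCommutativeRing)
open import Data.Empty using (⊥; ⊥-elim)
open import Data.Fin as Fin using (Fin; toℕ; punchOut)
import Data.Fin.Properties as Fin
open import Data.Integer as ℤ using (ℤ; -[1+_]; _⊖_; _◃_)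
import Data.Integer.Properties as ℤ
open import Data.List as List using (List; []; _∷_; _++_; length; filter; map; take; upTo; applyUpTo; deduplicate; cartesianProduct; cartesianProductWith)
import Data.List.Properties as List
open import Data.List.Membership.Propositional using (_∈_; find; lose)
open import Data.List.Membership.Propositional.Properties
open import Data.List.Relation.Binary.Permutation.Propositional using (_↭_; ↭-refl; ↭-sym; ↭-trans; prep; ↭⇒↭ₛ)
open import Data.List.Relation.Binary.Permutation.Propositional.Properties using (shift; ∈-resp-↭)
open import Data.List.Relation.Binary.Permutation.Setoid.Properties using (Unique-resp-↭)
open import Data.List.Relation.Unary.All as All using (All; []; _∷_)
import Data.List.Relation.Unary.All.Properties as All
open import Data.List.Relation.Unary.AllPairs using ([]; _∷_)
open import Data.List.Relation.Unary.Any as Any using (Any; here; there)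
import Data.List.Relation.Unary.Any.Properties as Any
open import Data.List.Relation.Unary.Unique.Propositional using (Unique)
import Data.List.Relation.Unary.Unique.Propositional.Properties as Unique
open import Data.Maybe using (Maybe; just; nothing)
open import Data.Nat as ℕ using (ℕ; zero; suc; _≤_; _<_; z≤n; s≤s; NonZero)
open import Data.Nat.Coprimality using (coprime-Bézout; prime⇒coprime)
open import Data.Nat.Divisibility using (_∣_; ∣-refl)
open import Data.Nat.DivMod using (_/_; _%_; _mod_; m≡m%n+[m/n]*n; m%n%n≡m%n; m%n<n; m*n%n≡0; m<n⇒m%n≡m; %-distribˡ-+; %-distribˡ-*)
open import Data.Nat.GCD using (module Bézout)
open import Data.Nat.Primality using (Prime; prime⇒nonTrivial)
import Data.Nat.Properties as ℕ
open import Data.Nat.Tactic.RingSolver using (solve-∀)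
open import Data.Product using (∃; ∃₂; _×_; _,_; proj₁; proj₂)
import Data.Product.Properties as Product
open import Data.Sign as Sign using (Sign)
open import Data.Sum using (_⊎_; inj₁; inj₂)
open import Data.Unit using (tt)
open import Level using (0ℓ)
open import Relation.Binary.Definitions using (DecidableEquality)
import Relation.Binary.PropositionalEquality as ≡
open ≡ using (_≡_; _≢_)
open import Relation.Nullary using (¬_; Dec; yes; no; ¬?; decidable-stable)
open import Relation.Nullary.Decidable using (isYes; toWitness)

-- Fields with propositional equality, and a ring solver with integer coefficients

-- One entry of the matrix is frozen at a nonzero element `c₀` of the set: the triples (a , d , z)
-- with value a d + c₀ z already number |A|³. If they took fewer than a small multiple of |A|^(3/2)
-- values, an average triple would share its value with more than C |A|^(3/2) others. This has the
-- order of the square root of the number of lines, which is also the degree from which on counting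
-- coefficients yields a polynomial vanishing on all of them; so only constants decide, and they are
-- followed throughout. The obstacle is the characteristic: formal derivatives, factorials and the
-- order of a zero behave as over the rationals only for degrees below p. A degree of order
-- |A|^(3/2) is at most of order p by |A| ≤ p^(2/3). To get below p itself, the lines are built from
-- N elements of the set only, with 16 N ≤ |A|; the remainder modulo 16 and the sets with at most 15
-- elements go into the final constant.

record Field : Set₁ where
  infix  8 -_
  infixl 7 _*_
  infixl 6 _+_
  infix 4 _≟_
  field
    Carrier           : Set
    _+_ _*_           : Carrier → Carrier → Carrier
    -_                : Carrier → Carrier
    0# 1#             : Carrier
    isCommutativeRing : IsCommutativeRing _≡_ _+_ _*_ -_ 0# 1#
    _≟_               : DecidableEquality Carrier
    1≢0               : 1# ≢ 0#
    inverse           : ∀ x → x ≢ 0# → ∃ λ y → x * y ≡ 1#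

  commutativeRing : CommutativeRing 0ℓ 0ℓ
  commutativeRing = record { isCommutativeRing = isCommutativeRing }

  open CommutativeRing commutativeRing public
    using (+-comm; +-assoc; +-identityˡ; +-identityʳ; *-comm; *-assoc;
           *-identityˡ; *-identityʳ; zeroˡ; zeroʳ; distribˡ; distribʳ; -‿inverseˡ; -‿inverseʳ)

  infixl 6 _-_
  _-_ : Carrier → Carrier → Carrier
  x - y = x + - y

-- Integer coefficients have an equality decided by computation, so numerals cancel in normal forms
-- even over an abstract field.
module IntegerSolver {c ℓ} (R : CommutativeRing c ℓ) where
  open CommutativeRing R using (Carrier; _≈_; _+_; _*_; -_; 0#; 1#; ring; semiring; setoid; +-abelianGroup; refl; sym; trans; +-cong; +-assoc; +-comm; +-identityˡ; +-identityʳ; -‿cong; -‿inverseʳ)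
  open Algebra.Properties.Ring ring using (-0#≈0#; -‿distribˡ-*; -‿distribʳ-*; -‿involutive)
  open Algebra.Properties.AbelianGroup +-abelianGroup using (⁻¹-∙-comm)
  module M = Algebra.Properties.Semiring.Mult.TCOptimised semiring
  open import Relation.Binary.Reasoning.Setoid setoid

  fromℤ : ℤ → Carrier
  fromℤ (ℤ.+ n) = n M.× 1#
  fromℤ -[1+ n ] = - (suc n M.× 1#)

  suc-homo : ∀ n → suc n M.× 1# ≈ 1# + n M.× 1#
  suc-homo n = M.×-homo-+ 1# 1 n

  ⊖-homo : ∀ m n → fromℤ (m ⊖ n) ≈ m M.× 1# + - (n M.× 1#)
  ⊖-homo m zero = sym (trans (+-cong refl -0#≈0#) (+-identityʳ _))
  ⊖-homo zero (suc n) = sym (+-identityˡ _)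
  ⊖-homo (suc m) (suc n) = begin
    fromℤ (suc m ⊖ suc n) ≡⟨ ≡.cong fromℤ (ℤ.[1+m]⊖[1+n]≡m⊖n m n) ⟩
    fromℤ (m ⊖ n) ≈⟨ ⊖-homo m n ⟩
    a + - b ≈⟨ +-identityˡ _ ⟨
    0# + (a + - b) ≈⟨ +-cong (-‿inverseʳ 1#) refl ⟨
    (1# + - 1#) + (a + - b) ≈⟨ +-assoc _ _ _ ⟩
    1# + (- 1# + (a + - b)) ≈⟨ +-cong refl (+-assoc _ _ _) ⟨
    1# + ((- 1# + a) + - b) ≈⟨ +-cong refl (+-cong (+-comm _ _) refl) ⟩
    1# + ((a + - 1#) + - b) ≈⟨ +-cong refl (+-assoc _ _ _) ⟩
    1# + (a + (- 1# + - b)) ≈⟨ +-assoc _ _ _ ⟨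
    (1# + a) + (- 1# + - b) ≈⟨ +-cong (sym (suc-homo m)) (trans (⁻¹-∙-comm 1# b) (-‿cong (sym (suc-homo n)))) ⟩
    suc m M.× 1# + - (suc n M.× 1#) ∎
    where
    a = m M.× 1#
    b = n M.× 1#

  +◃-homo : ∀ n → fromℤ (Sign.+ ◃ n) ≈ n M.× 1#
  +◃-homo zero = refl
  +◃-homo (suc n) = refl

  -◃-homo : ∀ n → fromℤ (Sign.- ◃ n) ≈ - (n M.× 1#)
  -◃-homo zero = sym -0#≈0#
  -◃-homo (suc n) = refl

  +-homo : ∀ i j → fromℤ (i ℤ.+ j) ≈ fromℤ i + fromℤ j
  +-homo (ℤ.+ m) (ℤ.+ n) = M.×-homo-+ 1# m n
  +-homo (ℤ.+ m) -[1+ n ] = ⊖-homo m (suc n)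
  +-homo -[1+ m ] (ℤ.+ n) = trans (⊖-homo n (suc m)) (+-comm _ _)
  +-homo -[1+ m ] -[1+ n ] = begin
    - (suc (suc (m ℕ.+ n)) M.× 1#) ≡⟨ ≡.cong (λ k → - (k M.× 1#)) (≡.cong suc (≡.sym (ℕ.+-suc m n))) ⟩
    - ((suc m ℕ.+ suc n) M.× 1#) ≈⟨ -‿cong (M.×-homo-+ 1# (suc m) (suc n)) ⟩
    - (suc m M.× 1# + suc n M.× 1#) ≈⟨ ⁻¹-∙-comm _ _ ⟨
    - (suc m M.× 1#) + - (suc n M.× 1#) ∎

  *-homo : ∀ i j → fromℤ (i ℤ.* j) ≈ fromℤ i * fromℤ j
  *-homo (ℤ.+ m) (ℤ.+ n) = trans (+◃-homo (m ℕ.* n)) (M.×1-homo-* m n)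
  *-homo (ℤ.+ m) -[1+ n ] =
    trans (-◃-homo (m ℕ.* suc n)) (trans (-‿cong (M.×1-homo-* m (suc n))) (-‿distribʳ-* _ _))
  *-homo -[1+ m ] (ℤ.+ n) =
    trans (-◃-homo (suc m ℕ.* n)) (trans (-‿cong (M.×1-homo-* (suc m) n)) (-‿distribˡ-* _ _))
  *-homo -[1+ m ] -[1+ n ] = begin
    (suc m ℕ.* suc n) M.× 1# ≈⟨ M.×1-homo-* (suc m) (suc n) ⟩
    suc m M.× 1# * suc n M.× 1# ≈⟨ -‿involutive _ ⟨
    - - (suc m M.× 1# * suc n M.× 1#) ≈⟨ -‿cong (-‿distribˡ-* _ _) ⟩
    - (- (suc m M.× 1#) * suc n M.× 1#) ≈⟨ -‿distribʳ-* _ _ ⟩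
    - (suc m M.× 1#) * - (suc n M.× 1#) ∎

  -‿homo : ∀ i → fromℤ (ℤ.- i) ≈ - fromℤ i
  -‿homo (ℤ.+ zero) = sym -0#≈0#
  -‿homo (ℤ.+ suc n) = refl
  -‿homo -[1+ n ] = sym (-‿involutive _)

  morphism : ℤ.+-*-rawRing -Raw-AlmostCommutative⟶ fromCommutativeRing R
  morphism = record
    { ⟦_⟧ = fromℤ ; +-homo = +-homo ; *-homo = *-homo ; -‿homo = -‿homo ; 0-homo = refl ; 1-homo = refl }

  equal? : ∀ i j → Maybe (fromℤ i ≈ fromℤ j)
  equal? i j with i ℤ.≟ j
  ... | yes ≡.refl = just refl
  ... | no _ = nothing

  open Algebra.Solver.Ring ℤ.+-*-rawRing (fromCommutativeRing R) morphism equal? public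

module FieldProperties (F : Field) where
  open Field F
  open IntegerSolver commutativeRing public using (solve; _:=_; _:+_; _:*_; _:-_; :-_; con; Polynomial)
  open ≡ using (refl; sym; trans; cong; module ≡-Reasoning)
  open ≡-Reasoning

  0ₖ 1ₖ : ∀ {n} → Polynomial n
  0ₖ = con (ℤ.+ 0)
  1ₖ = con (ℤ.+ 1)

  *-cancel : ∀ {x y} → x ≢ 0# → x * y ≡ 0# → y ≡ 0#
  *-cancel {x} {y} x≢0 xy≡0 with inverse x x≢0
  ... | i , xi≡1 = begin
    y ≡⟨ sym (*-identityˡ y) ⟩
    1# * y ≡⟨ cong (_* y) (sym xi≡1) ⟩
    (x * i) * y ≡⟨ solve 3 (λ x i y → (x :* i) :* y := i :* (x :* y)) refl x i y ⟩
    i * (x * y) ≡⟨ cong (i *_) xy≡0 ⟩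
    i * 0# ≡⟨ zeroʳ i ⟩
    0# ∎

  *-nonzero : ∀ {x y} → x ≢ 0# → y ≢ 0# → x * y ≢ 0#
  *-nonzero x≢0 y≢0 xy≡0 = y≢0 (*-cancel x≢0 xy≡0)

  -‿≡0 : ∀ {x y} → x - y ≡ 0# → x ≡ y
  -‿≡0 {x} {y} e = trans (solve 2 (λ x y → x := (x :- y) :+ y) refl x y)
                    (trans (cong (_+ y) e) (+-identityˡ y))

  -‿≢0 : ∀ {x y} → x ≢ y → x - y ≢ 0#
  -‿≢0 x≢y e = x≢y (-‿≡0 e)

  x≡y⇒x-y≡0 : ∀ {x y} → x ≡ y → x - y ≡ 0#
  x≡y⇒x-y≡0 {x} refl = -‿inverseʳ x

  ι : ℕ → Carrier
  ι zero    = 0#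
  ι (suc n) = 1# + ι n

-- Polynomial functions in one variable

module PolynomialFunctions (F : Field) where
  open Field F
  open FieldProperties F
  open ≡ using (refl; sym; trans; cong; cong₂; module ≡-Reasoning)
  open ≡-Reasoning

  -- Pol n f f′: f is a polynomial function of degree at most n, and f′ is its formal derivative.
  data Pol : ℕ → (Carrier → Carrier) → (Carrier → Carrier) → Set where
    constant : ∀ {n f f′} c → (∀ w → f w ≡ c) → (∀ w → f′ w ≡ 0#) → Pol n f f′
    horner   : ∀ {n f f′ g g′} c → Pol n g g′ → (∀ w → f w ≡ c + w * g w) →
               (∀ w → f′ w ≡ g w + w * g′ w) → Pol (suc n) f f′

  Pol-resp : ∀ {n f f′ g g′} → (∀ w → g w ≡ f w) → (∀ w → g′ w ≡ f′ w) → Pol n f f′ → Pol n g g′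
  Pol-resp e e′ (constant c h h′) = constant c (λ w → trans (e w) (h w)) (λ w → trans (e′ w) (h′ w))
  Pol-resp e e′ (horner c P h h′) = horner c P (λ w → trans (e w) (h w)) (λ w → trans (e′ w) (h′ w))

  Pol-≤ : ∀ {m n f f′} → m ≤ n → Pol m f f′ → Pol n f f′
  Pol-≤ m≤n (constant c h h′) = constant c h h′
  Pol-≤ (s≤s m≤n) (horner c P h h′) = horner c (Pol-≤ m≤n P) h h′

  Pol-const : ∀ {n} c → Pol n (λ _ → c) (λ _ → 0#)
  Pol-const c = constant c (λ _ → refl) (λ _ → refl)

  Pol-affine : ∀ {n} a b → Pol (suc n) (λ w → a + w * b) (λ _ → b)
  Pol-affine a b = horner a (Pol-const b) (λ _ → refl)
    (λ w → solve 2 (λ w b → b := b :+ w :* 0ₖ) refl w b)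

  Pol-scale : ∀ {n f f′} k → Pol n f f′ → Pol n (λ w → k * f w) (λ w → k * f′ w)
  Pol-scale k (constant c h h′) =
    constant (k * c) (λ w → cong (k *_) (h w)) (λ w → trans (cong (k *_) (h′ w)) (zeroʳ k))
  Pol-scale k (horner {g = g} {g′} c P h h′) = horner (k * c) (Pol-scale k P)
    (λ w → trans (cong (k *_) (h w))
             (solve 4 (λ k c w g → k :* (c :+ w :* g) := k :* c :+ w :* (k :* g)) refl k c w (g w)))
    (λ w → trans (cong (k *_) (h′ w))
             (solve 4 (λ k g w g′ → k :* (g :+ w :* g′) := k :* g :+ w :* (k :* g′)) refl k (g w) w (g′ w)))

  Pol-+ : ∀ {n f f′ g g′} → Pol n f f′ → Pol n g g′ → Pol n (λ w → f w + g w) (λ w → f′ w + g′ w)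
  Pol-+ (constant c h h′) (constant d k k′) = constant (c + d)
    (λ w → cong₂ _+_ (h w) (k w)) (λ w → trans (cong₂ _+_ (h′ w) (k′ w)) (+-identityˡ 0#))
  Pol-+ (constant c h h′) (horner {g = g} {g′} d Q k k′) = horner (c + d) Q
    (λ w → trans (cong₂ _+_ (h w) (k w)) (sym (+-assoc _ _ _)))
    (λ w → trans (cong₂ _+_ (h′ w) (k′ w)) (+-identityˡ _))
  Pol-+ (horner {g = g} {g′} d Q k k′) (constant c h h′) = horner (d + c) Q
    (λ w → trans (cong₂ _+_ (k w) (h w))
             (solve 4 (λ c d w g → (d :+ w :* g) :+ c := (d :+ c) :+ w :* g) refl c d w (g w)))
    (λ w → trans (cong₂ _+_ (k′ w) (h′ w)) (+-identityʳ _))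
  Pol-+ (horner {g = g₁} {g₁′} c P h h′) (horner {g = g₂} {g₂′} d Q k k′) = horner (c + d) (Pol-+ P Q)
    (λ w → trans (cong₂ _+_ (h w) (k w))
             (solve 5 (λ c d w g₁ g₂ → (c :+ w :* g₁) :+ (d :+ w :* g₂) := (c :+ d) :+ w :* (g₁ :+ g₂))
               refl c d w (g₁ w) (g₂ w)))
    (λ w → trans (cong₂ _+_ (h′ w) (k′ w))
             (solve 5 (λ a b w g₁ g₂ → (a :+ w :* g₁) :+ (b :+ w :* g₂) := (a :+ b) :+ w :* (g₁ :+ g₂))
               refl (g₁ w) (g₂ w) w (g₁′ w) (g₂′ w)))

  Pol-neg : ∀ {n f f′} → Pol n f f′ → Pol n (λ w → - f w) (λ w → - f′ w)
  Pol-neg {f = f} {f′} P = Pol-resp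
    (λ w → solve 1 (λ x → :- x := :- 1ₖ :* x) refl (f w))
    (λ w → solve 1 (λ x → :- x := :- 1ₖ :* x) refl (f′ w)) (Pol-scale (- 1#) P)

  Pol-- : ∀ {n f f′ g g′} → Pol n f f′ → Pol n g g′ → Pol n (λ w → f w - g w) (λ w → f′ w - g′ w)
  Pol-- P Q = Pol-+ P (Pol-neg Q)

  Pol-* : ∀ {m n f f′ g g′} → Pol m f f′ → Pol n g g′ →
          Pol (m ℕ.+ n) (λ w → f w * g w) (λ w → f′ w * g w + f w * g′ w)
  Pol-* {m} {n} {g = g} {g′} (constant c h h′) Q = Pol-≤ (ℕ.m≤n+m n m) (Pol-resp
    (λ w → cong (_* g w) (h w))
    (λ w → trans (cong₂ (λ a b → a * g w + b * g′ w) (h′ w) (h w))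
             (solve 3 (λ g c g′ → 0ₖ :* g :+ c :* g′ := c :* g′) refl (g w) c (g′ w)))
    (Pol-scale c Q))
  Pol-* {suc m} {n} {g = g} {g′} (horner {g = q} {q′} c P h h′) Q = Pol-resp
    (λ w → trans (cong (_* g w) (h w))
      (solve 4 (λ c w q g → (c :+ w :* q) :* g := c :* g :+ (0ₖ :+ w :* (q :* g))) refl c w (q w) (g w)))
    (λ w → trans (cong₂ (λ a b → a * g w + b * g′ w) (h′ w) (h w))
      (solve 6 (λ c w q q′ g g′ → (q :+ w :* q′) :* g :+ (c :+ w :* q) :* g′
                  := c :* g′ :+ (q :* g :+ w :* (q′ :* g :+ q :* g′))) refl c w (q w) (q′ w) (g w) (g′ w)))
    (Pol-+ (Pol-≤ (ℕ.≤-trans (ℕ.m≤n+m n m) (ℕ.n≤1+n _)) (Pol-scale c Q))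
           (horner 0# (Pol-* P Q) (λ _ → refl) (λ _ → refl)))

  -- Division by `w - a`, carried out on the derivative as well, so that orders of vanishing can be
  -- lowered without losing `f′`.
  Pol-factor : ∀ {n f f′} → Pol n f f′ → ∀ a → ∃₂ λ g g′ → Pol (ℕ.pred n) g g′ ×
    (∀ w → f w ≡ f a + (w - a) * g w) × (∀ w → f′ w ≡ g w + (w - a) * g′ w)
  Pol-factor (constant c h h′) a = (λ _ → 0#) , (λ _ → 0#) , Pol-const 0# ,
    (λ w → trans (h w) (trans (sym (h a)) (solve 3 (λ x w a → x := x :+ (w :- a) :* 0ₖ) refl _ w a))) ,
    (λ w → trans (h′ w) (solve 2 (λ w a → 0ₖ := 0ₖ :+ (w :- a) :* 0ₖ) refl w a))
  -- Split off to keep the quotient at degree 0; the general formula below would only give degree 1.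
  Pol-factor {f = f} (horner {n = zero} {g = g} {g′} c (constant d k k′) h h′) a =
    (λ _ → d) , (λ _ → 0#) , Pol-const d ,
    (λ w → trans (f≡ w) (trans (solve 4 (λ c w a d → c :+ w :* d := (c :+ a :* d) :+ (w :- a) :* d) refl c w a d)
              (cong (_+ (w - a) * d) (sym (f≡ a))))) ,
    (λ w → trans (h′ w) (trans (cong₂ (λ x y → x + w * y) (k w) (k′ w))
              (solve 3 (λ d w a → d :+ w :* 0ₖ := d :+ (w :- a) :* 0ₖ) refl d w a)))
    where
    f≡ : ∀ w → f w ≡ c + w * d
    f≡ w = trans (h w) (cong (λ x → c + w * x) (k w))
  Pol-factor {f = f} (horner {n = suc n} {g = g} {g′} c P h h′) a with Pol-factor P a
  ... | q , q′ , Q , e , e′ =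
    (λ w → g a + w * q w) , (λ w → q w + w * q′ w) , horner (g a) Q (λ _ → refl) (λ _ → refl) ,
    (λ w → begin
      f w ≡⟨ h w ⟩
      c + w * g w ≡⟨ cong (λ x → c + w * x) (e w) ⟩
      c + w * (g a + (w - a) * q w)
        ≡⟨ solve 5 (λ c w a ga q → c :+ w :* (ga :+ (w :- a) :* q) := (c :+ a :* ga) :+ (w :- a) :* (ga :+ w :* q))
             refl c w a (g a) (q w) ⟩
      (c + a * g a) + (w - a) * (g a + w * q w) ≡⟨ cong (_+ (w - a) * (g a + w * q w)) (sym (h a)) ⟩
      f a + (w - a) * (g a + w * q w) ∎) ,
    (λ w → trans (h′ w) (trans (cong₂ (λ x y → x + w * y) (e w) (e′ w))
      (solve 5 (λ w a ga q q′ → (ga :+ (w :- a) :* q) :+ w :* (q :+ (w :- a) :* q′)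
                  := (ga :+ w :* q) :+ (w :- a) :* (q :+ w :* q′)) refl w a (g a) (q w) (q′ w))))

  -- The conclusion on `f′` does not follow from the one on `f`: the function w^p - w is zero on the
  -- field of p elements, but its formal derivative is not. More zeros than the degree exclude this.
  Pol-zeros : ∀ {n f f′} → Pol n f f′ → ∀ {ws} → Unique ws → All (λ w → f w ≡ 0#) ws → n < length ws →
              (∀ w → f w ≡ 0#) × (∀ w → f′ w ≡ 0#)
  Pol-zeros (constant c h h′) {a ∷ _} _ (fa ∷ _) n< =
    (λ w → trans (h w) (trans (sym (h a)) fa)) , h′
  Pol-zeros {suc n} {f} P {a ∷ ws} (a∉ws ∷ uniq) (fa ∷ fws) (s≤s n<) with Pol-factor P a
  ... | g , g′ , Q , e , e′ =
    (λ w → trans (f≡ w) (trans (cong ((w - a) *_) (proj₁ ih w)) (zeroʳ _))) ,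
    (λ w → trans (e′ w) (trans (cong₂ (λ x y → x + (w - a) * y) (proj₁ ih w) (proj₂ ih w))
       (solve 2 (λ w a → 0ₖ :+ (w :- a) :* 0ₖ := 0ₖ) refl w a)))
    where
    f≡ : ∀ w → f w ≡ (w - a) * g w
    f≡ w = trans (e w) (trans (cong (_+ _) fa) (+-identityˡ _))

    gws : ∀ {ws} → All (λ w → a ≢ w) ws → All (λ w → f w ≡ 0#) ws → All (λ w → g w ≡ 0#) ws
    gws [] [] = []
    gws (a≢w ∷ ns) (fw ∷ fws) =
      *-cancel (-‿≢0 (λ w≡a → a≢w (sym w≡a))) (trans (sym (f≡ _)) fw) ∷ gws ns fws

    ih = Pol-zeros Q uniq (gws a∉ws fws) n<

-- Derivatives and linear differential equations below the characteristic

length-filter-≢ : ∀ {A : Set} {P : A → Set} (P? : ∀ x → Dec (P x)) {xs} → Unique xs →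
                  (∀ {x y} → ¬ P x → ¬ P y → x ≡ y) → length xs ≤ suc (length (filter P? xs))
length-filter-≢ P? {[]} _ one = z≤n
length-filter-≢ {P = P} P? {x ∷ xs} (x∉ ∷ u) one with P? x
... | yes _ = s≤s (length-filter-≢ P? u one)
... | no ¬px = s≤s (ℕ.≤-reflexive (≡.sym (≡.cong length (List.filter-all P? (rest x∉)))))
  where
  rest : ∀ {ys} → All (x ≢_) ys → All P ys
  rest [] = []
  rest {y ∷ _} (x≢y ∷ ns) with P? y
  ... | yes py = py ∷ rest ns
  ... | no ¬py = ⊥-elim (x≢y (one ¬px ¬py))

-- The hypothesis `char` says that the characteristic is zero or at least `p`; it holds in the
-- fields of p and of p² elements alike.
module Characteristic (F : Field) (p : ℕ)
  (char : ∀ n → suc n < p → FieldProperties.ι F (suc n) ≢ Field.0# F) where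
  open Field F
  open FieldProperties F
  open PolynomialFunctions F
  open ≡ using (refl; sym; trans; cong; cong₂; module ≡-Reasoning)
  open ≡-Reasoning

  ι-+ : ∀ m n → ι (m ℕ.+ n) ≡ ι m + ι n
  ι-+ zero n = sym (+-identityˡ _)
  ι-+ (suc m) n = trans (cong (1# +_) (ι-+ m n)) (sym (+-assoc _ _ _))

  ι-injective : ∀ {m n} → m < n → n < p → ι m ≢ ι n
  ι-injective {m} m<n n<p e with ℕ.m≤n⇒∃[o]m+o≡n m<n
  ... | k , refl = char k (ℕ.≤-<-trans (s≤s (ℕ.m≤n+m k m)) n<p) (begin
    ι (suc k) ≡⟨ solve 2 (λ a b → b := (a :+ b) :- a) refl (ι m) (ι (suc k)) ⟩
    (ι m + ι (suc k)) - ι m ≡⟨ cong (_- ι m) (sym (ι-+ m (suc k))) ⟩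
    ι (m ℕ.+ suc k) - ι m ≡⟨ cong (λ j → ι j - ι m) (ℕ.+-suc m k) ⟩
    ι (suc m ℕ.+ k) - ι m ≡⟨ cong (_- ι m) (sym e) ⟩
    ι m - ι m ≡⟨ -‿inverseʳ _ ⟩
    0# ∎)

  points : ℕ → List Carrier
  points = applyUpTo ι

  points-unique : ∀ {n} → n ≤ p → Unique (points n)
  points-unique {n} n≤p = Unique.applyUpTo⁺₁ ι n (λ i<j j<n → ι-injective i<j (ℕ.<-≤-trans j<n n≤p))

  Pol-derivative : ∀ {n f f′} → Pol n f f′ → ∃ λ f″ → Pol n f′ f″
  Pol-derivative (constant c h h′) = (λ _ → 0#) , constant 0# h′ (λ _ → refl)
  Pol-derivative (horner c P h h′) with Pol-derivative P
  ... | g″ , P′ = _ , Pol-resp h′ (λ _ → refl)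
    (Pol-+ (Pol-≤ (ℕ.n≤1+n _) P) (horner 0# P′ (λ _ → sym (+-identityˡ _)) (λ _ → refl)))

  -- Of the `p` available points at most one is lost. This allows a factor `w - a` to be cancelled
  -- from an identity.
  Pol-punctured : ∀ {n f f′} → Pol n f f′ → suc n < p → ∀ a → (∀ w → w ≢ a → f w ≡ 0#) → ∀ w → f w ≡ 0#
  Pol-punctured P n<p a f≡0 = proj₁ (Pol-zeros P (Unique.filter⁺ ≢a? (points-unique ℕ.≤-refl))
    (All.map (λ {w} → f≡0 w) (All.all-filter ≢a? (points p)))
    (ℕ.≤-pred (ℕ.<-≤-trans n<p (ℕ.≤-trans (ℕ.≤-reflexive (sym (List.length-applyUpTo ι p)))
      (length-filter-≢ ≢a? (points-unique ℕ.≤-refl) λ ¬x ¬y → trans (dne ¬x) (sym (dne ¬y)))))))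
    where
    ≢a? = λ w → ¬? (w ≟ a)
    dne : ∀ {w} → ¬ (w ≢ a) → w ≡ a
    dne {w} ¬¬e with w ≟ a
    ... | yes e = e
    ... | no ¬e = ⊥-elim (¬¬e ¬e)

  -- A solution of X′ A = Q X vanishing at a is zero: in X = (w - a)ʳ Y the equation forces r Y(a) A(a) = 0,
  -- so that the order of vanishing can be raised until it exceeds the degree.
  module _ {m q A A′ Q Q′} (PA : Pol m A A′) (PQ : Pol q Q Q′) (a : Carrier) (Aa≢0 : A a ≢ 0#) where

    ode-order : ∀ {n Y Y′} r → Pol n Y Y′ → r ℕ.+ n < p → 2 ℕ.+ (n ℕ.+ m ℕ.+ q) < p → Y a ≡ 0# →
      (∀ w → (ι r * Y w + (w - a) * Y′ w) * A w ≡ (w - a) * (Q w * Y w)) → ∀ w → Y w ≡ 0#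
    ode-order {zero} r (constant c h h′) _ _ Ya eq w = trans (h w) (trans (sym (h a)) Ya)
    ode-order {suc n} {Y} {Y′} r P r+n<p deg<p Ya eq w with Pol-factor P a
    ... | Z , Z′ , PZ , e , e′ = trans (Y≡ w) (trans (cong ((w - a) *_) (ih w)) (zeroʳ _))
      where
      Y≡ : ∀ w → Y w ≡ (w - a) * Z w
      Y≡ w = trans (e w) (trans (cong (_+ _) Ya) (+-identityˡ _))

      -- The equation for Y = (w - a) Z with one factor w - a cancelled: the same equation for `Z`,
      -- with `r` raised by one.
      G : Carrier → Carrier
      G w = (ι (suc r) * Z w + (w - a) * Z′ w) * A w - (w - a) * (Q w * Z w)

      Pol-shift : ∀ {n} → Pol (suc n) (λ w → w - a) (λ _ → 1#)
      Pol-shift = Pol-resp (λ w → solve 2 (λ w a → w :- a := :- a :+ w :* 1ₖ) refl w a) (λ _ → refl) (Pol-affine (- a) 1#)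

      PG : Pol (1 ℕ.+ (n ℕ.+ m ℕ.+ q)) G _
      PG = Pol-- (Pol-≤ (s≤s (ℕ.m≤m+n (n ℕ.+ m) q))
                   (Pol-* (Pol-+ (Pol-≤ (ℕ.n≤1+n n) (Pol-scale (ι (suc r)) PZ))
                                 (Pol-* {m = 1} Pol-shift (proj₂ (Pol-derivative PZ)))) PA))
                 (Pol-≤ (s≤s (ℕ.≤-trans (ℕ.≤-reflexive (ℕ.+-comm q n)) (ℕ.+-monoˡ-≤ q (ℕ.m≤m+n n m))))
                   (Pol-* {m = 1} Pol-shift (Pol-* PQ PZ)))

      G≡0 : ∀ w → G w ≡ 0#
      G≡0 = Pol-punctured PG (ℕ.<-trans (ℕ.n<1+n _) deg<p) a λ w w≢a → *-cancel (-‿≢0 w≢a) (begin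
        (w - a) * G w
          ≡⟨ solve 6 (λ r d z z′ A Q → d :* (((1ₖ :+ r) :* z :+ d :* z′) :* A :- d :* (Q :* z))
                   := (r :* (d :* z) :+ d :* (z :+ d :* z′)) :* A :- d :* (Q :* (d :* z))) refl
               (ι r) (w - a) (Z w) (Z′ w) (A w) (Q w) ⟩
        (ι r * ((w - a) * Z w) + (w - a) * (Z w + (w - a) * Z′ w)) * A w - (w - a) * (Q w * ((w - a) * Z w))
          ≡⟨ cong₂ (λ y y′ → (ι r * y + (w - a) * y′) * A w - (w - a) * (Q w * y)) (sym (Y≡ w)) (sym (e′ w)) ⟩
        (ι r * Y w + (w - a) * Y′ w) * A w - (w - a) * (Q w * Y w)
          ≡⟨ x≡y⇒x-y≡0 (eq w) ⟩
        0# ∎)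

      r<p : suc r < p
      r<p = ℕ.≤-<-trans (ℕ.≤-trans (s≤s (ℕ.m≤m+n r n)) (ℕ.≤-reflexive (sym (ℕ.+-suc r n)))) r+n<p

      -- At `a` only the term with `ι (suc r)` survives, and this factor is nonzero because r + n
      -- stays below `p` throughout.
      Za : Z a ≡ 0#
      Za = *-cancel Aa≢0 (*-cancel (char r r<p) (trans
        (solve 6 (λ r a z z′ A Q → r :* (A :* z) := (r :* z :+ (a :- a) :* z′) :* A :- (a :- a) :* (Q :* z)) refl
          (ι (suc r)) a (Z a) (Z′ a) (A a) (Q a)) (G≡0 a)))

      ih : ∀ w → Z w ≡ 0#
      ih = ode-order (suc r) PZ (ℕ.≤-<-trans (ℕ.≤-reflexive (sym (ℕ.+-suc r n))) r+n<p)
             (ℕ.<-trans (ℕ.n<1+n _) deg<p) Za (λ w → -‿≡0 (G≡0 w))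

    ode-unique : ∀ {n X X′} → Pol n X X′ → 2 ℕ.+ (n ℕ.+ m ℕ.+ q) < p → X a ≡ 0# →
      (∀ w → X′ w * A w ≡ Q w * X w) → ∀ w → X w ≡ 0#
    ode-unique {n} {X} {X′} P deg<p Xa eq = ode-order 0 P
      (ℕ.≤-<-trans (ℕ.≤-trans (ℕ.m≤m+n n m) (ℕ.≤-trans (ℕ.m≤m+n _ q) (ℕ.m≤n+m _ 2))) deg<p) deg<p Xa
      λ w → trans (solve 4 (λ x d x′ A → (0ₖ :* x :+ d :* x′) :* A := d :* (x′ :* A)) refl (X w) (w - a) (X′ w) (A w))
                  (cong ((w - a) *_) (eq w))

  -- The hypothesis is the numerator of (B / A)″.
  quotient-affine : ∀ {δ A A′ A″ B B′ B″} → Pol δ A A′ → Pol δ A′ A″ → Pol δ B B′ → Pol δ B′ B″ →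
    3 ℕ.+ (δ ℕ.+ δ ℕ.+ δ ℕ.+ δ) < p →
    (∀ w → (B″ w * A w - B w * A″ w) * A w ≡ (A′ w + A′ w) * (B′ w * A w - B w * A′ w)) →
    ∀ a → A a ≢ 0# → ∃₂ λ c k → ∀ w → B w ≡ (c + w * k) * A w
  quotient-affine {δ} {A} {A′} {A″} {B} {B′} {B″} PA PA′ PB PB′ deg<p eq a Aa≢0 with inverse (A a) Aa≢0
  ... | i , Aai = c , κ , λ w → -‿≡0 (Y≡0 w)
    where
    -- `κ` is the value of (B / A)′ at `a`, and `c` is chosen so that c + a κ is the value of B / A
    -- there.
    κ = (B′ a * A a - B a * A′ a) * (i * i)
    c = B a * i - κ * a

    -- X = A² ((B / A)′ - κ). The hypothesis becomes X′ A = 2 A′ X.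
    X : Carrier → Carrier
    X w = (B′ w * A w - B w * A′ w) - κ * (A w * A w)

    unit : ∀ x → x * (A a * i) ≡ x
    unit x = trans (cong (x *_) Aai) (*-identityʳ x)

    X≡0 : ∀ w → X w ≡ 0#
    X≡0 = ode-unique PA (Pol-+ PA′ PA′) a Aa≢0
      (Pol-- (Pol-- (Pol-* PB′ PA) (Pol-* PB PA′)) (Pol-scale κ (Pol-* PA PA)))
      (ℕ.<-trans (ℕ.n<1+n _) deg<p)
      (trans (cong (λ x → W - x) (trans (solve 3 (λ W i A → W :* (i :* i) :* (A :* A) := W :* (A :* i) :* (A :* i)) refl W i (A a))
                 (trans (unit _) (unit W)))) (-‿inverseʳ W))
      λ w → trans
        (solve 7 (λ A A′ A″ B B′ B″ κ →
             ((B″ :* A :+ B′ :* A′) :- (B′ :* A′ :+ B :* A″) :- κ :* (A′ :* A :+ A :* A′)) :* A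
          := (B″ :* A :- B :* A″) :* A :- κ :* (A′ :* A :+ A :* A′) :* A)
          refl (A w) (A′ w) (A″ w) (B w) (B′ w) (B″ w) κ)
        (trans (cong (_- κ * (A′ w * A w + A w * A′ w) * A w) (eq w))
        (solve 5 (λ A A′ B B′ κ →
             (A′ :+ A′) :* (B′ :* A :- B :* A′) :- κ :* (A′ :* A :+ A :* A′) :* A
          := (A′ :+ A′) :* ((B′ :* A :- B :* A′) :- κ :* (A :* A)))
          refl (A w) (A′ w) (B w) (B′ w) κ))
      where W = B′ a * A a - B a * A′ a

    -- Y = A (B / A - (c + w κ)). Since `X` is zero, Y′ A = A′ Y.
    Y : Carrier → Carrier
    Y w = B w - (c + w * κ) * A w

    Y≡0 : ∀ w → Y w ≡ 0#
    Y≡0 = ode-unique PA PA′ a Aa≢0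
      (Pol-- (Pol-≤ (ℕ.n≤1+n δ) PB) (Pol-* {m = 1} (Pol-affine c κ) PA))
      (ℕ.≤-<-trans (s≤s (s≤s (s≤s (ℕ.m≤m+n _ δ)))) deg<p)
      (trans (solve 5 (λ B i κ a A → B :- ((B :* i :- κ :* a) :+ a :* κ) :* A := B :- B :* (A :* i)) refl (B a) i κ a (A a))
             (x≡y⇒x-y≡0 (sym (unit (B a)))))
      λ w → trans
        (solve 7 (λ A A′ B B′ κ c w →
             (B′ :- (κ :* A :+ (c :+ w :* κ) :* A′)) :* A
          := ((B′ :* A :- B :* A′) :- κ :* (A :* A)) :+ A′ :* (B :- (c :+ w :* κ) :* A))
          refl (A w) (A′ w) (B w) (B′ w) κ c w)
        (trans (cong (_+ A′ w * Y w) (X≡0 w)) (+-identityˡ _))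

-- Polynomials in three variables

-- A polynomial in u, v, w is a list of coefficients and exponents. It is only used through its pairings ⟪ P , φ ⟫
-- with functionals φ on monomials: Δ e is the transpose of the derivative in direction e.
module TrivariatePolynomials (F : Field) where
  open Field F
  open FieldProperties F
  open PolynomialFunctions F
  open ≡ using (refl; cong; cong₂; module ≡-Reasoning)
  open ≡-Reasoning
  open Algebra.Properties.Semiring.Exp (CommutativeRing.semiring commutativeRing) public using (_^_)

  Point = Carrier × Carrier × Carrier

  Monomial = ℕ × ℕ × ℕ

  Functional = Monomial → Carrier

  Polynomial₃ = List (Carrier × Monomial)

  degree : Monomial → ℕ
  degree (i , j , l) = i ℕ.+ j ℕ.+ l

  Degree≤ : ℕ → Polynomial₃ → Set
  Degree≤ δ = All (λ t → degree (proj₂ t) ≤ δ)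

  ⟪_,_⟫ : Polynomial₃ → Functional → Carrier
  ⟪ [] , φ ⟫ = 0#
  ⟪ (c , m) ∷ P , φ ⟫ = c * φ m + ⟪ P , φ ⟫

  at : Point → Functional
  at (u , v , w) (i , j , l) = u ^ i * v ^ j * w ^ l

  Δ : Point → Functional → Functional
  Δ (a , b , c) φ (i , j , l) =
    a * (ι i * φ (ℕ.pred i , j , l)) + b * (ι j * φ (i , ℕ.pred j , l)) + c * (ι l * φ (i , j , ℕ.pred l))

  _≗ₘ_ : Functional → Functional → Set
  φ ≗ₘ ψ = ∀ m → φ m ≡ ψ m

  pairing-cong : ∀ P {φ ψ} → φ ≗ₘ ψ → ⟪ P , φ ⟫ ≡ ⟪ P , ψ ⟫
  pairing-cong [] e = refl
  pairing-cong ((c , m) ∷ P) e = cong₂ (λ a b → c * a + b) (e m) (pairing-cong P e)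

  Δ-cong : ∀ e {φ ψ} → φ ≗ₘ ψ → Δ e φ ≗ₘ Δ e ψ
  Δ-cong (a , b , c) h (i , j , l) =
    cong₂ _+_ (cong₂ _+_ (cong (λ t → a * (ι i * t)) (h _)) (cong (λ t → b * (ι j * t)) (h _)))
      (cong (λ t → c * (ι l * t)) (h _))

  Δ-comm : ∀ e f φ → Δ e (Δ f φ) ≗ₘ Δ f (Δ e φ)
  Δ-comm (a , b , c) (a′ , b′ , c′) φ (i , j , l) =
    solve 18 (λ a b c a′ b′ c′ I I′ J J′ L L′ A B C D E G →
         a :* (I :* (a′ :* (I′ :* A) :+ b′ :* (J :* D) :+ c′ :* (L :* E)))
           :+ b :* (J :* (a′ :* (I :* D) :+ b′ :* (J′ :* B) :+ c′ :* (L :* G)))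
           :+ c :* (L :* (a′ :* (I :* E) :+ b′ :* (J :* G) :+ c′ :* (L′ :* C)))
      := a′ :* (I :* (a :* (I′ :* A) :+ b :* (J :* D) :+ c :* (L :* E)))
           :+ b′ :* (J :* (a :* (I :* D) :+ b :* (J′ :* B) :+ c :* (L :* G)))
           :+ c′ :* (L :* (a :* (I :* E) :+ b :* (J :* G) :+ c :* (L′ :* C)))) refl
      a b c a′ b′ c′ (ι i) (ι (ℕ.pred i)) (ι j) (ι (ℕ.pred j)) (ι l) (ι (ℕ.pred l))
      (φ (ℕ.pred (ℕ.pred i) , j , l)) (φ (i , ℕ.pred (ℕ.pred j) , l)) (φ (i , j , ℕ.pred (ℕ.pred l)))
      (φ (ℕ.pred i , ℕ.pred j , l)) (φ (ℕ.pred i , j , ℕ.pred l)) (φ (i , ℕ.pred j , ℕ.pred l))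

  swap : ∀ P e f φ → ⟪ P , Δ e (Δ f φ) ⟫ ≡ ⟪ P , Δ f (Δ e φ) ⟫
  swap P e f φ = pairing-cong P (Δ-comm e f φ)

  swap′ : ∀ P e f g φ → ⟪ P , Δ e (Δ f (Δ g φ)) ⟫ ≡ ⟪ P , Δ e (Δ g (Δ f φ)) ⟫
  swap′ P e f g φ = pairing-cong P (Δ-cong e (Δ-comm f g φ))

  -- The factor `k` avoids division: directions will be expressed in a frame only after
  -- multiplication by a square.
  record Combination (k : Carrier) (e : Point) (α β γ : Carrier) (f g h : Point) : Set where
    constructor combination
    field
      first  : k * proj₁ e ≡ α * proj₁ f + β * proj₁ g + γ * proj₁ h
      second : k * proj₁ (proj₂ e) ≡ α * proj₁ (proj₂ f) + β * proj₁ (proj₂ g) + γ * proj₁ (proj₂ h)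
      third  : k * proj₂ (proj₂ e) ≡ α * proj₂ (proj₂ f) + β * proj₂ (proj₂ g) + γ * proj₂ (proj₂ h)

  Δ-linear : ∀ P {k e α β γ f g h} → Combination k e α β γ f g h → ∀ φ →
    k * ⟪ P , Δ e φ ⟫ ≡ α * ⟪ P , Δ f φ ⟫ + β * ⟪ P , Δ g φ ⟫ + γ * ⟪ P , Δ h φ ⟫
  Δ-linear [] {k} {_} {α} {β} {γ} _ φ =
    solve 4 (λ k α β γ → k :* 0ₖ := α :* 0ₖ :+ β :* 0ₖ :+ γ :* 0ₖ) refl k α β γ
  Δ-linear ((c , m@(i , j , l)) ∷ P) {k} {e₁ , e₂ , e₃} {α} {β} {γ} {f₁ , f₂ , f₃} {g₁ , g₂ , g₃} {h₁ , h₂ , h₃}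
           C@(combination eq₁ eq₂ eq₃) φ = begin
    k * (c * (e₁ * A + e₂ * B + e₃ * D) + ⟪ P , Δ (e₁ , e₂ , e₃) φ ⟫)
      ≡⟨ solve 9 (λ k c e₁ e₂ e₃ A B D r → k :* (c :* (e₁ :* A :+ e₂ :* B :+ e₃ :* D) :+ r)
           := c :* ((k :* e₁) :* A :+ (k :* e₂) :* B :+ (k :* e₃) :* D) :+ k :* r) refl k c e₁ e₂ e₃ A B D _ ⟩
    c * ((k * e₁) * A + (k * e₂) * B + (k * e₃) * D) + k * ⟪ P , Δ (e₁ , e₂ , e₃) φ ⟫
      ≡⟨ cong₂ _+_ (cong (c *_) (cong₂ _+_ (cong₂ _+_ (cong (_* A) eq₁) (cong (_* B) eq₂)) (cong (_* D) eq₃)))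
           (Δ-linear P C φ) ⟩
    c * ((α * f₁ + β * g₁ + γ * h₁) * A + (α * f₂ + β * g₂ + γ * h₂) * B + (α * f₃ + β * g₃ + γ * h₃) * D)
      + (α * ⟪ P , Δ (f₁ , f₂ , f₃) φ ⟫ + β * ⟪ P , Δ (g₁ , g₂ , g₃) φ ⟫ + γ * ⟪ P , Δ (h₁ , h₂ , h₃) φ ⟫)
      ≡⟨ solve 19 (λ c α β γ A B D f₁ f₂ f₃ g₁ g₂ g₃ h₁ h₂ h₃ r s t →
           c :* ((α :* f₁ :+ β :* g₁ :+ γ :* h₁) :* A :+ (α :* f₂ :+ β :* g₂ :+ γ :* h₂) :* B
                 :+ (α :* f₃ :+ β :* g₃ :+ γ :* h₃) :* D) :+ (α :* r :+ β :* s :+ γ :* t)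
           := α :* (c :* (f₁ :* A :+ f₂ :* B :+ f₃ :* D) :+ r) :+ β :* (c :* (g₁ :* A :+ g₂ :* B :+ g₃ :* D) :+ s)
                :+ γ :* (c :* (h₁ :* A :+ h₂ :* B :+ h₃ :* D) :+ t)) refl
           c α β γ A B D f₁ f₂ f₃ g₁ g₂ g₃ h₁ h₂ h₃ _ _ _ ⟩
    _ ∎
    where
    A = ι i * φ (ℕ.pred i , j , l)
    B = ι j * φ (i , ℕ.pred j , l)
    D = ι l * φ (i , j , ℕ.pred l)

  -- A curve of functionals, polynomial on each monomial with degree at most that of the monomial.
  -- Pairing it with a polynomial of degree δ gives a polynomial of degree δ in the parameter, to
  -- which zero counting applies.
  Family : (Carrier → Functional) → (Carrier → Functional) → Set
  Family φ φ′ = ∀ m → Pol (degree m) (λ s → φ s m) (λ s → φ′ s m)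

  Family-Δ : ∀ e {φ φ′} → Family φ φ′ → Family (λ s → Δ e (φ s)) (λ s → Δ e (φ′ s))
  Family-Δ (a , b , c) Φ m@(i , j , l) = Pol-+ (Pol-+
    (Pol-scale a (Pol-scale (ι i) (Pol-≤ (ℕ.+-monoˡ-≤ l (ℕ.+-monoˡ-≤ j (ℕ.pred[n]≤n {i}))) (Φ _))))
    (Pol-scale b (Pol-scale (ι j) (Pol-≤ (ℕ.+-monoˡ-≤ l (ℕ.+-monoʳ-≤ i (ℕ.pred[n]≤n {j}))) (Φ _)))))
    (Pol-scale c (Pol-scale (ι l) (Pol-≤ (ℕ.+-monoʳ-≤ (i ℕ.+ j) (ℕ.pred[n]≤n {l})) (Φ _))))

  Family-pairing : ∀ {δ} P → Degree≤ δ P → ∀ {φ φ′} → Family φ φ′ →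
                   Pol δ (λ s → ⟪ P , φ s ⟫) (λ s → ⟪ P , φ′ s ⟫)
  Family-pairing [] _ Φ = Pol-const 0#
  Family-pairing ((c , m) ∷ P) (d ∷ ds) Φ = Pol-+ (Pol-scale c (Pol-≤ d (Φ m))) (Family-pairing P ds Φ)

  Pol-^ : ∀ n a b → Pol n (λ s → (a + s * b) ^ n) (λ s → b * (ι n * (a + s * b) ^ ℕ.pred n))
  Pol-^ zero a b = Pol-resp (λ _ → refl) (λ s → solve 1 (λ b → b :* (0ₖ :* 1ₖ) := 0ₖ) refl b) (Pol-const 1#)
  Pol-^ (suc n) a b = Pol-resp (λ _ → refl) (eq n) (Pol-* {m = 1} (Pol-affine a b) (Pol-^ n a b))
    where
    eq : ∀ n s → b * (ι (suc n) * (a + s * b) ^ n)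
               ≡ b * (a + s * b) ^ n + (a + s * b) * (b * (ι n * (a + s * b) ^ ℕ.pred n))
    eq zero s = solve 2 (λ b t → b :* ((1ₖ :+ 0ₖ) :* 1ₖ) := b :* 1ₖ :+ t :* (b :* (0ₖ :* 1ₖ))) refl b (a + s * b)
    eq (suc n) s = solve 4 (λ b t i x → b :* ((1ₖ :+ i) :* (t :* x)) := b :* (t :* x) :+ t :* (b :* (i :* x))) refl
      b (a + s * b) (ι (suc n)) ((a + s * b) ^ n)

  -- The chain rule: the parameter derivative along a line is the derivative in its direction.
  Family-at : ∀ a b c a′ b′ c′ → Family (λ s → at (a + s * a′ , b + s * b′ , c + s * c′))
                                        (λ s → Δ (a′ , b′ , c′) (at (a + s * a′ , b + s * b′ , c + s * c′)))
  Family-at a b c a′ b′ c′ (i , j , l) = Pol-resp (λ _ → refl)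
    (λ s → solve 12 (λ a b c I J L x y z x′ y′ z′ →
         a :* (I :* (x′ :* y :* z)) :+ b :* (J :* (x :* y′ :* z)) :+ c :* (L :* (x :* y :* z′))
      := (a :* (I :* x′) :* y :+ x :* (b :* (J :* y′))) :* z :+ x :* y :* (c :* (L :* z′))) refl
      a′ b′ c′ (ι i) (ι j) (ι l) ((a + s * a′) ^ i) ((b + s * b′) ^ j) ((c + s * c′) ^ l)
      ((a + s * a′) ^ ℕ.pred i) ((b + s * b′) ^ ℕ.pred j) ((c + s * c′) ^ ℕ.pred l))
    (Pol-* (Pol-* (Pol-^ i a a′) (Pol-^ j b b′)) (Pol-^ l c c′))

length-split : ∀ {A : Set} {P : A → Set} (P? : ∀ x → Dec (P x)) xs →
               length xs ≡ length (filter P? xs) ℕ.+ length (filter (λ x → ¬? (P? x)) xs)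
length-split P? [] = ≡.refl
length-split P? (x ∷ xs) with P? x
... | yes _ = ≡.cong suc (length-split P? xs)
... | no _ = ≡.trans (≡.cong suc (length-split P? xs)) (≡.sym (ℕ.+-suc _ _))

Unique-map-filter : ∀ {A B : Set} {f : A → B} {P : A → Set} (P? : ∀ x → Dec (P x)) xs →
                    Unique (map f xs) → Unique (map f (filter P? xs))
Unique-map-filter P? [] _ = []
Unique-map-filter P? (x ∷ xs) (n ∷ u) with P? x
... | no _ = Unique-map-filter P? xs u
... | yes _ = All.map⁺ (All.filter⁺ P? (All.map⁻ n)) ∷ Unique-map-filter P? xs u

-- Contact at the crossings of lines

module CrossingIdentities (F : Field) where
  open Field F
  open FieldProperties F
  open ≡ using (refl; sym; trans; cong; module ≡-Reasoning)
  open ≡-Reasoning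

  -- In the frame of null directions σ² e₁ + ρ² e₂ + σρ e₃, and with first and second derivatives
  -- along `e₂` zero, the null direction (f₃ : - f₁) is tangent. This is the second derivative along
  -- it, divided by `f₃`.
  tangency : (f₁ f₃ f₁₁ f₁₃ f₁₂ f₃₃ f₂₃ : Carrier) → Carrier
  tangency f₁ f₃ f₁₁ f₁₃ f₁₂ f₃₃ f₂₃ =
    f₃ * f₃ * (f₃ * f₁₁ - (f₁ + f₁) * f₁₃) + f₁ * f₁ * (f₃ * (f₃₃ + (f₁₂ + f₁₂)) - (f₁ + f₁) * f₂₃)

  -- After multiplication by σ³ the form depends on `f₁` only through σ f₁ = - ρ f₃. Clearing
  -- denominators in this way also covers `f₃` = 0.
  tangency-zero : ∀ {σ} ρ f₁ f₃ f₁₁ f₁₃ f₁₂ f₃₃ f₂₃ → σ ≢ 0# →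
    σ * σ * f₁ + σ * ρ * f₃ ≡ 0# →
    σ * σ * (σ * σ * f₁₁ + ρ * ρ * f₁₂ + σ * ρ * f₁₃) + ρ * ρ * (σ * σ * f₁₂ + σ * ρ * f₂₃)
      + σ * ρ * (σ * σ * f₁₃ + ρ * ρ * f₂₃ + σ * ρ * f₃₃) ≡ 0# →
    tangency f₁ f₃ f₁₁ f₁₃ f₁₂ f₃₃ f₂₃ ≡ 0#
  tangency-zero {σ} ρ f₁ f₃ f₁₁ f₁₃ f₁₂ f₃₃ f₂₃ σ≢0 h₁ h₂ =
    *-cancel σ≢0 (*-cancel σ≢0 (*-cancel σ≢0 (begin
      σ * (σ * (σ * tangency f₁ f₃ f₁₁ f₁₃ f₁₂ f₃₃ f₂₃))
        ≡⟨ solve 8 (λ σ f₁ f₃ f₁₁ f₁₃ f₁₂ f₃₃ f₂₃ →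
             σ :* (σ :* (σ :* (f₃ :* f₃ :* (f₃ :* f₁₁ :- (f₁ :+ f₁) :* f₁₃)
               :+ f₁ :* f₁ :* (f₃ :* (f₃₃ :+ (f₁₂ :+ f₁₂)) :- (f₁ :+ f₁) :* f₂₃))))
             := Gₖ σ (σ :* f₁) f₃ f₁₁ f₁₃ f₁₂ f₃₃ f₂₃) refl σ f₁ f₃ f₁₁ f₁₃ f₁₂ f₃₃ f₂₃ ⟩
      G (σ * f₁) ≡⟨ cong G σf₁≡ ⟩
      G (- (ρ * f₃))
        ≡⟨ solve 8 (λ σ ρ f₃ f₁₁ f₁₃ f₁₂ f₃₃ f₂₃ → Gₖ σ (:- (ρ :* f₃)) f₃ f₁₁ f₁₃ f₁₂ f₃₃ f₂₃
             := f₃ :* f₃ :* f₃ :* (σ :* (σ :* σ :* f₁₁ :+ (ρ :* ρ :* (f₁₂ :+ f₁₂) :+ ρ :* ρ :* f₃₃) :+ σ :* ρ :* (f₁₃ :+ f₁₃))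
                  :+ ρ :* ρ :* ρ :* (f₂₃ :+ f₂₃))) refl σ ρ f₃ f₁₁ f₁₃ f₁₂ f₃₃ f₂₃ ⟩
      f₃ * f₃ * f₃ * H ≡⟨ cong (f₃ * f₃ * f₃ *_) H≡0 ⟩
      f₃ * f₃ * f₃ * 0# ≡⟨ zeroʳ _ ⟩
      0# ∎)))
    where
    Gₖ : ∀ {n} (σ a f₃ f₁₁ f₁₃ f₁₂ f₃₃ f₂₃ : Polynomial n) → Polynomial n
    Gₖ σ a f₃ f₁₁ f₁₃ f₁₂ f₃₃ f₂₃ = σ :* f₃ :* f₃ :* (σ :* σ :* f₃ :* f₁₁ :- σ :* (a :+ a) :* f₁₃)
      :+ a :* a :* (σ :* f₃ :* (f₃₃ :+ (f₁₂ :+ f₁₂)) :- (a :+ a) :* f₂₃)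

    G : Carrier → Carrier
    G a = σ * f₃ * f₃ * (σ * σ * f₃ * f₁₁ - σ * (a + a) * f₁₃)
      + a * a * (σ * f₃ * (f₃₃ + (f₁₂ + f₁₂)) - (a + a) * f₂₃)

    H = σ * (σ * σ * f₁₁ + (ρ * ρ * (f₁₂ + f₁₂) + ρ * ρ * f₃₃) + σ * ρ * (f₁₃ + f₁₃)) + ρ * ρ * ρ * (f₂₃ + f₂₃)

    σf₁≡ : σ * f₁ ≡ - (ρ * f₃)
    σf₁≡ = -‿≡0 (*-cancel σ≢0 (trans
      (solve 4 (λ σ ρ f₁ f₃ → σ :* (σ :* f₁ :- :- (ρ :* f₃)) := σ :* σ :* f₁ :+ σ :* ρ :* f₃) refl σ ρ f₁ f₃) h₁))

    H≡0 : H ≡ 0#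
    H≡0 = *-cancel σ≢0 (trans (solve 7 (λ σ ρ f₁₁ f₁₃ f₁₂ f₃₃ f₂₃ →
      σ :* (σ :* (σ :* σ :* f₁₁ :+ (ρ :* ρ :* (f₁₂ :+ f₁₂) :+ ρ :* ρ :* f₃₃) :+ σ :* ρ :* (f₁₃ :+ f₁₃)) :+ ρ :* ρ :* ρ :* (f₂₃ :+ f₂₃))
      := σ :* σ :* (σ :* σ :* f₁₁ :+ ρ :* ρ :* f₁₂ :+ σ :* ρ :* f₁₃) :+ ρ :* ρ :* (σ :* σ :* f₁₂ :+ σ :* ρ :* f₂₃)
         :+ σ :* ρ :* (σ :* σ :* f₁₃ :+ ρ :* ρ :* f₂₃ :+ σ :* ρ :* f₃₃)) refl σ ρ f₁₁ f₁₃ f₁₂ f₃₃ f₂₃) h₂)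

  -- Where `f₁` and `f₁₁` vanish, the second summand of `tangency`, a multiple of f₁², has
  -- derivative zero, and in the first summand only the bracket needs to be differentiated.
  tangency-derivative : ∀ {f₁ f₃ f₁₁ f₁₃ f₁′ f₃′ f₁₁′ f₁₃′ y y′} → f₁ ≡ 0# → f₁₁ ≡ 0# →
    (f₃′ * f₃ + f₃ * f₃′) * (f₃ * f₁₁ - (f₁ + f₁) * f₁₃)
      + f₃ * f₃ * ((f₃′ * f₁₁ + f₃ * f₁₁′) - ((f₁′ + f₁′) * f₁₃ + (f₁ + f₁) * f₁₃′))
      + ((f₁′ * f₁ + f₁ * f₁′) * y + f₁ * f₁ * y′) ≡ 0# →
    f₃ * f₃ * (f₃ * f₁₁′ - (f₁′ + f₁′) * f₁₃) ≡ 0#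
  tangency-derivative {f₃ = f₃} {f₁₃ = f₁₃} {f₁′} {f₃′} {f₁₁′} {f₁₃′} {y} {y′} refl refl h = trans
    (solve 8 (λ f₃ f₁₃ f₁′ f₃′ f₁₁′ f₁₃′ y y′ →
         f₃ :* f₃ :* (f₃ :* f₁₁′ :- (f₁′ :+ f₁′) :* f₁₃)
      := (f₃′ :* f₃ :+ f₃ :* f₃′) :* (f₃ :* 0ₖ :- (0ₖ :+ 0ₖ) :* f₁₃)
         :+ f₃ :* f₃ :* ((f₃′ :* 0ₖ :+ f₃ :* f₁₁′) :- ((f₁′ :+ f₁′) :* f₁₃ :+ (0ₖ :+ 0ₖ) :* f₁₃′))
         :+ ((f₁′ :* 0ₖ :+ 0ₖ :* f₁′) :* y :+ 0ₖ :* 0ₖ :* y′)) refl f₃ f₁₃ f₁′ f₃′ f₁₁′ f₁₃′ y y′) h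

  affine-numerator : ∀ τ a a₁ a₂ b b₁ b₂ f₃ f₁₂ f₁₁₂ f₁₃ → τ ≢ 0# → a + τ * b ≡ 0# → f₃ ≡ τ * a →
    f₁₂ ≡ τ * (a₁ + τ * b₁) → f₁₁₂ ≡ τ * (a₂ + τ * b₂) → f₁₃ ≡ τ * a₁ →
    f₃ * f₃ * (f₃ * f₁₁₂ - (f₁₂ + f₁₂) * f₁₃) ≡ 0# →
    (b₂ * a - b * a₂) * a ≡ (a₁ + a₁) * (b₁ * a - b * a₁)
  affine-numerator τ a a₁ a₂ b b₁ b₂ f₃ f₁₂ f₁₁₂ f₁₃ τ≢0 h refl refl refl refl star with a ≟ 0#
  ... | yes refl = trans (solve 5 (λ a₁ a₂ b b₁ b₂ → (b₂ :* 0ₖ :- b :* a₂) :* 0ₖ := 0ₖ) refl a₁ a₂ b b₁ b₂)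
      (sym (trans (cong (λ b → (a₁ + a₁) * (b₁ * 0# - b * a₁)) b≡0)
        (solve 2 (λ a₁ b₁ → (a₁ :+ a₁) :* (b₁ :* 0ₖ :- 0ₖ :* a₁) := 0ₖ) refl a₁ b₁)))
      where
      b≡0 : b ≡ 0#
      b≡0 = *-cancel τ≢0 (trans (sym (+-identityˡ _)) h)
  ... | no a≢0 = -‿≡0 (*-cancel τ≢0 (begin
      τ * ((b₂ * a - b * a₂) * a - (a₁ + a₁) * (b₁ * a - b * a₁))
        ≡⟨ solve 7 (λ τ a a₁ a₂ b b₁ b₂ → τ :* ((b₂ :* a :- b :* a₂) :* a :- (a₁ :+ a₁) :* (b₁ :* a :- b :* a₁))
             := a :* (τ :* b₂ :* a :- (a₁ :+ a₁) :* (τ :* b₁)) :- (τ :* b) :* (a₂ :* a :- (a₁ :+ a₁) :* a₁)) refl τ a a₁ a₂ b b₁ b₂ ⟩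
      a * (τ * b₂ * a - (a₁ + a₁) * (τ * b₁)) - (τ * b) * (a₂ * a - (a₁ + a₁) * a₁)
        ≡⟨ cong (λ t → a * (τ * b₂ * a - (a₁ + a₁) * (τ * b₁)) - t * (a₂ * a - (a₁ + a₁) * a₁)) τb≡ ⟩
      a * (τ * b₂ * a - (a₁ + a₁) * (τ * b₁)) - (- a) * (a₂ * a - (a₁ + a₁) * a₁)
        ≡⟨ solve 6 (λ τ a a₁ a₂ b₁ b₂ →
             a :* (τ :* b₂ :* a :- (a₁ :+ a₁) :* (τ :* b₁)) :- (:- a) :* (a₂ :* a :- (a₁ :+ a₁) :* a₁)
             := a :* (a :* (a₂ :+ τ :* b₂) :- ((a₁ :+ τ :* b₁) :+ (a₁ :+ τ :* b₁)) :* a₁)) refl τ a a₁ a₂ b₁ b₂ ⟩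
      a * (a * (a₂ + τ * b₂) - ((a₁ + τ * b₁) + (a₁ + τ * b₁)) * a₁)
        ≡⟨ cong (a *_) bracket ⟩
      a * 0# ≡⟨ zeroʳ a ⟩
      0# ∎))
      where
      τb≡ : τ * b ≡ - a
      τb≡ = -‿≡0 (trans (solve 2 (λ a t → t :- :- a := a :+ t) refl a (τ * b)) h)
      τa≢0 = *-nonzero τ≢0 a≢0
      bracket : a * (a₂ + τ * b₂) - ((a₁ + τ * b₁) + (a₁ + τ * b₁)) * a₁ ≡ 0#
      bracket = *-cancel τ≢0 (*-cancel τ≢0 (trans
        (solve 6 (λ τ a a₁ a₂ b₁ b₂ → τ :* (τ :* (a :* (a₂ :+ τ :* b₂) :- ((a₁ :+ τ :* b₁) :+ (a₁ :+ τ :* b₁)) :* a₁))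
          := (τ :* a) :* (τ :* (a₂ :+ τ :* b₂)) :- (τ :* (a₁ :+ τ :* b₁) :+ τ :* (a₁ :+ τ :* b₁)) :* (τ :* a₁)) refl τ a a₁ a₂ b₁ b₂)
        (*-cancel (*-nonzero τa≢0 τa≢0) star)))

module Crossings (F : Field) (p : ℕ)
  (char : ∀ n → suc n < p → FieldProperties.ι F (suc n) ≢ Field.0# F) where
  open Field F
  open FieldProperties F
  open PolynomialFunctions F
  open TrivariatePolynomials F
  open Characteristic F p char
  open CrossingIdentities F
  open ≡ using (refl; sym; trans; cong; cong₂; subst; module ≡-Reasoning)
  open ≡-Reasoning

  Line = Carrier × Carrier × Carrier

  direction : Carrier → Point
  direction x = x * x , x , 1#

  -- The line of symmetric matrices (u v ; v w) with (u v ; v w) (1 , - x) = (z , y).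
  point : Line → Carrier → Point
  point (x , y , z) w = (z + x * y) + w * (x * x) , y + w * x , 0# + w * 1#

  -- One parameter serves both lines, because it is the third coordinate of the point.
  record Cross (ℓ m : Line) (w : Carrier) : Set where
    constructor cross
    field
      distinct : proj₁ ℓ ≢ proj₁ m
      meet     : point ℓ w ≡ point m w

  Family-line : ∀ ℓ → Family (λ s → at (point ℓ s)) (λ s → Δ (direction (proj₁ ℓ)) (at (point ℓ s)))
  Family-line (x , y , z) = Family-at (z + x * y) y 0# (x * x) x 1#

  module _ {δ} (P : Polynomial₃) (P≤δ : Degree≤ δ P) (deg<p : 3 ℕ.+ (δ ℕ.+ δ ℕ.+ δ ℕ.+ δ) < p) where

    Contains : Line → Set
    Contains ℓ = ∀ w → ⟪ P , at (point ℓ w) ⟫ ≡ 0#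

    -- Crossings are counted by distinct points rather than by distinct lines, since they serve as
    -- zeros of one-variable polynomials along `ℓ`.
    record Crossed (ℓ : Line) (N : ℕ) : Set where
      field
        crossings : List (Carrier × Line)
        unique    : Unique (map proj₁ crossings)
        crossing  : All (λ c → Cross ℓ (proj₂ c) (proj₁ c) × Contains (proj₂ c)) crossings
        many      : N < length crossings

    δ<p : δ < p
    δ<p = ℕ.≤-<-trans (ℕ.≤-trans (ℕ.m≤m+n δ δ) (ℕ.≤-trans (ℕ.m≤m+n _ δ) (ℕ.≤-trans (ℕ.m≤m+n _ δ) (ℕ.m≤n+m _ 3)))) deg<p

    Pol-zero-everywhere : ∀ {f f′} → Pol δ f f′ → (∀ w → f w ≡ 0#) → ∀ w → f′ w ≡ 0#
    Pol-zero-everywhere {f} Q f≡0 = proj₂ (Pol-zeros Q (points-unique ℕ.≤-refl) (All.universal f≡0 _)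
      (ℕ.<-≤-trans δ<p (ℕ.≤-reflexive (sym (List.length-applyUpTo ι p)))))

    pairing-family : ∀ {φ φ′} → Family φ φ′ → Pol δ (λ s → ⟪ P , φ s ⟫) (λ s → ⟪ P , φ′ s ⟫)
    pairing-family = Family-pairing P P≤δ

    contains₁ : ∀ {ℓ} → Contains ℓ → ∀ w → ⟪ P , Δ (direction (proj₁ ℓ)) (at (point ℓ w)) ⟫ ≡ 0#
    contains₁ {ℓ} c = Pol-zero-everywhere (pairing-family (Family-line ℓ)) c

    contains₂ : ∀ {ℓ} → Contains ℓ → ∀ w →
      ⟪ P , Δ (direction (proj₁ ℓ)) (Δ (direction (proj₁ ℓ)) (at (point ℓ w))) ⟫ ≡ 0#
    contains₂ {ℓ} c = Pol-zero-everywhere (pairing-family (Family-Δ _ (Family-line ℓ))) (contains₁ c)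

    contains₃ : ∀ {ℓ} → Contains ℓ → ∀ w →
      ⟪ P , Δ (direction (proj₁ ℓ)) (Δ (direction (proj₁ ℓ)) (Δ (direction (proj₁ ℓ)) (at (point ℓ w)))) ⟫ ≡ 0#
    contains₃ {ℓ} c = Pol-zero-everywhere (pairing-family (Family-Δ _ (Family-Δ _ (Family-line ℓ)))) (contains₂ c)

    -- The frame comes from both directions, but `φ` runs along `m`: the relation `Φ` is found at
    -- the crossings of `m` and then differentiated along `m` at the point where it meets `ℓ`.
    module Transversal {ℓ m : Line} {w₀ : Carrier} (ℓ⊂P : Contains ℓ) (m⊂P : Contains m) (X : Cross ℓ m w₀) where
      private
        x = proj₁ ℓ
        x′ = proj₁ m
        e₁ = direction x
        e₂ = direction x′
        τ = x′ - x

        -- Null directions are (σ : ρ) ↦ σ² e₁ + ρ² e₂ + σρ e₃.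
        e₃ : Point
        e₃ = x * x′ + x * x′ , x + x′ , 1# + 1#

        φ : Carrier → Functional
        φ s = at (point m s)

        f₁ f₃ f₁₁ f₁₃ f₁₂ f₃₃ f₂₃ : Carrier → Carrier
        f₁ s = ⟪ P , Δ e₁ (φ s) ⟫
        f₃ s = ⟪ P , Δ e₃ (φ s) ⟫
        f₁₁ s = ⟪ P , Δ e₁ (Δ e₁ (φ s)) ⟫
        f₁₃ s = ⟪ P , Δ e₁ (Δ e₃ (φ s)) ⟫
        f₁₂ s = ⟪ P , Δ e₁ (Δ e₂ (φ s)) ⟫
        f₃₃ s = ⟪ P , Δ e₃ (Δ e₃ (φ s)) ⟫
        f₂₃ s = ⟪ P , Δ e₂ (Δ e₃ (φ s)) ⟫

        φ-fam : Family φ (λ s → Δ e₂ (φ s))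
        φ-fam = Family-line m

        Φ : Carrier → Carrier
        Φ s = tangency (f₁ s) (f₃ s) (f₁₁ s) (f₁₃ s) (f₁₂ s) (f₃₃ s) (f₂₃ s)

        D₁ = pairing-family (Family-Δ e₁ φ-fam)
        D₃ = pairing-family (Family-Δ e₃ φ-fam)
        D₁₃ = pairing-family (Family-Δ e₁ (Family-Δ e₃ φ-fam))

        Φ-Pol : Pol (δ ℕ.+ δ ℕ.+ (δ ℕ.+ δ)) Φ _
        Φ-Pol = Pol-+
          (Pol-* (Pol-* D₃ D₃) (Pol-- (Pol-* D₃ (pairing-family (Family-Δ e₁ (Family-Δ e₁ φ-fam)))) (Pol-* (Pol-+ D₁ D₁) D₁₃)))
          (Pol-* (Pol-* D₁ D₁) (Pol--
            (Pol-* D₃ (Pol-+ (pairing-family (Family-Δ e₃ (Family-Δ e₃ φ-fam))) (Pol-+ D₁₂ D₁₂)))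
            (Pol-* (Pol-+ D₁ D₁) (pairing-family (Family-Δ e₂ (Family-Δ e₃ φ-fam))))))
          where D₁₂ = pairing-family (Family-Δ e₁ (Family-Δ e₂ φ-fam))

        -- The line `k` has a null direction other than that of `m`, and the polynomial vanishes on
        -- it, so its first and second derivatives in this direction are zero.
        Φ-zero : ∀ {k s} → Cross m k s → Contains k → Φ s ≡ 0#
        Φ-zero {k@(t , _)} {s} (cross x′≢t eq) k⊂P = tangency-zero ρ (f₁ s) (f₃ s) (f₁₁ s) (f₁₃ s) (f₁₂ s) (f₃₃ s) (f₂₃ s)
          (-‿≢0 x′≢t) h₁ h₂
          where
          σ = x′ - t
          ρ = t - x
          n = direction t

          -- The conic (t² , t , 1) in the coordinates (σ : ρ) in which x is (1 : 0) and x′ is (0 :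
          -- 1).
          C : Combination (τ * τ) n (σ * σ) (ρ * ρ) (σ * ρ) e₁ e₂ e₃
          C = combination
            (solve 3 (λ x x′ t → (x′ :- x) :* (x′ :- x) :* (t :* t) := (x′ :- t) :* (x′ :- t) :* (x :* x)
              :+ (t :- x) :* (t :- x) :* (x′ :* x′) :+ (x′ :- t) :* (t :- x) :* (x :* x′ :+ x :* x′)) refl x x′ t)
            (solve 3 (λ x x′ t → (x′ :- x) :* (x′ :- x) :* t := (x′ :- t) :* (x′ :- t) :* x
              :+ (t :- x) :* (t :- x) :* x′ :+ (x′ :- t) :* (t :- x) :* (x :+ x′)) refl x x′ t)
            (solve 3 (λ x x′ t → (x′ :- x) :* (x′ :- x) :* 1ₖ := (x′ :- t) :* (x′ :- t) :* 1ₖ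
              :+ (t :- x) :* (t :- x) :* 1ₖ :+ (x′ :- t) :* (t :- x) :* (1ₖ :+ 1ₖ)) refl x x′ t)

          n₁ : ⟪ P , Δ n (φ s) ⟫ ≡ 0#
          n₁ = trans (cong (λ q → ⟪ P , Δ n (at q) ⟫) eq) (contains₁ k⊂P s)

          n₂ : ⟪ P , Δ n (Δ n (φ s)) ⟫ ≡ 0#
          n₂ = trans (cong (λ q → ⟪ P , Δ n (Δ n (at q)) ⟫) eq) (contains₂ k⊂P s)

          drop₂ : ∀ a b c d e → b ≡ 0# → a * c + d * b + e ≡ a * c + e
          drop₂ a _ c d e refl = solve 4 (λ a c d e → a :* c :+ d :* 0ₖ :+ e := a :* c :+ e) refl a c d e

          h₁ : σ * σ * f₁ s + σ * ρ * f₃ s ≡ 0#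
          h₁ = begin
            σ * σ * f₁ s + σ * ρ * f₃ s ≡⟨ sym (drop₂ _ _ _ _ _ (contains₁ m⊂P s)) ⟩
            σ * σ * f₁ s + ρ * ρ * ⟪ P , Δ e₂ (φ s) ⟫ + σ * ρ * f₃ s ≡⟨ sym (Δ-linear P C (φ s)) ⟩
            τ * τ * ⟪ P , Δ n (φ s) ⟫ ≡⟨ cong (τ * τ *_) n₁ ⟩
            τ * τ * 0# ≡⟨ zeroʳ _ ⟩
            0# ∎

          mixed : ∀ e → τ * τ * ⟪ P , Δ e (Δ n (φ s)) ⟫ ≡
            σ * σ * ⟪ P , Δ e₁ (Δ e (φ s)) ⟫ + ρ * ρ * ⟪ P , Δ e₂ (Δ e (φ s)) ⟫ + σ * ρ * ⟪ P , Δ e₃ (Δ e (φ s)) ⟫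
          mixed e = trans (cong (τ * τ *_) (swap P e n (φ s))) (Δ-linear P C (Δ e (φ s)))

          h₂ : σ * σ * (σ * σ * f₁₁ s + ρ * ρ * f₁₂ s + σ * ρ * f₁₃ s) + ρ * ρ * (σ * σ * f₁₂ s + σ * ρ * f₂₃ s)
                 + σ * ρ * (σ * σ * f₁₃ s + ρ * ρ * f₂₃ s + σ * ρ * f₃₃ s) ≡ 0#
          h₂ = begin
            _ ≡⟨ cong₂ _+_ (cong₂ _+_
                   (cong (σ * σ *_) (trans (cong₂ (λ a b → σ * σ * f₁₁ s + ρ * ρ * a + σ * ρ * b)
                     (swap P e₁ e₂ (φ s)) (swap P e₁ e₃ (φ s))) (sym (mixed e₁))))
                   (cong (ρ * ρ *_) (trans (trans (cong (λ a → σ * σ * f₁₂ s + σ * ρ * a) (swap P e₂ e₃ (φ s)))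
                     (sym (drop₂ _ _ _ _ _ (contains₂ m⊂P s)))) (sym (mixed e₂)))))
                   (cong (σ * ρ *_) (sym (mixed e₃))) ⟩
            σ * σ * (τ * τ * a₁) + ρ * ρ * (τ * τ * a₂) + σ * ρ * (τ * τ * a₃)
              ≡⟨ solve 7 (λ σ₂ ρ₂ σρ τ₂ a₁ a₂ a₃ → σ₂ :* (τ₂ :* a₁) :+ ρ₂ :* (τ₂ :* a₂) :+ σρ :* (τ₂ :* a₃)
                   := τ₂ :* (σ₂ :* a₁ :+ ρ₂ :* a₂ :+ σρ :* a₃)) refl (σ * σ) (ρ * ρ) (σ * ρ) (τ * τ) a₁ a₂ a₃ ⟩
            τ * τ * (σ * σ * a₁ + ρ * ρ * a₂ + σ * ρ * a₃) ≡⟨ cong (τ * τ *_) (sym (Δ-linear P C (Δ n (φ s)))) ⟩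
            τ * τ * (τ * τ * ⟪ P , Δ n (Δ n (φ s)) ⟫) ≡⟨ cong (λ a → τ * τ * (τ * τ * a)) n₂ ⟩
            τ * τ * (τ * τ * 0#) ≡⟨ trans (cong (τ * τ *_) (zeroʳ _)) (zeroʳ _) ⟩
            0# ∎
            where
            a₁ = ⟪ P , Δ e₁ (Δ n (φ s)) ⟫
            a₂ = ⟪ P , Δ e₂ (Δ n (φ s)) ⟫
            a₃ = ⟪ P , Δ e₃ (Δ n (φ s)) ⟫

      -- More crossings than the degree of `Φ` make it zero along `m`, together with its derivative.
      -- As `ℓ` is contained, `f₁` and `f₁₁` vanish at `w₀`.
      third-order : Crossed m (δ ℕ.+ δ ℕ.+ (δ ℕ.+ δ)) →
        f₃ w₀ * f₃ w₀ * (f₃ w₀ * ⟪ P , Δ e₁ (Δ e₁ (Δ e₂ (φ w₀))) ⟫ - (f₁₂ w₀ + f₁₂ w₀) * f₁₃ w₀) ≡ 0#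
      third-order R = tangency-derivative
        (trans (cong (λ q → ⟪ P , Δ e₁ (at q) ⟫) (sym (Cross.meet X))) (contains₁ ℓ⊂P w₀))
        (trans (cong (λ q → ⟪ P , Δ e₁ (Δ e₁ (at q)) ⟫) (sym (Cross.meet X))) (contains₂ ℓ⊂P w₀))
        (proj₂ (Pol-zeros Φ-Pol unique
          (All.map⁺ (All.map (λ (c , k⊂P) → Φ-zero c k⊂P) crossing))
          (ℕ.<-≤-trans many (ℕ.≤-reflexive (sym (List.length-map proj₁ crossings))))) w₀)
        where open Crossed R

      -- Taylor expansion of (t² , t , 1) at x. Unlike `e₂` and `e₃`, the vectors (2 x , 1 , 0) and
      -- (1 , 0 , 0) depend on `ℓ` alone, so one pair of polynomials along `ℓ` serves all its
      -- crossings.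
      e₂-frame : Combination 1# e₂ 1# τ (τ * τ) e₁ (x + x , 1# , 0#) (1# , 0# , 0#)
      e₂-frame = combination
        (solve 2 (λ x x′ → 1ₖ :* (x′ :* x′) := 1ₖ :* (x :* x) :+ (x′ :- x) :* (x :+ x) :+ (x′ :- x) :* (x′ :- x) :* 1ₖ) refl x x′)
        (solve 2 (λ x x′ → 1ₖ :* x′ := 1ₖ :* x :+ (x′ :- x) :* 1ₖ :+ (x′ :- x) :* (x′ :- x) :* 0ₖ) refl x x′)
        (solve 2 (λ x x′ → 1ₖ :* 1ₖ := 1ₖ :* 1ₖ :+ (x′ :- x) :* 0ₖ :+ (x′ :- x) :* (x′ :- x) :* 0ₖ) refl x x′)

      e₃-frame : Combination 1# e₃ (1# + 1#) τ 0# e₁ (x + x , 1# , 0#) (1# , 0# , 0#)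
      e₃-frame = combination
        (solve 2 (λ x x′ → 1ₖ :* (x :* x′ :+ x :* x′) := (1ₖ :+ 1ₖ) :* (x :* x) :+ (x′ :- x) :* (x :+ x) :+ 0ₖ :* 1ₖ) refl x x′)
        (solve 2 (λ x x′ → 1ₖ :* (x :+ x′) := (1ₖ :+ 1ₖ) :* x :+ (x′ :- x) :* 1ₖ :+ 0ₖ :* 0ₖ) refl x x′)
        (solve 2 (λ x x′ → 1ₖ :* (1ₖ :+ 1ₖ) := (1ₖ :+ 1ₖ) :* 1ₖ :+ (x′ :- x) :* 0ₖ :+ 0ₖ :* 0ₖ) refl x x′)

      private
        A A′ A″ B B′ B″ : Functional → Carrier
        A ψ = ⟪ P , Δ (x + x , 1# , 0#) ψ ⟫
        A′ ψ = ⟪ P , Δ (x + x , 1# , 0#) (Δ e₁ ψ) ⟫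
        A″ ψ = ⟪ P , Δ (x + x , 1# , 0#) (Δ e₁ (Δ e₁ ψ)) ⟫
        B ψ = ⟪ P , Δ (1# , 0# , 0#) ψ ⟫
        B′ ψ = ⟪ P , Δ (1# , 0# , 0#) (Δ e₁ ψ) ⟫
        B″ ψ = ⟪ P , Δ (1# , 0# , 0#) (Δ e₁ (Δ e₁ ψ)) ⟫

        frame₂ : ∀ {f g} ψ → ⟪ P , Δ e₁ ψ ⟫ ≡ 0# → ⟪ P , Δ (x + x , 1# , 0#) ψ ⟫ ≡ f → ⟪ P , Δ (1# , 0# , 0#) ψ ⟫ ≡ g →
                 ⟪ P , Δ e₂ ψ ⟫ ≡ τ * (f + τ * g)
        frame₂ {f} {g} ψ z refl refl = begin
          ⟪ P , Δ e₂ ψ ⟫ ≡⟨ sym (*-identityˡ _) ⟩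
          1# * ⟪ P , Δ e₂ ψ ⟫ ≡⟨ Δ-linear P e₂-frame ψ ⟩
          1# * ⟪ P , Δ e₁ ψ ⟫ + τ * f + τ * τ * g ≡⟨ cong (λ a → 1# * a + τ * f + τ * τ * g) z ⟩
          1# * 0# + τ * f + τ * τ * g
            ≡⟨ solve 3 (λ τ f g → 1ₖ :* 0ₖ :+ τ :* f :+ τ :* τ :* g := τ :* (f :+ τ :* g)) refl τ f g ⟩
          τ * (f + τ * g) ∎

        frame₃ : ∀ ψ → ⟪ P , Δ e₁ ψ ⟫ ≡ 0# → ⟪ P , Δ e₃ ψ ⟫ ≡ τ * ⟪ P , Δ (x + x , 1# , 0#) ψ ⟫
        frame₃ ψ z = begin
          ⟪ P , Δ e₃ ψ ⟫ ≡⟨ sym (*-identityˡ _) ⟩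
          1# * ⟪ P , Δ e₃ ψ ⟫ ≡⟨ Δ-linear P e₃-frame ψ ⟩
          (1# + 1#) * ⟪ P , Δ e₁ ψ ⟫ + τ * f + 0# * g ≡⟨ cong (λ a → (1# + 1#) * a + τ * f + 0# * g) z ⟩
          (1# + 1#) * 0# + τ * f + 0# * g
            ≡⟨ solve 3 (λ τ f g → (1ₖ :+ 1ₖ) :* 0ₖ :+ τ :* f :+ 0ₖ :* g := τ :* f) refl τ f g ⟩
          τ * f ∎
          where
          f = ⟪ P , Δ (x + x , 1# , 0#) ψ ⟫
          g = ⟪ P , Δ (1# , 0# , 0#) ψ ⟫

        τ≢0 : τ ≢ 0#
        τ≢0 = -‿≢0 (λ e → Cross.distinct X (sym e))

        ψ = at (point ℓ w₀)

        ψ≡φ : ψ ≡ φ w₀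
        ψ≡φ = cong at (Cross.meet X)

      -- So B / A has the value - 1 / τ at a crossing where `A` is nonzero: the directions of all
      -- neighbours are encoded in one rational function along `ℓ`.
      transversal : A ψ + τ * B ψ ≡ 0#
      transversal = *-cancel τ≢0 (trans (sym (frame₂ ψ (contains₁ ℓ⊂P w₀) refl refl))
        (trans (cong (λ q → ⟪ P , Δ e₂ q ⟫) ψ≡φ) (contains₁ m⊂P w₀)))

      numerator-zero : Crossed m (δ ℕ.+ δ ℕ.+ (δ ℕ.+ δ)) →
        (B″ ψ * A ψ - B ψ * A″ ψ) * A ψ ≡ (A′ ψ + A′ ψ) * (B′ ψ * A ψ - B ψ * A′ ψ)
      numerator-zero R = affine-numerator τ (A ψ) (A′ ψ) (A″ ψ) (B ψ) (B′ ψ) (B″ ψ)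
        ⟪ P , Δ e₃ ψ ⟫ ⟪ P , Δ e₁ (Δ e₂ ψ) ⟫ ⟪ P , Δ e₁ (Δ e₁ (Δ e₂ ψ)) ⟫ ⟪ P , Δ e₁ (Δ e₃ ψ) ⟫
        τ≢0 transversal
        (frame₃ ψ (contains₁ ℓ⊂P w₀))
        (trans (swap P e₁ e₂ ψ) (frame₂ (Δ e₁ ψ) (contains₂ ℓ⊂P w₀) refl refl))
        (trans (swap′ P e₁ e₁ e₂ ψ) (trans (swap P e₁ e₂ (Δ e₁ ψ))
          (frame₂ (Δ e₁ (Δ e₁ ψ)) (contains₃ ℓ⊂P w₀) refl refl)))
        (trans (swap P e₁ e₃ ψ) (frame₃ (Δ e₁ ψ) (contains₂ ℓ⊂P w₀)))
        (≡.subst (λ q → ⟪ P , Δ e₃ q ⟫ * ⟪ P , Δ e₃ q ⟫ * (⟪ P , Δ e₃ q ⟫ * ⟪ P , Δ e₁ (Δ e₁ (Δ e₂ q)) ⟫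
          - (⟪ P , Δ e₁ (Δ e₂ q) ⟫ + ⟪ P , Δ e₁ (Δ e₂ q) ⟫) * ⟪ P , Δ e₁ (Δ e₃ q) ⟫) ≡ 0#) (sym ψ≡φ) (third-order R))

    module _ {ℓ : Line} (ℓ⊂P : Contains ℓ) (L : ℕ) (R : Crossed ℓ (δ ℕ.+ δ ℕ.+ (δ ℕ.+ δ) ℕ.+ L))
             (R′ : All (λ c → Crossed (proj₂ c) (δ ℕ.+ δ ℕ.+ (δ ℕ.+ δ))) (Crossed.crossings R))
             (not-collinear : ∀ c k {cs} → Unique (map proj₁ cs) → (∀ {d} → d ∈ cs → d ∈ Crossed.crossings R) →
               All (λ d → 1# + (proj₁ (proj₂ d) - proj₁ ℓ) * (c + proj₁ d * k) ≡ 0#) cs → length cs ≤ L) where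
      open Crossed R
      private
        x = proj₁ ℓ
        e₁ = direction x
        U V : Point
        U = 1# , 0# , 0#
        V = x + x , 1# , 0#
        4δ = δ ℕ.+ δ ℕ.+ (δ ℕ.+ δ)

        ψ : Carrier → Functional
        ψ s = at (point ℓ s)

        A A′ A″ B B′ B″ : Carrier → Carrier
        A s = ⟪ P , Δ V (ψ s) ⟫
        A′ s = ⟪ P , Δ V (Δ e₁ (ψ s)) ⟫
        A″ s = ⟪ P , Δ V (Δ e₁ (Δ e₁ (ψ s))) ⟫
        B s = ⟪ P , Δ U (ψ s) ⟫
        B′ s = ⟪ P , Δ U (Δ e₁ (ψ s)) ⟫
        B″ s = ⟪ P , Δ U (Δ e₁ (Δ e₁ (ψ s))) ⟫

        Pol-A : Pol δ A A′
        Pol-A = pairing-family (Family-Δ V (Family-line ℓ))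
        Pol-A′ : Pol δ A′ A″
        Pol-A′ = pairing-family (Family-Δ V (Family-Δ e₁ (Family-line ℓ)))
        Pol-A″ : Pol δ A″ _
        Pol-A″ = pairing-family (Family-Δ V (Family-Δ e₁ (Family-Δ e₁ (Family-line ℓ))))
        Pol-B : Pol δ B B′
        Pol-B = pairing-family (Family-Δ U (Family-line ℓ))
        Pol-B′ : Pol δ B′ B″
        Pol-B′ = pairing-family (Family-Δ U (Family-Δ e₁ (Family-line ℓ)))
        Pol-B″ : Pol δ B″ _
        Pol-B″ = pairing-family (Family-Δ U (Family-Δ e₁ (Family-Δ e₁ (Family-line ℓ))))

        zero-at-crossings : ∀ {n f f′} → Pol n f f′ → n ≤ 4δ → All (λ d → f (proj₁ d) ≡ 0#) crossings → ∀ w → f w ≡ 0#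
        zero-at-crossings Q n≤4δ z = proj₁ (Pol-zeros Q unique (All.map⁺ z)
          (ℕ.≤-<-trans n≤4δ (ℕ.≤-<-trans (ℕ.m≤m+n 4δ L) (ℕ.<-≤-trans many (ℕ.≤-reflexive (sym (List.length-map proj₁ crossings)))))))

        numerator : ∀ w → (B″ w * A w - B w * A″ w) * A w ≡ (A′ w + A′ w) * (B′ w * A w - B w * A′ w)
        numerator w = -‿≡0 (zero-at-crossings
          (Pol-- (Pol-* (Pol-- (Pol-* Pol-B″ Pol-A) (Pol-* Pol-B Pol-A″)) Pol-A)
                 (Pol-≤ (ℕ.≤-reflexive (sym (ℕ.+-assoc δ δ δ)))
                   (Pol-* (Pol-+ Pol-A′ Pol-A′) (Pol-- (Pol-* Pol-B′ Pol-A) (Pol-* Pol-B Pol-A′)))))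
          (ℕ.+-monoʳ-≤ (δ ℕ.+ δ) (ℕ.m≤m+n δ δ))
          (All.zipWith (λ ((c , m⊂P) , r) → x≡y⇒x-y≡0 (Transversal.numerator-zero ℓ⊂P m⊂P c r)) (crossing , R′)) w)

        module _ {a c k : Carrier} (Aa≢0 : A a ≢ 0#) (B≡ : ∀ w → B w ≡ (c + w * k) * A w) where
          A≟0 = λ (d : Carrier × Line) → A (proj₁ d) ≟ 0#
          zeros = filter A≟0 crossings
          others = filter (λ d → ¬? (A≟0 d)) crossings

          zeros≤ : length zeros ≤ δ
          zeros≤ = ℕ.≮⇒≥ λ δ<zeros → Aa≢0 (proj₁ (Pol-zeros Pol-A (Unique-map-filter A≟0 crossings unique)
            (All.map⁺ (All.all-filter A≟0 crossings))
            (ℕ.<-≤-trans δ<zeros (ℕ.≤-reflexive (sym (List.length-map proj₁ zeros))))) a)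

          affine : ∀ {d} → Cross ℓ (proj₂ d) (proj₁ d) × Contains (proj₂ d) → A (proj₁ d) ≢ 0# →
                   1# + (proj₁ (proj₂ d) - x) * (c + proj₁ d * k) ≡ 0#
          affine {w , m} (X , m⊂P) Aw≢0 = *-cancel Aw≢0 (trans
            (solve 3 (λ a τ q → a :* (1ₖ :+ τ :* q) := a :+ τ :* (q :* a)) refl (A w) (proj₁ m - x) (c + w * k))
            (trans (cong (λ b → A w + (proj₁ m - x) * b) (sym (B≡ w))) (Transversal.transversal ℓ⊂P m⊂P X)))

          others≤ : length others ≤ L
          others≤ = not-collinear c k (Unique-map-filter _ crossings unique) (λ d∈ → proj₁ (∈-filter⁻ _ d∈))
            (All.zipWith (λ (a≢0 , h) → affine h a≢0) (All.all-filter _ crossings , All.filter⁺ _ crossing))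

          not-affine : ⊥
          not-affine = ℕ.<-irrefl refl (ℕ.<-≤-trans many (ℕ.≤-trans
            (ℕ.≤-reflexive (length-split A≟0 crossings)) (ℕ.≤-trans (ℕ.+-mono-≤ zeros≤ others≤)
            (ℕ.+-monoˡ-≤ L (ℕ.≤-trans (ℕ.m≤m+n δ δ) (ℕ.m≤m+n _ _))))))

        -- Otherwise B / A is affine. Each crossing is then a zero of `A`, which happens at most δ
        -- times, or satisfies the affine relation, which happens at most `L` times; but there are
        -- more than 4 δ + L crossings.
        A-zero : ∀ w → A w ≡ 0#
        A-zero a = decidable-stable (A a ≟ 0#) λ Aa≢0 →
          let _ , _ , B≡ = quotient-affine Pol-A Pol-A′ Pol-B Pol-B′ deg<p numerator a Aa≢0 in not-affine Aa≢0 B≡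

        B-zero : ∀ w → B w ≡ 0#
        B-zero = zero-at-crossings Pol-B (ℕ.≤-trans (ℕ.m≤m+n δ δ) (ℕ.m≤m+n _ _)) (All.map (λ {d} → at-crossing {d}) crossing)
          where
          at-crossing : ∀ {d} → Cross ℓ (proj₂ d) (proj₁ d) × Contains (proj₂ d) → B (proj₁ d) ≡ 0#
          at-crossing {w , m} (X , m⊂P) = *-cancel (-‿≢0 (λ e → Cross.distinct X (sym e)))
            (trans (sym (+-identityˡ _)) (trans (cong (_+ (proj₁ m - x) * B w) (sym (A-zero w)))
              (Transversal.transversal ℓ⊂P m⊂P X)))

      gradient-zero : ∀ e w → ⟪ P , Δ e (at (point ℓ w)) ⟫ ≡ 0#
      gradient-zero e@(e₁′ , e₂′ , e₃′) w = begin
        ⟪ P , Δ e (ψ w) ⟫ ≡⟨ sym (*-identityˡ _) ⟩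
        1# * ⟪ P , Δ e (ψ w) ⟫ ≡⟨ Δ-linear P C (ψ w) ⟩
        e₃′ * ⟪ P , Δ e₁ (ψ w) ⟫ + β * A w + γ * B w
          ≡⟨ cong₂ _+_ (cong₂ _+_ (cong (e₃′ *_) (contains₁ ℓ⊂P w)) (cong (β *_) (A-zero w))) (cong (γ *_) (B-zero w)) ⟩
        e₃′ * 0# + β * 0# + γ * 0#
          ≡⟨ solve 3 (λ a b c → a :* 0ₖ :+ b :* 0ₖ :+ c :* 0ₖ := 0ₖ) refl e₃′ β γ ⟩
        0# ∎
        where
        -- The vectors `e₁`, `V`, `U` are unitriangular, so coordinates are found from the third
        -- entry upwards without division.
        β = e₂′ - e₃′ * x
        γ = e₁′ - e₃′ * (x * x) - β * (x + x)
        C : Combination 1# e e₃′ β γ e₁ V U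
        C = combination
          (solve 4 (λ a b c x → 1ₖ :* a := c :* (x :* x) :+ (b :- c :* x) :* (x :+ x)
             :+ (a :- c :* (x :* x) :- (b :- c :* x) :* (x :+ x)) :* 1ₖ) refl e₁′ e₂′ e₃′ x)
          (solve 4 (λ a b c x → 1ₖ :* b := c :* x :+ (b :- c :* x) :* 1ₖ
             :+ (a :- c :* (x :* x) :- (b :- c :* x) :* (x :+ x)) :* 0ₖ) refl e₁′ e₂′ e₃′ x)
          (solve 4 (λ a b c x → 1ₖ :* c := c :* 1ₖ :+ (b :- c :* x) :* 0ₖ
             :+ (a :- c :* (x :* x) :- (b :- c :* x) :* (x :+ x)) :* 0ₖ) refl e₁′ e₂′ e₃′ x)

-- A polynomial vanishing on the lines

length-cartesianProductWith : ∀ {A B C : Set} (f : A → B → C) xs ys →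
  length (cartesianProductWith f xs ys) ≡ length xs ℕ.* length ys
length-cartesianProductWith f [] ys = ≡.refl
length-cartesianProductWith f (x ∷ xs) ys = ≡.trans (List.length-++ (map (f x) ys))
  (≡.cong₂ ℕ._+_ (List.length-map (f x) ys) (length-cartesianProductWith f xs ys))

-- Conditions against monomials. A line costs 3 d + 1 conditions, since the monomials of
-- `box (suc d)` have degree up to 3 d; hence the 3 in the hypothesis.
fewer-conditions : ∀ n d → 3 ℕ.* suc n ≤ suc d ℕ.* suc d → suc n ℕ.* suc (3 ℕ.* d) < suc d ℕ.* (suc d ℕ.* suc d)
fewer-conditions n d size = begin
  suc (suc n ℕ.* suc (3 ℕ.* d)) ≤⟨ ℕ.*-monoʳ-< (suc n) (ℕ.≤-trans (ℕ.n≤1+n _) (ℕ.≤-reflexive (expand d))) ⟩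
  suc n ℕ.* (3 ℕ.* suc d) ≡⟨ regroup (suc n) (suc d) ⟩
  3 ℕ.* suc n ℕ.* suc d ≤⟨ ℕ.*-monoˡ-≤ (suc d) size ⟩
  suc d ℕ.* suc d ℕ.* suc d ≡⟨ ℕ.*-assoc (suc d) (suc d) (suc d) ⟩
  suc d ℕ.* (suc d ℕ.* suc d) ∎
  where
  open ℕ.≤-Reasoning
  expand : ∀ d → suc (suc (suc (3 ℕ.* d))) ≡ 3 ℕ.* suc d
  expand = solve-∀
  regroup : ∀ n d → n ℕ.* (3 ℕ.* d) ≡ 3 ℕ.* n ℕ.* d
  regroup = solve-∀

module LinearAlgebra (F : Field) where
  open Field F
  open FieldProperties F
  open TrivariatePolynomials F
  open ≡ using (refl; sym; trans; cong; cong₂)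

  scaleₚ : Carrier → Polynomial₃ → Polynomial₃
  scaleₚ k = map λ (c , m) → k * c , m

  pairing-scale : ∀ k P φ → ⟪ scaleₚ k P , φ ⟫ ≡ k * ⟪ P , φ ⟫
  pairing-scale k [] φ = sym (zeroʳ k)
  pairing-scale k ((c , m) ∷ P) φ = trans (cong (k * c * φ m +_) (pairing-scale k P φ))
    (solve 4 (λ k c f r → k :* c :* f :+ k :* r := k :* (c :* f :+ r)) refl k c (φ m) _)

  pairing-eliminate : ∀ P φ ψ a b → ⟪ P , (λ m → a * ψ m - b * φ m) ⟫ ≡ a * ⟪ P , ψ ⟫ - b * ⟪ P , φ ⟫
  pairing-eliminate [] φ ψ a b = solve 2 (λ a b → 0ₖ := a :* 0ₖ :- b :* 0ₖ) refl a b
  pairing-eliminate ((c , m) ∷ P) φ ψ a b = trans (cong (c * (a * ψ m - b * φ m) +_) (pairing-eliminate P φ ψ a b))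
    (solve 7 (λ a b c f g r s → c :* (a :* g :- b :* f) :+ (a :* s :- b :* r)
      := a :* (c :* g :+ s) :- b :* (c :* f :+ r)) refl a b c (φ m) (ψ m) _ _)

  pairing-zero : ∀ P {φ} → All (λ t → proj₁ t * φ (proj₂ t) ≡ 0#) P → ⟪ P , φ ⟫ ≡ 0#
  pairing-zero [] [] = refl
  pairing-zero (_ ∷ P) (z ∷ zs) = trans (cong₂ _+_ z (pairing-zero P zs)) (+-identityˡ 0#)

  proj₂-scaleₚ : ∀ k P → map proj₂ (scaleₚ k P) ≡ map proj₂ P
  proj₂-scaleₚ k P = sym (List.map-∘ P)

  -- Elimination without division: a functional that is zero on all monomials is dropped; any other
  -- has a pivot, which is removed from the remaining functionals and whose coefficient is fixed
  -- last. The permutation records that each monomial occurs once, as reading off coefficients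
  -- requires.
  underdetermined : ∀ n (R : List Functional) ms → length R ≡ n → n < length ms →
    ∃ λ P → map proj₂ P ↭ ms × Any (λ t → proj₁ t ≢ 0#) P × All (λ φ → ⟪ P , φ ⟫ ≡ 0#) R
  underdetermined zero [] (m ∷ ms) _ _ = (1# , m) ∷ map (0# ,_) ms ,
    ≡.subst (λ ks → m ∷ ks ↭ m ∷ ms) (sym (trans (sym (List.map-∘ ms)) (List.map-id ms))) ↭-refl , here 1≢0 , []
  underdetermined (suc n) (φ ∷ R) ms R≡n n<ms with All.all? (λ m → φ m ≟ 0#) ms
  ... | yes φ≡0 with underdetermined n R ms (ℕ.suc-injective R≡n) (ℕ.<-trans (ℕ.n<1+n _) n<ms)
  ... | P , perm , nz , zs = P , perm , nz , pairing-zero P (All.tabulate λ {t} t∈P →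
          trans (cong (proj₁ t *_) (All.lookup φ≡0 (∈-resp-↭ perm (∈-map⁺ proj₂ t∈P)))) (zeroʳ _)) ∷ zs
  underdetermined (suc n) (φ ∷ R) ms R≡n n<ms | no ¬φ≡0 with find (All.¬All⇒Any¬ (λ m → φ m ≟ 0#) ms ¬φ≡0)
  ... | m , m∈ms , φm≢0 with ∈-∃++ m∈ms
  ... | xs , ys , refl with underdetermined n (map (λ ψ k → φ m * ψ k - ψ m * φ k) R) (xs ++ ys)
          (trans (List.length-map _ R) (ℕ.suc-injective R≡n))
          (ℕ.≤-pred (ℕ.≤-trans n<ms (ℕ.≤-reflexive (trans (List.length-++-comm xs (m ∷ ys))
              (cong suc (List.length-++-comm ys xs))))))
  ... | P , perm , nz , zs = (- ⟪ P , φ ⟫ , m) ∷ scaleₚ (φ m) P ,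
          ↭-trans (prep m (≡.subst (_↭ xs ++ ys) (sym (proj₂-scaleₚ (φ m) P)) perm)) (↭-sym (shift m xs ys)) ,
          there (Any.map⁺ (Any.map (*-nonzero φm≢0) nz)) ,
          trans (cong (- ⟪ P , φ ⟫ * φ m +_) (pairing-scale (φ m) P φ))
            (solve 2 (λ r f → :- r :* f :+ f :* r := 0ₖ) refl ⟪ P , φ ⟫ (φ m)) ∷
          All.map (λ {ψ} z → trans (cong (- ⟪ P , φ ⟫ * ψ m +_) (pairing-scale (φ m) P ψ))
            (trans (solve 4 (λ r g f s → :- r :* g :+ f :* s := f :* s :- g :* r) refl ⟪ P , φ ⟫ (ψ m) (φ m) ⟪ P , ψ ⟫)
              (trans (sym (pairing-eliminate P φ ψ (φ m) (ψ m))) z))) (All.map⁻ zs)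

  pairing-single : ∀ P {φ c m} → Unique (map proj₂ P) → (c , m) ∈ P →
    (∀ {t} → t ∈ P → proj₂ t ≢ m → proj₁ t * φ (proj₂ t) ≡ 0#) → ⟪ P , φ ⟫ ≡ c * φ m
  pairing-single (_ ∷ P) (m∉ ∷ u) (here refl) zs =
    trans (cong (_ +_) (pairing-zero P (All.tabulate λ t∈P → zs (there t∈P)
      (λ e → All.lookup m∉ (∈-map⁺ proj₂ t∈P) (sym e))))) (+-identityʳ _)
  pairing-single (t ∷ P) (m∉ ∷ u) (there c∈) zs =
    trans (cong₂ _+_ (zs (here refl) (All.lookup m∉ (∈-map⁺ proj₂ c∈))) (pairing-single P u c∈ λ t∈ → zs (there t∈)))
      (+-identityˡ _)

  ∂₁ ∂₂ ∂₃ : Functional → Functional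
  ∂₁ φ (i , j , l) = ι i * φ (ℕ.pred i , j , l)
  ∂₂ φ (i , j , l) = ι j * φ (i , ℕ.pred j , l)
  ∂₃ φ (i , j , l) = ι l * φ (i , j , ℕ.pred l)

  -- Derivatives are needed as polynomials because the vanishing of the gradient is applied to them
  -- again. Their lists may repeat monomials, which pairings tolerate.
  partial₁ partial₂ partial₃ : Polynomial₃ → Polynomial₃
  partial₁ = map λ (c , i , j , l) → ι i * c , ℕ.pred i , j , l
  partial₂ = map λ (c , i , j , l) → ι j * c , i , ℕ.pred j , l
  partial₃ = map λ (c , i , j , l) → ι l * c , i , j , ℕ.pred l

  private
    rotate : ∀ n c f → ι n * c * f ≡ c * (ι n * f)
    rotate n c f = solve 3 (λ n c f → n :* c :* f := c :* (n :* f)) refl (ι n) c f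

  pairing-partial₁ : ∀ P φ → ⟪ partial₁ P , φ ⟫ ≡ ⟪ P , ∂₁ φ ⟫
  pairing-partial₁ [] φ = refl
  pairing-partial₁ ((c , i , _) ∷ P) φ = cong₂ _+_ (rotate i c _) (pairing-partial₁ P φ)

  pairing-partial₂ : ∀ P φ → ⟪ partial₂ P , φ ⟫ ≡ ⟪ P , ∂₂ φ ⟫
  pairing-partial₂ [] φ = refl
  pairing-partial₂ ((c , _ , j , _) ∷ P) φ = cong₂ _+_ (rotate j c _) (pairing-partial₂ P φ)

  pairing-partial₃ : ∀ P φ → ⟪ partial₃ P , φ ⟫ ≡ ⟪ P , ∂₃ φ ⟫
  pairing-partial₃ [] φ = refl
  pairing-partial₃ ((c , _ , _ , l) ∷ P) φ = cong₂ _+_ (rotate l c _) (pairing-partial₃ P φ)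

  degree-partial₁ : ∀ {δ P} → Degree≤ δ P → Degree≤ δ (partial₁ P)
  degree-partial₁ d = All.map⁺ (All.map (λ {(_ , i , j , l)} → ℕ.≤-trans (ℕ.+-monoˡ-≤ l (ℕ.+-monoˡ-≤ j (ℕ.pred[n]≤n {i})))) d)

  degree-partial₂ : ∀ {δ P} → Degree≤ δ P → Degree≤ δ (partial₂ P)
  degree-partial₂ d = All.map⁺ (All.map (λ {(_ , i , j , l)} → ℕ.≤-trans (ℕ.+-monoˡ-≤ l (ℕ.+-monoʳ-≤ i (ℕ.pred[n]≤n {j})))) d)

  degree-partial₃ : ∀ {δ P} → Degree≤ δ P → Degree≤ δ (partial₃ P)
  degree-partial₃ d = All.map⁺ (All.map (λ {(_ , i , j , l)} → ℕ.≤-trans (ℕ.+-monoʳ-≤ (i ℕ.+ j) (ℕ.pred[n]≤n {l}))) d)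

  infix 8 _⟨_⟩^_
  _⟨_⟩^_ : ∀ {A : Set} → A → (A → A) → ℕ → A
  x ⟨ f ⟩^ zero = x
  x ⟨ f ⟩^ suc n = f (x ⟨ f ⟩^ n)

  ∂ᵐ : Monomial → Functional → Functional
  ∂ᵐ (a , b , c) φ = ((φ ⟨ ∂₃ ⟩^ c) ⟨ ∂₂ ⟩^ b) ⟨ ∂₁ ⟩^ a

  falling : ℕ → ℕ → Carrier
  falling i zero = 1#
  falling i (suc a) = ι i * falling (ℕ.pred i) a

  lower : ℕ → ℕ → ℕ
  lower i zero = i
  lower i (suc a) = lower (ℕ.pred i) a

  lower-self : ∀ a → lower a a ≡ 0
  lower-self zero = refl
  lower-self (suc a) = lower-self a

  falling-< : ∀ {i a} → i < a → falling i a ≡ 0#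
  falling-< {zero} {suc a} _ = zeroˡ _
  falling-< {suc i} {suc a} (s≤s i<a) = trans (cong (ι (suc i) *_) (falling-< i<a)) (zeroʳ _)

  ∂₁-iterate : ∀ a φ i j l → (φ ⟨ ∂₁ ⟩^ a) (i , j , l) ≡ falling i a * φ (lower i a , j , l)
  ∂₁-iterate zero φ i j l = sym (*-identityˡ _)
  ∂₁-iterate (suc a) φ i j l = trans (cong (ι i *_) (∂₁-iterate a φ (ℕ.pred i) j l)) (sym (*-assoc _ _ _))

  ∂₂-iterate : ∀ b φ i j l → (φ ⟨ ∂₂ ⟩^ b) (i , j , l) ≡ falling j b * φ (i , lower j b , l)
  ∂₂-iterate zero φ i j l = sym (*-identityˡ _)
  ∂₂-iterate (suc b) φ i j l = trans (cong (ι j *_) (∂₂-iterate b φ i (ℕ.pred j) l)) (sym (*-assoc _ _ _))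

  ∂₃-iterate : ∀ c φ i j l → (φ ⟨ ∂₃ ⟩^ c) (i , j , l) ≡ falling l c * φ (i , j , lower l c)
  ∂₃-iterate zero φ i j l = sym (*-identityˡ _)
  ∂₃-iterate (suc c) φ i j l = trans (cong (ι l *_) (∂₃-iterate c φ i j (ℕ.pred l))) (sym (*-assoc _ _ _))

  ∂ᵐ-value : ∀ a b c φ i j l → ∂ᵐ (a , b , c) φ (i , j , l) ≡
    falling i a * (falling j b * (falling l c * φ (lower i a , lower j b , lower l c)))
  ∂ᵐ-value a b c φ i j l = trans (∂₁-iterate a _ i j l) (cong (falling i a *_)
    (trans (∂₂-iterate b _ (lower i a) j l) (cong (falling j b *_) (∂₃-iterate c φ (lower i a) (lower j b) l))))

  vanishing : ∀ {x y z} r → x ≡ 0# ⊎ y ≡ 0# ⊎ z ≡ 0# → x * (y * (z * r)) ≡ 0#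
  vanishing r (inj₁ refl) = zeroˡ _
  vanishing {x} {z = z} r (inj₂ (inj₁ refl)) = solve 3 (λ x z r → x :* (0ₖ :* (z :* r)) := 0ₖ) refl x z r
  vanishing {x} {y} r (inj₂ (inj₂ refl)) = solve 3 (λ x y r → x :* (y :* (0ₖ :* r)) := 0ₖ) refl x y r

  -- Not exceeding `m` in degree and different from it, `k` has a smaller exponent somewhere, and
  -- the falling factorial there is zero.
  ∂ᵐ-zero : ∀ m φ k → degree k ≤ degree m → k ≢ m → ∂ᵐ m φ k ≡ 0#
  ∂ᵐ-zero (a , b , c) φ (i , j , l) k≤m k≢m with a ℕ.≤? i | b ℕ.≤? j | c ℕ.≤? l
  ... | no a≰i | _ | _ = trans (∂ᵐ-value a b c φ i j l) (vanishing _ (inj₁ (falling-< (ℕ.≰⇒> a≰i))))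
  ... | yes _ | no b≰j | _ = trans (∂ᵐ-value a b c φ i j l) (vanishing _ (inj₂ (inj₁ (falling-< (ℕ.≰⇒> b≰j)))))
  ... | yes _ | yes _ | no c≰l = trans (∂ᵐ-value a b c φ i j l) (vanishing _ (inj₂ (inj₂ (falling-< (ℕ.≰⇒> c≰l)))))
  ... | yes a≤i | yes b≤j | yes c≤l = ⊥-elim (k≢m (equal i≡a j≡b l≡c))
    where
    equal : i ≡ a → j ≡ b → l ≡ c → (i , j , l) ≡ (a , b , c)
    equal refl refl refl = refl
    l≡c : l ≡ c
    l≡c = ℕ.≤-antisym (ℕ.+-cancelˡ-≤ (a ℕ.+ b) l c (ℕ.≤-trans (ℕ.+-monoˡ-≤ l (ℕ.+-mono-≤ a≤i b≤j)) k≤m)) c≤l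
    ij≤ab : i ℕ.+ j ≤ a ℕ.+ b
    ij≤ab = ℕ.+-cancelʳ-≤ c (i ℕ.+ j) (a ℕ.+ b) (ℕ.≤-trans (ℕ.+-monoʳ-≤ (i ℕ.+ j) c≤l) k≤m)
    j≡b : j ≡ b
    j≡b = ℕ.≤-antisym (ℕ.+-cancelˡ-≤ a j b (ℕ.≤-trans (ℕ.+-monoˡ-≤ j a≤i) ij≤ab)) b≤j
    i≡a : i ≡ a
    i≡a = ℕ.≤-antisym (ℕ.+-cancelʳ-≤ b i a (ℕ.≤-trans (ℕ.+-monoʳ-≤ i b≤j) ij≤ab)) a≤i

module LineConfigurations (F : Field) (p : ℕ)
  (char : ∀ n → suc n < p → FieldProperties.ι F (suc n) ≢ Field.0# F) where
  open Field F
  open FieldProperties F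
  open PolynomialFunctions F
  open TrivariatePolynomials F
  open Characteristic F p char
  open Crossings F p char
  open LinearAlgebra F
  open ≡ using (refl; sym; trans; cong; cong₂; subst)

  falling-self≢0 : ∀ a → a < p → falling a a ≢ 0#
  falling-self≢0 zero _ = 1≢0
  falling-self≢0 (suc a) a<p = *-nonzero (char a a<p) (falling-self≢0 a (ℕ.<-trans (ℕ.n<1+n a) a<p))

  ∂ᵐ-self : ∀ m Q → degree m < p → ∂ᵐ m (at Q) m ≢ 0#
  ∂ᵐ-self (a , b , c) Q m<p e = *-nonzero (falling-self≢0 a (ℕ.≤-<-trans a≤ m<p))
    (*-nonzero (falling-self≢0 b (ℕ.≤-<-trans b≤ m<p)) (*-nonzero (falling-self≢0 c (ℕ.≤-<-trans c≤ m<p)) one))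
    (trans (sym (∂ᵐ-value a b c (at Q) a b c)) e)
    where
    a≤ : a ≤ a ℕ.+ b ℕ.+ c
    a≤ = ℕ.≤-trans (ℕ.m≤m+n a b) (ℕ.m≤m+n _ c)
    b≤ : b ≤ a ℕ.+ b ℕ.+ c
    b≤ = ℕ.≤-trans (ℕ.m≤n+m b a) (ℕ.m≤m+n _ c)
    c≤ : c ≤ a ℕ.+ b ℕ.+ c
    c≤ = ℕ.m≤n+m c _
    one : at Q (lower a a , lower b b , lower c c) ≢ 0#
    one e rewrite lower-self a | lower-self b | lower-self c =
      1≢0 (trans (solve 0 (1ₖ := 1ₖ :* 1ₖ :* 1ₖ) refl) e)

  module _ (𝓛 : List Line) (δ L : ℕ) (deg<p : 3 ℕ.+ (δ ℕ.+ δ ℕ.+ δ ℕ.+ δ) < p) where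

    -- Membership in the family replaces the containment in `Crossed`. The data are then free of the
    -- polynomial and remain valid for its partial derivatives.
    record Network (ℓ : Line) : Set where
      field
        crossings : List (Carrier × Line)
        unique    : Unique (map proj₁ crossings)
        crossing  : All (λ d → Cross ℓ (proj₂ d) (proj₁ d) × proj₂ d ∈ 𝓛) crossings
        many      : δ ℕ.+ δ ℕ.+ (δ ℕ.+ δ) ℕ.+ L < length crossings
        not-collinear : ∀ c k {ds} → Unique (map proj₁ ds) → (∀ {d} → d ∈ ds → d ∈ crossings) →
          All (λ d → 1# + (proj₁ (proj₂ d) - proj₁ ℓ) * (c + proj₁ d * k) ≡ 0#) ds → length ds ≤ L

    module _ (networks : ∀ {ℓ} → ℓ ∈ 𝓛 → Network ℓ) where

      ContainsAll : Polynomial₃ → Set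
      ContainsAll P = ∀ {ℓ} → ℓ ∈ 𝓛 → ∀ w → ⟪ P , at (point ℓ w) ⟫ ≡ 0#

      gradient : ∀ {P} → Degree≤ δ P → ContainsAll P → ∀ e {ℓ} → ℓ ∈ 𝓛 → ∀ w → ⟪ P , Δ e (at (point ℓ w)) ⟫ ≡ 0#
      gradient {P} P≤δ P⊃ e ℓ∈ = gradient-zero P P≤δ deg<p (P⊃ ℓ∈) L (crossed ℓ∈ (Network.many (networks ℓ∈)))
        (All.map (λ (_ , m∈) → crossed m∈ (ℕ.≤-<-trans (ℕ.m≤m+n _ L) (Network.many (networks m∈))))
          (Network.crossing (networks ℓ∈)))
        (Network.not-collinear (networks ℓ∈)) e
        where
        crossed : ∀ {ℓ n} (ℓ∈ : ℓ ∈ 𝓛) → n < length (Network.crossings (networks ℓ∈)) → Crossed P P≤δ deg<p ℓ n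
        crossed ℓ∈ n< = record
          { crossings = Network.crossings (networks ℓ∈) ; unique = Network.unique (networks ℓ∈)
          ; crossing = All.map (λ (c , m∈) → c , P⊃ m∈) (Network.crossing (networks ℓ∈)) ; many = n< }

      iterated : ∀ {P} → Degree≤ δ P → ContainsAll P → ∀ m {ℓ} → ℓ ∈ 𝓛 → ∀ w → ⟪ P , ∂ᵐ m (at (point ℓ w)) ⟫ ≡ 0#
      iterated {P} P≤δ P⊃ (suc a , b , c) ℓ∈ w = trans (sym (pairing-partial₁ P _))
        (iterated (degree-partial₁ P≤δ) (λ ℓ∈ w → trans (pairing-partial₁ P _) (trans
          (pairing-cong P λ { (i , j , l) → solve 3 (λ x y z → x := 1ₖ :* x :+ 0ₖ :* y :+ 0ₖ :* z) refl _ _ _ })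
          (gradient P≤δ P⊃ (1# , 0# , 0#) ℓ∈ w))) (a , b , c) ℓ∈ w)
      iterated {P} P≤δ P⊃ (zero , suc b , c) ℓ∈ w = trans (sym (pairing-partial₂ P _))
        (iterated (degree-partial₂ P≤δ) (λ ℓ∈ w → trans (pairing-partial₂ P _) (trans
          (pairing-cong P λ { (i , j , l) → solve 3 (λ x y z → y := 0ₖ :* x :+ 1ₖ :* y :+ 0ₖ :* z) refl _ _ _ })
          (gradient P≤δ P⊃ (0# , 1# , 0#) ℓ∈ w))) (zero , b , c) ℓ∈ w)
      iterated {P} P≤δ P⊃ (zero , zero , suc c) ℓ∈ w = trans (sym (pairing-partial₃ P _))
        (iterated (degree-partial₃ P≤δ) (λ ℓ∈ w → trans (pairing-partial₃ P _) (trans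
          (pairing-cong P λ { (i , j , l) → solve 3 (λ x y z → z := 0ₖ :* x :+ 0ₖ :* y :+ 1ₖ :* z) refl _ _ _ })
          (gradient P≤δ P⊃ (0# , 0# , 1#) ℓ∈ w))) (zero , zero , c) ℓ∈ w)
      iterated P≤δ P⊃ (zero , zero , zero) ℓ∈ w = P⊃ ℓ∈ w

      -- Once the coefficients of higher degree are zero, `∂ᵐ m` at a point of `ℓ` kills every term
      -- except that of `m`, where it leaves a product of factorials, nonzero because the degree is
      -- below `p`.
      coefficients-zero : ∀ {P} → Degree≤ δ P → Unique (map proj₂ P) → ContainsAll P → ∀ {ℓ} → ℓ ∈ 𝓛 →
        ∀ {t} → t ∈ P → proj₁ t ≡ 0#
      coefficients-zero {P} P≤δ uniq P⊃ {ℓ} ℓ∈ {t} t∈P =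
        from (suc δ) (degree (proj₂ t)) (ℕ.m≤n+m (suc δ) _) t∈P ℕ.≤-refl
        where
        -- Descending induction on the degree e; n bounds the number of degrees above e.
        from : ∀ n e → δ < e ℕ.+ n → ∀ {t} → t ∈ P → e ≤ degree (proj₂ t) → proj₁ t ≡ 0#
        from zero e δ<e {t} t∈P e≤t = ⊥-elim (ℕ.<-irrefl refl
          (ℕ.<-≤-trans δ<e (ℕ.≤-trans (ℕ.≤-reflexive (ℕ.+-identityʳ e)) (ℕ.≤-trans e≤t (All.lookup P≤δ t∈P)))))
        from (suc n) e δ<e {c , m} t∈P e≤t with ℕ.m≤n⇒m<n∨m≡n e≤t
        ... | inj₁ e<t = from n (suc e) (subst (δ <_) (ℕ.+-suc e n) δ<e) t∈P e<t
        ... | inj₂ refl = *-cancel (∂ᵐ-self m (point ℓ 0#) (ℕ.≤-<-trans (All.lookup P≤δ t∈P) (δ<p P P≤δ deg<p)))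
              (trans (*-comm _ _) (trans (sym (pairing-single P uniq t∈P others)) (iterated P≤δ P⊃ m ℓ∈ 0#)))
          where
          others : ∀ {t} → t ∈ P → proj₂ t ≢ m → proj₁ t * ∂ᵐ m (at (point ℓ 0#)) (proj₂ t) ≡ 0#
          others {c′ , k} t∈P k≢m with degree k ℕ.≤? degree m
          ... | yes k≤m = trans (cong (c′ *_) (∂ᵐ-zero m _ k k≤m k≢m)) (zeroʳ c′)
          ... | no k≰m = trans (cong (_* _) (from n (suc (degree m)) (subst (δ <_) (ℕ.+-suc e n) δ<e) t∈P (ℕ.≰⇒> k≰m)))
                           (zeroˡ _)

  -- Bounding the exponents separately makes the count an exact cube, at the price of a total degree
  -- three times as large.
  box : ℕ → List Monomial
  box n = cartesianProduct (upTo n) (cartesianProduct (upTo n) (upTo n))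

  length-box : ∀ n → length (box n) ≡ n ℕ.* (n ℕ.* n)
  length-box n = trans (length-cartesianProductWith _,_ (upTo n) (cartesianProduct (upTo n) (upTo n)))
    (cong₂ ℕ._*_ (List.length-upTo n) (trans (length-cartesianProductWith _,_ (upTo n) (upTo n))
      (cong₂ ℕ._*_ (List.length-upTo n) (List.length-upTo n))))

  box-unique : ∀ n → Unique (box n)
  box-unique n = Unique.cartesianProduct⁺ (Unique.upTo⁺ n) (Unique.cartesianProduct⁺ (Unique.upTo⁺ n) (Unique.upTo⁺ n))

  box-degree : ∀ d {m} → m ∈ box (suc d) → degree m ≤ 3 ℕ.* d
  box-degree d {i , j , l} m∈ with ∈-cartesianProduct⁻ (upTo (suc d)) _ m∈
  ... | i∈ , jl∈ with ∈-cartesianProduct⁻ (upTo (suc d)) (upTo (suc d)) jl∈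
  ... | j∈ , l∈ = ℕ.≤-trans (ℕ.+-mono-≤ (ℕ.+-mono-≤ (below i∈) (below j∈)) (below l∈))
          (ℕ.≤-reflexive (trans (ℕ.+-assoc d d d) (cong (λ e → d ℕ.+ (d ℕ.+ e)) (sym (ℕ.+-identityʳ d)))))
    where
    below : ∀ {i} → i ∈ upTo (suc d) → i ≤ d
    below i∈ = ℕ.≤-pred (∈-upTo⁻ i∈)

  conditions : List Line → ℕ → List Functional
  conditions 𝓛 n = cartesianProductWith (λ ℓ s → at (point ℓ s)) 𝓛 (points n)

  length-conditions : ∀ 𝓛 n → length (conditions 𝓛 n) ≡ length 𝓛 ℕ.* n
  length-conditions 𝓛 n = trans (length-cartesianProductWith _ 𝓛 (points n)) (cong (length 𝓛 ℕ.*_) (List.length-applyUpTo ι n))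

  conditions-contains : ∀ {𝓛 δ P} → suc δ ≤ p → Degree≤ δ P → All (λ φ → ⟪ P , φ ⟫ ≡ 0#) (conditions 𝓛 (suc δ)) →
    ∀ {ℓ} → ℓ ∈ 𝓛 → ∀ w → ⟪ P , at (point ℓ w) ⟫ ≡ 0#
  conditions-contains {P = P} δ<p P≤δ zeros {ℓ} ℓ∈ = proj₁ (Pol-zeros (Family-pairing P P≤δ (Family-line ℓ)) (points-unique δ<p)
    (All.tabulate λ s∈ → All.lookup zeros (∈-cartesianProductWith⁺ (λ ℓ s → at (point ℓ s)) ℓ∈ s∈))
    (ℕ.≤-reflexive (sym (List.length-applyUpTo ι _))))

  no-network : ∀ 𝓛 d L → 3 ℕ.* length 𝓛 ≤ suc d ℕ.* suc d → (deg<p : 3 ℕ.+ (3 ℕ.* d ℕ.+ 3 ℕ.* d ℕ.+ 3 ℕ.* d ℕ.+ 3 ℕ.* d) < p) →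
    ∀ {ℓ} → ℓ ∈ 𝓛 → ¬ (∀ {ℓ} → ℓ ∈ 𝓛 → Network 𝓛 (3 ℕ.* d) L deg<p ℓ)
  no-network 𝓛@(_ ∷ 𝓛′) d L size deg<p {ℓ} ℓ∈ networks =
    let P , perm , nonzero , zeros = underdetermined _ (conditions 𝓛 (suc (3 ℕ.* d))) (box (suc d))
          (length-conditions 𝓛 (suc (3 ℕ.* d)))
          (subst (length 𝓛 ℕ.* suc (3 ℕ.* d) <_) (sym (length-box (suc d))) (fewer-conditions (length 𝓛′) d size))
        P≤δ = All.tabulate λ t∈P → box-degree d (∈-resp-↭ perm (∈-map⁺ proj₂ t∈P))
        _ , t∈P , t≢0 = find nonzero
    in t≢0 (coefficients-zero 𝓛 (3 ℕ.* d) L deg<p networks P≤δ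
         (Unique-resp-↭ (≡.setoid Monomial) (↭⇒↭ₛ (↭-sym perm)) (box-unique (suc d)))
         (conditions-contains (δ<p P P≤δ deg<p) P≤δ zeros) ℓ∈ t∈P)

-- The fields of p and p² elements

commutativeRing-≡ : ∀ {A : Set} {_+_ _*_ : A → A → A} { -_ : A → A} {0# 1# : A} →
  (∀ x y z → (x + y) + z ≡ x + (y + z)) → (∀ x y → x + y ≡ y + x) → (∀ x → 0# + x ≡ x) → (∀ x → (- x) + x ≡ 0#) →
  (∀ x y z → (x * y) * z ≡ x * (y * z)) → (∀ x y → x * y ≡ y * x) → (∀ x → 1# * x ≡ x) →
  (∀ x y z → x * (y + z) ≡ (x * y) + (x * z)) → IsCommutativeRing _≡_ _+_ _*_ -_ 0# 1#
commutativeRing-≡ {_+_ = _+_} {_*_} { -_} +-assoc +-comm +-idˡ -‿invˡ *-assoc *-comm *-idˡ distribˡ = record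
  { isRing = record
    { +-isAbelianGroup = record
      { isGroup = record
        { isMonoid = record
          { isSemigroup = record
            { isMagma = record { isEquivalence = ≡.isEquivalence ; ∙-cong = ≡.cong₂ _+_ } ; assoc = +-assoc }
          ; identity = +-idˡ , λ x → ≡.trans (+-comm x _) (+-idˡ x) }
        ; inverse = -‿invˡ , λ x → ≡.trans (+-comm x _) (-‿invˡ x)
        ; ⁻¹-cong = ≡.cong -_ }
      ; comm = +-comm }
    ; *-cong = ≡.cong₂ _*_
    ; *-assoc = *-assoc
    ; *-identity = *-idˡ , λ x → ≡.trans (*-comm x _) (*-idˡ x)
    ; distrib = distribˡ , λ x y z → ≡.trans (*-comm _ x) (≡.trans (distribˡ x y z) (≡.cong₂ _+_ (*-comm x y) (*-comm x z))) }
  ; *-comm = *-comm }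

module PrimeField (p : ℕ) .{{_ : NonZero p}} (prime : Prime p) where
  open ≡ using (refl; sym; trans; cong; cong₂; subst; module ≡-Reasoning)
  open ≡-Reasoning

  [_] : ℕ → Fin p
  [ n ] = n mod p

  toℕ-[] : ∀ n → toℕ [ n ] ≡ n % p
  toℕ-[] n = Fin.toℕ-fromℕ< (m%n<n n p)

  []-cong : ∀ {m n} → m % p ≡ n % p → [ m ] ≡ [ n ]
  []-cong {m} {n} e = Fin.toℕ-injective (trans (toℕ-[] m) (trans e (sym (toℕ-[] n))))

  []-toℕ : ∀ a → [ toℕ a ] ≡ a
  []-toℕ a = Fin.toℕ-injective (trans (toℕ-[] _) (m<n⇒m%n≡m (Fin.toℕ<n a)))

  _+ₚ_ _*ₚ_ : Fin p → Fin p → Fin p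
  a +ₚ b = [ toℕ a ℕ.+ toℕ b ]
  a *ₚ b = [ toℕ a ℕ.* toℕ b ]

  -- Multiplication by p - 1 keeps negation within the arithmetic of ℕ.
  -ₚ_ : Fin p → Fin p
  -ₚ a = [ toℕ a ℕ.* ℕ.pred p ]

  []-+ : ∀ m n → [ m ] +ₚ [ n ] ≡ [ m ℕ.+ n ]
  []-+ m n = []-cong (trans (cong₂ (λ a b → (a ℕ.+ b) % p) (toℕ-[] m) (toℕ-[] n)) (sym (%-distribˡ-+ m n p)))

  []-* : ∀ m n → [ m ] *ₚ [ n ] ≡ [ m ℕ.* n ]
  []-* m n = []-cong (trans (cong₂ (λ a b → (a ℕ.* b) % p) (toℕ-[] m) (toℕ-[] n)) (sym (%-distribˡ-* m n p)))

  -- Every element is a class [ m ], and [_] is a homomorphism, so that identities are inherited from ℕ.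
  data Class : Fin p → Set where
    class : ∀ m → Class [ m ]

  class? : ∀ a → Class a
  class? a = subst Class ([]-toℕ a) (class (toℕ a))

  ring : CommutativeRing _ _
  ring = record { isCommutativeRing = commutativeRing-≡ {_+_ = _+ₚ_} {_*ₚ_} { -ₚ_} {[ 0 ]} {[ 1 ]}
    (λ a b c → +-assoc (class? a) (class? b) (class? c))
    (λ a b → cong [_] (ℕ.+-comm (toℕ a) (toℕ b)))
    (λ a → +-identityˡ (class? a))
    inverseˡ
    (λ a b c → *-assoc (class? a) (class? b) (class? c))
    (λ a b → cong [_] (ℕ.*-comm (toℕ a) (toℕ b)))
    (λ a → *-identityˡ (class? a))
    (λ a b c → distribˡ (class? a) (class? b) (class? c)) }
    where
    +-assoc : ∀ {a b c} → Class a → Class b → Class c → (a +ₚ b) +ₚ c ≡ a +ₚ (b +ₚ c)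
    +-assoc (class a) (class b) (class c) = begin
      ([ a ] +ₚ [ b ]) +ₚ [ c ] ≡⟨ cong (_+ₚ [ c ]) ([]-+ a b) ⟩
      [ a ℕ.+ b ] +ₚ [ c ] ≡⟨ []-+ (a ℕ.+ b) c ⟩
      [ a ℕ.+ b ℕ.+ c ] ≡⟨ cong [_] (ℕ.+-assoc a b c) ⟩
      [ a ℕ.+ (b ℕ.+ c) ] ≡⟨ sym ([]-+ a (b ℕ.+ c)) ⟩
      [ a ] +ₚ [ b ℕ.+ c ] ≡⟨ cong ([ a ] +ₚ_) (sym ([]-+ b c)) ⟩
      [ a ] +ₚ ([ b ] +ₚ [ c ]) ∎

    *-assoc : ∀ {a b c} → Class a → Class b → Class c → (a *ₚ b) *ₚ c ≡ a *ₚ (b *ₚ c)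
    *-assoc (class a) (class b) (class c) = begin
      ([ a ] *ₚ [ b ]) *ₚ [ c ] ≡⟨ cong (_*ₚ [ c ]) ([]-* a b) ⟩
      [ a ℕ.* b ] *ₚ [ c ] ≡⟨ []-* (a ℕ.* b) c ⟩
      [ a ℕ.* b ℕ.* c ] ≡⟨ cong [_] (ℕ.*-assoc a b c) ⟩
      [ a ℕ.* (b ℕ.* c) ] ≡⟨ sym ([]-* a (b ℕ.* c)) ⟩
      [ a ] *ₚ [ b ℕ.* c ] ≡⟨ cong ([ a ] *ₚ_) (sym ([]-* b c)) ⟩
      [ a ] *ₚ ([ b ] *ₚ [ c ]) ∎

    distribˡ : ∀ {a b c} → Class a → Class b → Class c → a *ₚ (b +ₚ c) ≡ (a *ₚ b) +ₚ (a *ₚ c)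
    distribˡ (class a) (class b) (class c) = begin
      [ a ] *ₚ ([ b ] +ₚ [ c ]) ≡⟨ cong ([ a ] *ₚ_) ([]-+ b c) ⟩
      [ a ] *ₚ [ b ℕ.+ c ] ≡⟨ []-* a (b ℕ.+ c) ⟩
      [ a ℕ.* (b ℕ.+ c) ] ≡⟨ cong [_] (ℕ.*-distribˡ-+ a b c) ⟩
      [ a ℕ.* b ℕ.+ a ℕ.* c ] ≡⟨ sym ([]-+ (a ℕ.* b) (a ℕ.* c)) ⟩
      [ a ℕ.* b ] +ₚ [ a ℕ.* c ] ≡⟨ cong₂ _+ₚ_ (sym ([]-* a b)) (sym ([]-* a c)) ⟩
      ([ a ] *ₚ [ b ]) +ₚ ([ a ] *ₚ [ c ]) ∎

    +-identityˡ : ∀ {a} → Class a → [ 0 ] +ₚ a ≡ a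
    +-identityˡ (class a) = []-+ 0 a

    *-identityˡ : ∀ {a} → Class a → [ 1 ] *ₚ a ≡ a
    *-identityˡ (class a) = trans ([]-* 1 a) (cong [_] (ℕ.*-identityˡ a))

    inverseˡ : ∀ a → (-ₚ a) +ₚ a ≡ [ 0 ]
    inverseˡ a = begin
      [ toℕ a ℕ.* ℕ.pred p ] +ₚ a ≡⟨ cong ([ toℕ a ℕ.* ℕ.pred p ] +ₚ_) (sym ([]-toℕ a)) ⟩
      [ toℕ a ℕ.* ℕ.pred p ] +ₚ [ toℕ a ] ≡⟨ []-+ _ _ ⟩
      [ toℕ a ℕ.* ℕ.pred p ℕ.+ toℕ a ] ≡⟨ cong [_] (ℕ.+-comm _ (toℕ a)) ⟩
      [ toℕ a ℕ.+ toℕ a ℕ.* ℕ.pred p ] ≡⟨ cong [_] (sym (ℕ.*-suc (toℕ a) (ℕ.pred p))) ⟩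
      [ toℕ a ℕ.* suc (ℕ.pred p) ] ≡⟨ cong (λ q → [ toℕ a ℕ.* q ]) (ℕ.suc-pred p) ⟩
      [ toℕ a ℕ.* p ] ≡⟨ []-cong (trans (m*n%n≡0 (toℕ a) p) (sym (m<n⇒m%n≡m (ℕ.>-nonZero⁻¹ p)))) ⟩
      [ 0 ] ∎

  1<p : 1 < p
  1<p = ℕ.nonTrivial⇒n>1 p {{prime⇒nonTrivial prime}}

  []≢0 : ∀ {n} → 0 < n → n < p → [ n ] ≢ [ 0 ]
  []≢0 {n} 0<n n<p e = ℕ.<-irrefl (sym (trans (sym (trans (toℕ-[] n) (m<n⇒m%n≡m n<p)))
    (trans (cong toℕ e) (trans (toℕ-[] 0) (m<n⇒m%n≡m (ℕ.<-trans (s≤s z≤n) 1<p)))))) 0<n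

  private
    module R = CommutativeRing ring
    p≡0 : ∀ x → [ x ℕ.* p ] ≡ [ 0 ]
    p≡0 x = []-cong (trans (m*n%n≡0 x p) (sym (m<n⇒m%n≡m (ℕ.<-trans (s≤s z≤n) 1<p))))

  open IntegerSolver ring using (solve; _:=_; _:+_; _:*_; :-_; _:-_)

  inverse : ∀ a → a ≢ [ 0 ] → ∃ λ b → a *ₚ b ≡ [ 1 ]
  inverse a a≢0 with coprime-Bézout (prime⇒coprime prime {{ℕ.>-nonZero 0<a}} (Fin.toℕ<n a))
    where
    0<a : 0 < toℕ a
    0<a = ℕ.n≢0⇒n>0 λ e → a≢0 (trans (sym ([]-toℕ a)) (cong [_] e))
  ... | Bézout.+- x y eq = -ₚ [ y ] , (begin
    a *ₚ (-ₚ [ y ]) ≡⟨ solve 3 (λ a y e → a :* (:- y) := e :- (e :+ y :* a)) refl a [ y ] [ 1 ] ⟩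
    [ 1 ] +ₚ (-ₚ ([ 1 ] +ₚ ([ y ] *ₚ a))) ≡⟨ cong (λ t → [ 1 ] +ₚ (-ₚ t)) one+ya ⟩
    [ 1 ] +ₚ (-ₚ [ 0 ]) ≡⟨ cong ([ 1 ] +ₚ_) (trans (sym (R.+-identityʳ _)) (R.-‿inverseˡ [ 0 ])) ⟩
    [ 1 ] +ₚ [ 0 ] ≡⟨ R.+-identityʳ _ ⟩
    [ 1 ] ∎)
    where
    one+ya : [ 1 ] +ₚ ([ y ] *ₚ a) ≡ [ 0 ]
    one+ya = begin
      [ 1 ] +ₚ ([ y ] *ₚ a) ≡⟨ cong (λ t → [ 1 ] +ₚ ([ y ] *ₚ t)) (sym ([]-toℕ a)) ⟩
      [ 1 ] +ₚ ([ y ] *ₚ [ toℕ a ]) ≡⟨ cong ([ 1 ] +ₚ_) ([]-* y (toℕ a)) ⟩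
      [ 1 ] +ₚ [ y ℕ.* toℕ a ] ≡⟨ []-+ 1 _ ⟩
      [ 1 ℕ.+ y ℕ.* toℕ a ] ≡⟨ cong [_] eq ⟩
      [ x ℕ.* p ] ≡⟨ p≡0 x ⟩
      [ 0 ] ∎
  ... | Bézout.-+ x y eq = [ y ] , (begin
    a *ₚ [ y ] ≡⟨ R.*-comm a [ y ] ⟩
    [ y ] *ₚ a ≡⟨ cong ([ y ] *ₚ_) (sym ([]-toℕ a)) ⟩
    [ y ] *ₚ [ toℕ a ] ≡⟨ []-* y (toℕ a) ⟩
    [ y ℕ.* toℕ a ] ≡⟨ cong [_] (sym eq) ⟩
    [ 1 ℕ.+ x ℕ.* p ] ≡⟨ sym ([]-+ 1 _) ⟩
    [ 1 ] +ₚ [ x ℕ.* p ] ≡⟨ cong ([ 1 ] +ₚ_) (p≡0 x) ⟩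
    [ 1 ] +ₚ [ 0 ] ≡⟨ R.+-identityʳ _ ⟩
    [ 1 ] ∎)

  primeField : Field
  primeField = record
    { Carrier = Fin p ; _+_ = _+ₚ_ ; _*_ = _*ₚ_ ; -_ = -ₚ_ ; 0# = [ 0 ] ; 1# = [ 1 ]
    ; isCommutativeRing = R.isCommutativeRing
    ; _≟_ = Fin._≟_
    ; 1≢0 = []≢0 (s≤s z≤n) 1<p
    ; inverse = inverse }

  ι-[] : ∀ n → FieldProperties.ι primeField n ≡ [ n ]
  ι-[] zero = refl
  ι-[] (suc n) = trans (cong ([ 1 ] +ₚ_) (ι-[] n)) ([]-+ 1 n)

  -- Squaring identifies 1 and -1, so it is not injective, hence not surjective.
  nonsquare : 2 < p → ∃ λ g → ∀ x → x *ₚ x ≢ g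
  nonsquare 2<p with Fin.¬∀⟶∃¬ p (λ g → ∃ λ x → x *ₚ x ≡ g) (λ g → Fin.any? λ x → x *ₚ x Fin.≟ g) notSurjective
    where
    minus-one = -ₚ [ 1 ]

    minus-one-square : minus-one *ₚ minus-one ≡ [ 1 ]
    minus-one-square = trans (solve 1 (λ e → (:- e) :* (:- e) := e :* e) refl [ 1 ]) (R.*-identityˡ _)

    1≢-1 : [ 1 ] ≢ minus-one
    1≢-1 e = []≢0 (s≤s z≤n) 2<p (trans (sym ([]-+ 1 1)) (trans (cong ([ 1 ] +ₚ_) e) (R.-‿inverseʳ [ 1 ])))

    module _ (s : ∀ g → ∃ λ x → x *ₚ x ≡ g) where
      root : Fin p → Fin p
      root g = proj₁ (s g)

      root-injective : ∀ {g h} → root g ≡ root h → g ≡ h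
      root-injective {g} {h} e = trans (sym (proj₂ (s g))) (trans (cong (λ x → x *ₚ x) e) (proj₂ (s h)))

      -- A value with square 1 can only be the root of 1. As 1 and - 1 differ, one of them is not.
      missed : ∃ λ v → ∀ g → v ≢ root g
      missed with root [ 1 ] Fin.≟ [ 1 ]
      ... | yes e = minus-one , λ g q → 1≢-1 (sym (trans q (trans (cong root
              (trans (sym (proj₂ (s g))) (trans (cong (λ x → x *ₚ x) (sym q)) minus-one-square))) e)))
      ... | no ¬e = [ 1 ] , λ g q → ¬e (sym (trans q (cong root
              (trans (sym (proj₂ (s g))) (trans (cong (λ x → x *ₚ x) (sym q)) (R.*-identityˡ [ 1 ]))))))

    omitting : ∀ {n} (f : Fin n → Fin n) → (∀ {i j} → f i ≡ f j → i ≡ j) → ∀ v → ¬ (∀ i → v ≢ f i)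
    omitting {suc n} f inj v v≢ = ℕ.<-irrefl refl
      (Fin.injective⇒≤ {f = λ i → punchOut (v≢ i)} λ e → inj (Fin.punchOut-injective (v≢ _) (v≢ _) e))

    notSurjective : ¬ (∀ g → ∃ λ x → x *ₚ x ≡ g)
    notSurjective s = omitting (root s) (root-injective s) (proj₁ (missed s)) (proj₂ (missed s))
  ... | g , ¬square = g , λ x e → ¬square (x , e)

module QuadraticExtension (F : Field) (g : Field.Carrier F) (nonsquare : ∀ x → Field._*_ F x x ≢ g) where
  open Field F
  open FieldProperties F
  open ≡ using (refl; trans; cong; cong₂; module ≡-Reasoning)
  open ≡-Reasoning

  private
    -- The pair (a , b) stands for a + b λ, where λ² = g.
    _⊞_ _⊠_ : Carrier × Carrier → Carrier × Carrier → Carrier × Carrier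
    (a , b) ⊞ (c , d) = a + c , b + d
    (a , b) ⊠ (c , d) = a * c + g * (b * d) , a * d + b * c

    ⊟_ : Carrier × Carrier → Carrier × Carrier
    ⊟ (a , b) = - a , - b

  -- For `b` nonzero, a vanishing norm would make `g` the square of a / b.
  norm≢0 : ∀ a b → (a , b) ≢ (0# , 0#) → a * a - g * (b * b) ≢ 0#
  norm≢0 a b ab≢0 N≡0 with b ≟ 0#
  ... | yes refl with a ≟ 0#
  ... | yes refl = ab≢0 refl
  ... | no a≢0 = *-nonzero a≢0 a≢0 (trans (solve 2 (λ a g → a :* a := a :* a :- g :* (0ₖ :* 0ₖ)) refl a g) N≡0)
  norm≢0 a b ab≢0 N≡0 | no b≢0 with inverse b b≢0
  ... | i , bi≡1 = nonsquare (a * i) (begin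
    (a * i) * (a * i) ≡⟨ solve 2 (λ a i → (a :* i) :* (a :* i) := (a :* a) :* (i :* i)) refl a i ⟩
    (a * a) * (i * i) ≡⟨ cong (_* (i * i)) (-‿≡0 N≡0) ⟩
    g * (b * b) * (i * i) ≡⟨ solve 3 (λ g b i → g :* (b :* b) :* (i :* i) := g :* ((b :* i) :* (b :* i))) refl g b i ⟩
    g * ((b * i) * (b * i)) ≡⟨ cong (λ t → g * (t * t)) bi≡1 ⟩
    g * (1# * 1#) ≡⟨ solve 1 (λ g → g :* (1ₖ :* 1ₖ) := g) refl g ⟩
    g ∎)

  extension : Field
  extension = record
    { Carrier = Carrier × Carrier ; _+_ = _⊞_ ; _*_ = _⊠_ ; -_ = ⊟_ ; 0# = 0# , 0# ; 1# = 1# , 0#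
    ; isCommutativeRing = commutativeRing-≡
        (λ (a , b) (c , d) (e , f) → cong₂ _,_ (+-assoc a c e) (+-assoc b d f))
        (λ (a , b) (c , d) → cong₂ _,_ (+-comm a c) (+-comm b d))
        (λ (a , b) → cong₂ _,_ (+-identityˡ a) (+-identityˡ b))
        (λ (a , b) → cong₂ _,_ (-‿inverseˡ a) (-‿inverseˡ b))
        (λ (a , b) (c , d) (e , f) → cong₂ _,_
          (solve 7 (λ a b c d e f g → (a :* c :+ g :* (b :* d)) :* e :+ g :* ((a :* d :+ b :* c) :* f)
             := a :* (c :* e :+ g :* (d :* f)) :+ g :* (b :* (c :* f :+ d :* e))) refl a b c d e f g)
          (solve 7 (λ a b c d e f g → (a :* c :+ g :* (b :* d)) :* f :+ (a :* d :+ b :* c) :* e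
             := a :* (c :* f :+ d :* e) :+ b :* (c :* e :+ g :* (d :* f))) refl a b c d e f g))
        (λ (a , b) (c , d) → cong₂ _,_
          (solve 5 (λ a b c d g → a :* c :+ g :* (b :* d) := c :* a :+ g :* (d :* b)) refl a b c d g)
          (solve 4 (λ a b c d → a :* d :+ b :* c := c :* b :+ d :* a) refl a b c d))
        (λ (a , b) → cong₂ _,_
          (solve 3 (λ a b g → 1ₖ :* a :+ g :* (0ₖ :* b) := a) refl a b g)
          (solve 2 (λ a b → 1ₖ :* b :+ 0ₖ :* a := b) refl a b))
        (λ (a , b) (c , d) (e , f) → cong₂ _,_
          (solve 7 (λ a b c d e f g → a :* (c :+ e) :+ g :* (b :* (d :+ f))
             := (a :* c :+ g :* (b :* d)) :+ (a :* e :+ g :* (b :* f))) refl a b c d e f g)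
          (solve 6 (λ a b c d e f → a :* (d :+ f) :+ b :* (c :+ e)
             := (a :* d :+ b :* c) :+ (a :* f :+ b :* e)) refl a b c d e f))
    ; _≟_ = Product.≡-dec _≟_ _≟_
    ; 1≢0 = λ e → 1≢0 (cong proj₁ e)
    ; inverse = inverse′ }
    where
    inverse′ : ∀ x → x ≢ (0# , 0#) → ∃ λ y → x ⊠ y ≡ (1# , 0#)
    inverse′ (a , b) ab≢0 with inverse _ (norm≢0 a b ab≢0)
    ... | i , Ni≡1 = (a * i , - (b * i)) , cong₂ _,_
      (trans (solve 4 (λ a b g i → a :* (a :* i) :+ g :* (b :* (:- (b :* i))) := (a :* a :- g :* (b :* b)) :* i) refl a b g i) Ni≡1)
      (solve 3 (λ a b i → a :* (:- (b :* i)) :+ b :* (a :* i) := 0ₖ) refl a b i)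

  ι-extension : ∀ n → FieldProperties.ι extension n ≡ (ι n , 0#)
  ι-extension zero = refl
  ι-extension (suc n) = trans (cong ((1# , 0#) ⊞_) (ι-extension n)) (cong (1# + ι n ,_) (+-identityˡ 0#))

-- Counting and pruning

open import Data.Bool using (Bool; true; false; T; T?)

module Counting where
  open ℕ.≤-Reasoning
  open ≡ using (refl; sym; trans; cong; cong₂)
  open import Data.Nat using (_+_; _*_)

  ∑ : {A : Set} → List A → (A → ℕ) → ℕ
  ∑ [] f = 0
  ∑ (x ∷ xs) f = f x + ∑ xs f

  module _ {A : Set} where

    ∑-cong : ∀ {f g : A → ℕ} → (∀ x → f x ≡ g x) → ∀ xs → ∑ xs f ≡ ∑ xs g
    ∑-cong e [] = refl
    ∑-cong e (x ∷ xs) = cong₂ _+_ (e x) (∑-cong e xs)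

    ∑-mono : ∀ {f g : A → ℕ} → (∀ x → f x ≤ g x) → ∀ xs → ∑ xs f ≤ ∑ xs g
    ∑-mono e [] = z≤n
    ∑-mono e (x ∷ xs) = ℕ.+-mono-≤ (e x) (∑-mono e xs)

    ∑-zero : ∀ (xs : List A) → ∑ xs (λ _ → 0) ≡ 0
    ∑-zero [] = refl
    ∑-zero (_ ∷ xs) = ∑-zero xs

    interchange : ∀ a b c d → (a + b) + (c + d) ≡ (a + c) + (b + d)
    interchange = solve-∀

    ∑-+ : ∀ (f g : A → ℕ) xs → ∑ xs (λ x → f x + g x) ≡ ∑ xs f + ∑ xs g
    ∑-+ f g [] = refl
    ∑-+ f g (x ∷ xs) = trans (cong (f x + g x +_) (∑-+ f g xs)) (interchange (f x) (g x) _ _)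

    ∑-++ : ∀ (f : A → ℕ) xs ys → ∑ (xs ++ ys) f ≡ ∑ xs f + ∑ ys f
    ∑-++ f [] ys = refl
    ∑-++ f (x ∷ xs) ys = trans (cong (f x +_) (∑-++ f xs ys)) (sym (ℕ.+-assoc (f x) _ _))

    ∑-remove : ∀ (f : A → ℕ) xs x ys → ∑ (xs ++ x ∷ ys) f ≡ f x + ∑ (xs ++ ys) f
    ∑-remove f [] x ys = refl
    ∑-remove f (y ∷ xs) x ys = trans (cong (f y +_) (∑-remove f xs x ys)) (rotate (f y) (f x) _)
      where
      rotate : ∀ a b c → a + (b + c) ≡ b + (a + c)
      rotate = solve-∀

    ∑-filter : ∀ {P : A → Set} (P? : ∀ x → Dec (P x)) (f : A → ℕ) xs →
               ∑ xs f ≡ ∑ (filter P? xs) f + ∑ (filter (λ x → ¬? (P? x)) xs) f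
    ∑-filter P? f [] = refl
    ∑-filter P? f (x ∷ xs) with P? x
    ... | yes _ = trans (cong (f x +_) (∑-filter P? f xs)) (sym (ℕ.+-assoc (f x) _ _))
    ... | no _ = trans (cong (f x +_) (∑-filter P? f xs)) (rotate (f x) (∑ (filter P? xs) f) _)
      where
      rotate : ∀ a b c → a + (b + c) ≡ b + (a + c)
      rotate = solve-∀

  ∑-map : ∀ {A B : Set} (h : A → B) f xs → ∑ (map h xs) f ≡ ∑ xs (λ x → f (h x))
  ∑-map h f [] = refl
  ∑-map h f (x ∷ xs) = cong (f (h x) +_) (∑-map h f xs)

  ∑-swap : ∀ {A B : Set} (f : A → B → ℕ) xs ys → ∑ xs (λ x → ∑ ys (f x)) ≡ ∑ ys (λ y → ∑ xs (λ x → f x y))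
  ∑-swap f [] ys = sym (∑-zero ys)
  ∑-swap f (x ∷ xs) ys = trans (cong (∑ ys (f x) +_) (∑-swap f xs ys)) (sym (∑-+ (f x) _ ys))

  ∑-product : ∀ {A B : Set} (f : A × B → ℕ) xs ys → ∑ (cartesianProduct xs ys) f ≡ ∑ xs (λ x → ∑ ys (λ y → f (x , y)))
  ∑-product f [] ys = refl
  ∑-product f (x ∷ xs) ys = trans (∑-++ f (map (x ,_) ys) _) (cong₂ _+_ (∑-map (x ,_) f ys) (∑-product f xs ys))

  𝟙 : Bool → ℕ
  𝟙 true = 1
  𝟙 false = 0

  ∑-𝟙 : ∀ {A : Set} (b : A → Bool) xs → ∑ xs (λ x → 𝟙 (b x)) ≡ length (filter (λ x → T? (b x)) xs)
  ∑-𝟙 b [] = refl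
  ∑-𝟙 b (x ∷ xs) with b x
  ... | true = cong suc (∑-𝟙 b xs)
  ... | false = ∑-𝟙 b xs

  -- Summed over the values s of f, this is 2 T r ≤ r² + T² for the size r of the fibre over s.
  second-moment : ∀ {A B : Set} (_≟_ : DecidableEquality B) (f : A → B) T ss xs → All (λ x → f x ∈ ss) xs →
    2 * T * length xs ≤ ∑ xs (λ x → ∑ xs (λ y → 𝟙 (isYes (f x ≟ f y)))) + T * T * length ss
  second-moment _≟_ f T [] [] _ = ℕ.≤-trans (ℕ.≤-reflexive (ℕ.*-zeroʳ (2 * T))) z≤n
  second-moment _≟_ f T [] (x ∷ xs) (() ∷ _)
  second-moment {A} {B} _≟_ f T (s ∷ ss) xs f∈ = begin
    2 * T * length xs ≡⟨ cong (2 * T *_) (length-split P? xs) ⟩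
    2 * T * (length ys + length zs) ≡⟨ ℕ.*-distribˡ-+ (2 * T) (length ys) (length zs) ⟩
    2 * T * length ys + 2 * T * length zs ≤⟨ ℕ.+-mono-≤ (am-gm T (length ys)) (second-moment _≟_ f T ss zs zs∈) ⟩
    length ys * length ys + T * T + (∑∑ zs + T * T * length ss) ≡⟨ rearrange (length ys * length ys) (T * T) (∑∑ zs) (length ss) ⟩
    length ys * length ys + ∑∑ zs + T * T * suc (length ss) ≤⟨ ℕ.+-monoˡ-≤ _ (ℕ.+-mono-≤ (fibre ys (All.all-filter P? xs)) (ℕ.≤-refl {∑∑ zs})) ⟩
    ∑∑ ys + ∑∑ zs + T * T * suc (length ss) ≤⟨ ℕ.+-monoˡ-≤ _ blocks ⟩
    ∑∑ xs + T * T * suc (length ss) ∎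
    where
    P? = λ x → f x ≟ s
    ys = filter P? xs
    zs = filter (λ x → ¬? (P? x)) xs

    ∑∑ : List A → ℕ
    ∑∑ xs = ∑ xs (λ x → ∑ xs (λ y → 𝟙 (isYes (f x ≟ f y))))

    rearrange : ∀ a b c d → a + b + (c + b * d) ≡ a + c + b * suc d
    rearrange = solve-∀

    am-gm : ∀ T r → 2 * T * r ≤ r * r + T * T
    am-gm T r with ℕ.≤-total T r
    ... | inj₁ T≤r with ℕ.m≤n⇒∃[o]m+o≡n T≤r
    ... | k , refl = ℕ.≤-trans (ℕ.m≤m+n _ (k * k)) (ℕ.≤-reflexive (square T k))
      where
      square : ∀ T k → 2 * T * (T + k) + k * k ≡ (T + k) * (T + k) + T * T
      square = solve-∀
    am-gm T r | inj₂ r≤T with ℕ.m≤n⇒∃[o]m+o≡n r≤T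
    ... | k , refl = ℕ.≤-trans (ℕ.m≤m+n _ (k * k)) (ℕ.≤-reflexive (square r k))
      where
      square : ∀ r k → 2 * (r + k) * r + k * k ≡ r * r + (r + k) * (r + k)
      square = solve-∀

    ≟-refl : ∀ s → 𝟙 (isYes (s ≟ s)) ≡ 1
    ≟-refl s with s ≟ s
    ... | yes _ = refl
    ... | no s≢s = ⊥-elim (s≢s refl)

    constant-sum : ∀ {xs} (g : A → ℕ) {c} → All (λ x → g x ≡ c) xs → ∑ xs g ≡ length xs * c
    constant-sum g [] = refl
    constant-sum g (e ∷ es) = cong₂ _+_ e (constant-sum g es)

    fibre : ∀ ys → All (λ x → f x ≡ s) ys → length ys * length ys ≤ ∑∑ ys
    fibre ys e = ℕ.≤-reflexive (sym (constant-sum _ (All.map (λ fx → trans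
      (constant-sum _ (All.map (λ fy → trans (cong₂ (λ a b → 𝟙 (isYes (a ≟ b))) fx fy) (≟-refl s)) e)) (ℕ.*-identityʳ _)) e)))

    blocks : ∑∑ ys + ∑∑ zs ≤ ∑∑ xs
    blocks = ℕ.≤-trans
      (ℕ.+-mono-≤ (∑-mono (λ x → ℕ.≤-trans (ℕ.m≤m+n _ _) (ℕ.≤-reflexive (sym (∑-filter P? _ xs)))) ys)
                  (∑-mono (λ x → ℕ.≤-trans (ℕ.m≤n+m _ _) (ℕ.≤-reflexive (sym (∑-filter P? _ xs)))) zs))
      (ℕ.≤-reflexive (sym (∑-filter P? _ xs)))

    zs∈ : All (λ x → f x ∈ ss) zs
    zs∈ = All.zipWith (λ { (here e , ¬e) → ⊥-elim (¬e e) ; (there i , _) → i })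
            (All.filter⁺ (λ x → ¬? (P? x)) f∈ , All.all-filter (λ x → ¬? (P? x)) xs)

  Unique-remove : ∀ {A : Set} xs {x : A} {ys} → Unique (xs ++ x ∷ ys) → Unique (xs ++ ys)
  Unique-remove [] (_ ∷ u) = u
  Unique-remove (y ∷ xs) (n ∷ u) = All.++⁺ (All.++⁻ˡ xs n) (All.tail (All.++⁻ʳ xs n)) ∷ Unique-remove xs u

  ∈-remove : ∀ {A : Set} xs {x : A} {ys z} → z ∈ xs ++ ys → z ∈ xs ++ x ∷ ys
  ∈-remove [] i = there i
  ∈-remove (_ ∷ xs) (here e) = here e
  ∈-remove (_ ∷ xs) (there i) = there (∈-remove xs i)

  length-remove : ∀ {A : Set} xs {x : A} {ys} → length (xs ++ x ∷ ys) ≡ suc (length (xs ++ ys))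
  length-remove [] = refl
  length-remove (_ ∷ xs) = cong suc (length-remove xs)

  module _ {A : Set} (e : A → A → ℕ) (e-sym : ∀ x y → e x y ≡ e y x) where

    record Core (U : List A) (T : ℕ) : Set where
      field
        vertices : List A
        unique   : Unique vertices
        subset   : ∀ {v} → v ∈ vertices → v ∈ U
        small    : length vertices ≤ length U
        nonempty : ∃ (_∈ vertices)
        degree   : ∀ {v} → v ∈ vertices → T < ∑ vertices (e v)

    -- Removing a vertex of degree at most `T` lowers the sum of the degrees by at most 2 T, so
    -- their average stays above 2 T and the list cannot become empty.
    prune : ∀ n U T → length U ≡ n → Unique U → 2 * T * length U < ∑ U (λ u → ∑ U (e u)) → Core U T
    prune n U T len uniq dense with All.all? (λ u → T ℕ.<? ∑ U (e u)) U
    prune n (u ∷ U) T len uniq dense | yes deg = record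
      { vertices = u ∷ U ; unique = uniq ; subset = λ i → i ; small = ℕ.≤-refl ; nonempty = u , here refl
      ; degree = All.lookup deg }
    ... | no ¬deg with Data.List.Membership.Propositional.find (All.¬All⇒Any¬ (λ u → T ℕ.<? ∑ U (e u)) U ¬deg)
    ... | u , u∈U , u≯T with ∈-∃++ u∈U
    prune zero _ T len uniq dense | no ¬deg | u , u∈U , u≯T | xs , ys , refl with () ← trans (sym (length-remove xs)) len
    prune (suc n) _ T len uniq dense | no ¬deg | u , u∈U , u≯T | xs , ys , refl = record
      { vertices = vertices ; unique = unique ; subset = λ i → ∈-remove xs (subset i)
      ; small = ℕ.≤-trans small (ℕ.≤-trans (ℕ.n≤1+n _) (ℕ.≤-reflexive (sym (length-remove xs))))
      ; nonempty = nonempty ; degree = degree }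
      where
      U = xs ++ u ∷ ys
      R = xs ++ ys

      total : ∑ U (λ v → ∑ U (e v)) ≤ 2 * T + ∑ R (λ v → ∑ R (e v))
      total = begin
        ∑ U (λ v → ∑ U (e v)) ≡⟨ ∑-remove _ xs u ys ⟩
        ∑ U (e u) + ∑ R (λ v → ∑ U (e v)) ≡⟨ cong (∑ U (e u) +_) (∑-cong (λ v → ∑-remove (e v) xs u ys) R) ⟩
        ∑ U (e u) + ∑ R (λ v → e v u + ∑ R (e v)) ≡⟨ cong (∑ U (e u) +_) (∑-+ (λ v → e v u) _ R) ⟩
        ∑ U (e u) + (∑ R (λ v → e v u) + ∑ R (λ v → ∑ R (e v)))
          ≤⟨ ℕ.+-mono-≤ (ℕ.≮⇒≥ u≯T) (ℕ.+-monoˡ-≤ _ (ℕ.≤-trans (ℕ.≤-reflexive (∑-cong (λ v → e-sym v u) R))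
               (ℕ.≤-trans (ℕ.m≤n+m _ (e u u)) (ℕ.≤-trans (ℕ.≤-reflexive (sym (∑-remove (e u) xs u ys))) (ℕ.≮⇒≥ u≯T))))) ⟩
        T + (T + ∑ R (λ v → ∑ R (e v))) ≡⟨ double T _ ⟩
        2 * T + ∑ R (λ v → ∑ R (e v)) ∎
        where
        double : ∀ T x → T + (T + x) ≡ 2 * T + x
        double = solve-∀

      open Core (prune n R T (ℕ.suc-injective (trans (sym (length-remove xs)) len)) (Unique-remove xs uniq)
        (ℕ.+-cancelˡ-< (2 * T) _ _ (ℕ.<-≤-trans (ℕ.≤-<-trans
          (ℕ.≤-reflexive (sym (trans (cong (2 * T *_) (length-remove xs)) (ℕ.*-suc (2 * T) (length R))))) dense) total)))

  injective-length : ∀ {A B : Set} (f : A → B) {xs ys} → Unique xs → (∀ {x} → x ∈ xs → f x ∈ ys) →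
    (∀ {x y} → x ∈ xs → y ∈ xs → f x ≡ f y → x ≡ y) → length xs ≤ length ys
  injective-length f {[]} _ _ _ = z≤n
  injective-length f {x ∷ xs} (x∉ ∷ u) into inj with ∈-∃++ (into (here refl))
  ... | ys , zs , refl = ℕ.≤-trans (s≤s (injective-length f u into′ λ i j → inj (there i) (there j)))
                           (ℕ.≤-reflexive (sym (length-remove ys)))
    where
    into′ : ∀ {y} → y ∈ xs → f y ∈ ys ++ zs
    into′ {y} i with ∈-++⁻ ys (into (there i))
    ... | inj₁ l = ∈-++⁺ˡ l
    ... | inj₂ (here e) = ⊥-elim (All.lookup x∉ i (inj (here refl) (there i) (sym e)))
    ... | inj₂ (there r) = ∈-++⁺ʳ ys r

  Unique-map : ∀ {A B : Set} (f : A → B) {xs} → Unique xs → (∀ {x y} → x ∈ xs → y ∈ xs → f x ≡ f y → x ≡ y) →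
               Unique (map f xs)
  Unique-map f [] inj = []
  Unique-map f (x∉ ∷ u) inj = All.map⁺ (All.tabulate λ i e → All.lookup x∉ i (inj (here refl) (there i) e)) ∷
    Unique-map f u λ i j → inj (there i) (there j)

-- The configuration of lines attached to a set

open Counting

-- The second moment is taken with parameter 2 T + 1. The values then cost at most half of the left
-- side, and the rest exceeds what pruning asks for.
many-coincidences : ∀ T n k S → 0 < n → 2 ℕ.* suc (2 ℕ.* T) ℕ.* n ≤ S ℕ.+ suc (2 ℕ.* T) ℕ.* suc (2 ℕ.* T) ℕ.* k →
  suc (2 ℕ.* T) ℕ.* k ≤ n → 2 ℕ.* T ℕ.* n < S
many-coincidences T n k S 0<n moment few = begin-strict
  2 ℕ.* T ℕ.* n <⟨ ℕ.m<n+m (2 ℕ.* T ℕ.* n) 0<n ⟩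
  suc (2 ℕ.* T) ℕ.* n ≤⟨ ℕ.+-cancelʳ-≤ (suc (2 ℕ.* T) ℕ.* n) _ S (begin
    suc (2 ℕ.* T) ℕ.* n ℕ.+ suc (2 ℕ.* T) ℕ.* n ≡⟨ twice (suc (2 ℕ.* T)) n ⟩
    2 ℕ.* suc (2 ℕ.* T) ℕ.* n ≤⟨ moment ⟩
    S ℕ.+ suc (2 ℕ.* T) ℕ.* suc (2 ℕ.* T) ℕ.* k ≡⟨ ≡.cong (S ℕ.+_) (ℕ.*-assoc (suc (2 ℕ.* T)) (suc (2 ℕ.* T)) k) ⟩
    S ℕ.+ suc (2 ℕ.* T) ℕ.* (suc (2 ℕ.* T) ℕ.* k) ≤⟨ ℕ.+-monoʳ-≤ S (ℕ.*-monoʳ-≤ (suc (2 ℕ.* T)) few) ⟩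
    S ℕ.+ suc (2 ℕ.* T) ℕ.* n ∎) ⟩
  S ∎
  where
  open ℕ.≤-Reasoning
  twice : ∀ a n → a ℕ.* n ℕ.+ a ℕ.* n ≡ 2 ℕ.* a ℕ.* n
  twice = solve-∀

module LineGeometry (F : Field) (p : ℕ)
  (char : ∀ n → suc n < p → FieldProperties.ι F (suc n) ≢ Field.0# F) where
  open Field F
  open FieldProperties F
  open Crossings F p char
  open ≡ using (refl; sym; trans; cong; cong₂; module ≡-Reasoning)
  open ≡-Reasoning

  reciprocal : Carrier → Carrier
  reciprocal x with x ≟ 0#
  ... | yes _ = 0#
  ... | no x≢0 = proj₁ (inverse x x≢0)

  reciprocal-inverse : ∀ x → x ≢ 0# → x * reciprocal x ≡ 1#
  reciprocal-inverse x x≢0 with x ≟ 0#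
  ... | yes x≡0 = ⊥-elim (x≢0 x≡0)
  ... | no x≢0 = proj₂ (inverse x x≢0)

  -- The parameter at which the second coordinates of the two lines agree, hence that of their
  -- crossing if they meet.
  slope : Line → Line → Carrier
  slope (x , y , _) (x′ , y′ , _) = (y′ - y) * reciprocal (x - x′)

  slope-* : ∀ ℓ m → proj₁ ℓ ≢ proj₁ m →
            slope ℓ m * (proj₁ ℓ - proj₁ m) ≡ proj₁ (proj₂ m) - proj₁ (proj₂ ℓ)
  slope-* (x , y , _) (x′ , y′ , _) x≢x′ = begin
    (y′ - y) * reciprocal (x - x′) * (x - x′)
      ≡⟨ solve 3 (λ a r d → a :* r :* d := a :* (d :* r)) refl (y′ - y) (reciprocal (x - x′)) (x - x′) ⟩
    (y′ - y) * ((x - x′) * reciprocal (x - x′)) ≡⟨ cong ((y′ - y) *_) (reciprocal-inverse _ (-‿≢0 x≢x′)) ⟩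
    (y′ - y) * 1# ≡⟨ *-identityʳ _ ⟩
    y′ - y ∎

  slope-cross : ∀ ℓ m → proj₁ ℓ ≢ proj₁ m →
    proj₂ (proj₂ ℓ) + proj₁ ℓ * proj₁ (proj₂ m) ≡ proj₂ (proj₂ m) + proj₁ m * proj₁ (proj₂ ℓ) → Cross ℓ m (slope ℓ m)
  slope-cross ℓ@(x , y , z) m@(x′ , y′ , z′) x≢x′ incident = cross x≢x′ (cong₂ _,_ first (cong (_, 0# + w * 1#) second))
    where
    w = slope ℓ m
    w* = slope-* ℓ m x≢x′

    second : y + w * x ≡ y′ + w * x′
    second = -‿≡0 (trans
      (solve 5 (λ x x′ y y′ w → (y :+ w :* x) :- (y′ :+ w :* x′) := w :* (x :- x′) :- (y′ :- y)) refl x x′ y y′ w)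
      (x≡y⇒x-y≡0 w*))

    first : (z + x * y) + w * (x * x) ≡ (z′ + x′ * y′) + w * (x′ * x′)
    first = -‿≡0 (begin
      ((z + x * y) + w * (x * x)) - ((z′ + x′ * y′) + w * (x′ * x′))
        ≡⟨ solve 7 (λ x y z x′ y′ z′ w →
             ((z :+ x :* y) :+ w :* (x :* x)) :- ((z′ :+ x′ :* y′) :+ w :* (x′ :* x′))
             := ((z :+ x :* y′) :- (z′ :+ x′ :* y)) :+ (w :* (x :- x′) :- (y′ :- y)) :* (x :+ x′)) refl x y z x′ y′ z′ w ⟩
      ((z + x * y′) - (z′ + x′ * y)) + (w * (x - x′) - (y′ - y)) * (x + x′)
        ≡⟨ cong₂ (λ a b → a + b * (x + x′)) (x≡y⇒x-y≡0 incident) (x≡y⇒x-y≡0 w*) ⟩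
      0# + 0# * (x + x′) ≡⟨ solve 1 (λ s → 0ₖ :+ 0ₖ :* s := 0ₖ) refl (x + x′) ⟩
      0# ∎)

  -- As w (x - x′) = y′ - y, the relation is affine in (x′ , y′), and it fails at (x , y): the
  -- neighbours lie on a line in the plane.
  collinear : ∀ ℓ m {c k} → proj₁ ℓ ≢ proj₁ m → 1# + (proj₁ m - proj₁ ℓ) * (c + slope ℓ m * k) ≡ 0# →
    1# + (proj₁ m - proj₁ ℓ) * c - (proj₁ (proj₂ m) - proj₁ (proj₂ ℓ)) * k ≡ 0#
  collinear ℓ@(x , y , _) m@(x′ , y′ , _) {c} {k} x≢x′ h = begin
    1# + (x′ - x) * c - (y′ - y) * k ≡⟨ cong (λ t → 1# + (x′ - x) * c - t * k) (sym (slope-* ℓ m x≢x′)) ⟩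
    1# + (x′ - x) * c - slope ℓ m * (x - x′) * k
      ≡⟨ solve 5 (λ x x′ c k w → 1ₖ :+ (x′ :- x) :* c :- w :* (x :- x′) :* k := 1ₖ :+ (x′ :- x) :* (c :+ w :* k)) refl x x′ c k (slope ℓ m) ⟩
    1# + (x′ - x) * (c + slope ℓ m * k) ≡⟨ h ⟩
    0# ∎

  same-x : ∀ {x x′ y y₁ y₂ c k} → k ≢ 0# → 1# + (x′ - x) * c - (y₁ - y) * k ≡ 0# → 1# + (x′ - x) * c - (y₂ - y) * k ≡ 0# → y₁ ≡ y₂
  same-x {x} {x′} {y} {y₁} {y₂} {c} {k} k≢0 h₁ h₂ = -‿≡0 (*-cancel k≢0 (begin
    k * (y₁ - y₂)
      ≡⟨ solve 7 (λ x x′ y y₁ y₂ c k → k :* (y₁ :- y₂)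
           := (1ₖ :+ (x′ :- x) :* c :- (y₂ :- y) :* k) :- (1ₖ :+ (x′ :- x) :* c :- (y₁ :- y) :* k)) refl x x′ y y₁ y₂ c k ⟩
    (1# + (x′ - x) * c - (y₂ - y) * k) - (1# + (x′ - x) * c - (y₁ - y) * k) ≡⟨ cong₂ _-_ h₂ h₁ ⟩
    0# - 0# ≡⟨ -‿inverseʳ 0# ⟩
    0# ∎))

  -- For `k` zero the relation reads 1 + (x′ - x) c = 0; hence `c` is nonzero and x′ is fixed.
  same-y : ∀ {x x₁ x₂ y y₁ y₂ c k} → k ≡ 0# → 1# + (x₁ - x) * c - (y₁ - y) * k ≡ 0# → 1# + (x₂ - x) * c - (y₂ - y) * k ≡ 0# → x₁ ≡ x₂
  same-y {x} {x₁} {x₂} {y} {y₁} {y₂} {c} refl h₁ h₂ = -‿≡0 (*-cancel c≢0 (begin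
    c * (x₁ - x₂)
      ≡⟨ solve 6 (λ x x₁ x₂ c y y₂ → c :* (x₁ :- x₂)
           := (1ₖ :+ (x₁ :- x) :* c :- y :* 0ₖ) :- (1ₖ :+ (x₂ :- x) :* c :- y₂ :* 0ₖ)) refl x x₁ x₂ c (y₁ - y) (y₂ - y) ⟩
    (1# + (x₁ - x) * c - (y₁ - y) * 0#) - (1# + (x₂ - x) * c - (y₂ - y) * 0#) ≡⟨ cong₂ _-_ h₁ h₂ ⟩
    0# - 0# ≡⟨ -‿inverseʳ 0# ⟩
    0# ∎))
    where
    c≢0 : c ≢ 0#
    c≢0 refl = 1≢0 (trans (solve 2 (λ a b → 1ₖ := 1ₖ :+ a :* 0ₖ :- b :* 0ₖ) refl (x₁ - x) (y₁ - y)) h₁)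

module SlopeCoordinates (F : Field) (g : Field.Carrier F) (nonsquare : ∀ x → Field._*_ F x x ≢ g) where
  open Field F
  open FieldProperties F
  module K = Field (QuadraticExtension.extension F g nonsquare)
  open ≡ using (refl; sym; trans; cong; cong₂)

  -- The λ-component of `W` is nonzero, since otherwise `W` and with it `β` would vanish; so the
  -- λ-component of the product determines `α`. It is applied with `ε` equal to 1 or - 1, the
  -- difference created by the shift.
  slope-coordinates : ∀ (W : K.Carrier) {α α′ ε β β′ η} → ε ≢ 0# → η ≡ 0# → β ≢ 0# →
    W K.* (α , ε) ≡ (β , η) → W K.* (α′ , ε) ≡ (β′ , η) → α ≡ α′ × β ≡ β′
  slope-coordinates (w₁ , w₂) {α} {α′} {ε} {β} {β′} ε≢0 refl β≢0 e e′ = α≡ , trans (sym (cong proj₁ e)) (trans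
    (cong (λ a → w₁ * a + g * (w₂ * ε)) α≡) (cong proj₁ e′))
    where
    w₂≢0 : w₂ ≢ 0#
    w₂≢0 refl = β≢0 (trans (sym (cong proj₁ e)) (trans (cong (λ w → w * α + g * (0# * ε)) w₁≡0)
      (solve 3 (λ a g ε → 0ₖ :* a :+ g :* (0ₖ :* ε) := 0ₖ) refl α g ε)))
      where
      w₁≡0 : w₁ ≡ 0#
      w₁≡0 = *-cancel ε≢0 (trans (solve 3 (λ ε w a → ε :* w := w :* ε :+ 0ₖ :* a) refl ε w₁ α) (cong proj₂ e))
    α≡ : α ≡ α′
    α≡ = -‿≡0 (*-cancel w₂≢0 (trans
      (solve 5 (λ w₁ w₂ ε a a′ → w₂ :* (a :- a′) := (w₁ :* ε :+ w₂ :* a) :- (w₁ :* ε :+ w₂ :* a′)) refl w₁ w₂ ε α α′)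
      (trans (cong₂ _-_ (cong proj₂ e) (cong proj₂ e′)) (-‿inverseʳ 0#))))

module Configuration (F : Field) (p : ℕ) (char : ∀ n → suc n < p → FieldProperties.ι F (suc n) ≢ Field.0# F)
  (g : Field.Carrier F) (nonsquare : ∀ x → Field._*_ F x x ≢ g) (c₀ : Field.Carrier F) (c₀≢0 : c₀ ≢ Field.0# F) where
  open ≡ using (refl; sym; trans; cong; cong₂; subst; subst₂; module ≡-Reasoning)
  open ≡-Reasoning

  private
    module F where
      open Field F public
      open FieldProperties F public
  open F using (0ₖ; 1ₖ; solve; _:=_; _:+_; _:*_; _:-_; :-_)

  K : Field
  K = QuadraticExtension.extension F g nonsquare

  private
    module K = Field K

  charK : ∀ n → suc n < p → FieldProperties.ι K (suc n) ≢ K.0#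
  charK n n<p e = char n n<p (cong proj₁ (trans (sym (QuadraticExtension.ι-extension F g nonsquare (suc n))) e))

  open Crossings K p charK using (Line)
  open LineGeometry K p charK
  open LineConfigurations K p charK

  Triple = F.Carrier × F.Carrier × F.Carrier

  Vertex = Bool × Triple

  tag : Bool → Triple → Vertex
  tag b t = b , t

  -- With λ = (0 , 1), the lines (a + λ , y , c₀ z) and (a′ , y′ , c₀ z′ + λ y′) are incident iff
  -- a y′ + c₀ z = a′ y + c₀ z′.
  line : Vertex → Line
  line (true , a , y , z) = (a , F.1#) , (y , F.0#) , (c₀ F.* z , F.0#)
  line (false , a , y , z) = (a , F.0#) , (y , F.0#) , (c₀ F.* z , y)

  f : Triple → F.Carrier
  f (a , d , z) = a F.* d F.+ c₀ F.* z

  -- The middle entries are exchanged so that each side of the coincidence uses both triples. Only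
  -- in this form is it an incidence between a line of one triple and a line of the other.
  G : Triple → Triple → Bool
  G (a , y , z) (a′ , y′ , z′) = isYes (f (a , y′ , z) F.≟ f (a′ , y , z′))

  link : Vertex → Vertex → Bool
  link (true , t) (false , t′) = G t t′
  link (false , t′) (true , t) = G t t′
  link (true , _) (true , _) = false
  link (false , _) (false , _) = false

  incident : ∀ u v → T (link u v) →
    proj₂ (proj₂ (line u)) K.+ proj₁ (line u) K.* proj₁ (proj₂ (line v)) ≡
    proj₂ (proj₂ (line v)) K.+ proj₁ (line v) K.* proj₁ (proj₂ (line u))
  incident (true , a , y , z) (false , a′ , y′ , z′) e = cong₂ _,_
    (trans (solve 4 (λ cz a y′ g → cz :+ (a :* y′ :+ g :* (1ₖ :* 0ₖ)) := a :* y′ :+ cz) refl (c₀ F.* z) a y′ g)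
      (trans (toWitness e)
        (solve 4 (λ cz a y′ g → a :* y′ :+ cz := cz :+ (a :* y′ :+ g :* (0ₖ :* 0ₖ))) refl (c₀ F.* z′) a′ y g)))
    (solve 4 (λ a a′ y y′ → 0ₖ :+ (a :* 0ₖ :+ 1ₖ :* y′) := y′ :+ (a′ :* 0ₖ :+ 0ₖ :* y)) refl a a′ y y′)
  incident u@(false , _) v@(true , _) e = sym (incident v u e)

  x-distinct : ∀ u v → T (link u v) → proj₁ (line u) ≢ proj₁ (line v)
  x-distinct (true , _) (false , _) _ e = F.1≢0 (cong proj₂ e)
  x-distinct (false , _) (true , _) _ e = F.1≢0 (sym (cong proj₂ e))

  z-determined : ∀ {a d z z′} → f (a , d , z) ≡ f (a , d , z′) → z ≡ z′
  z-determined {a} {d} {z} {z′} e = F.-‿≡0 (F.*-cancel c₀≢0 (trans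
    (solve 4 (λ c z z′ ad → c :* (z :- z′) := (ad :+ c :* z) :- (ad :+ c :* z′)) refl c₀ z z′ (a F.* d))
    (F.x≡y⇒x-y≡0 e)))

  abscissa ordinate : Vertex → F.Carrier
  abscissa (_ , a , _) = a
  ordinate (_ , _ , y , _) = y

  neighbour-determined : ∀ u v v′ → T (link u v) → T (link u v′) → abscissa v ≡ abscissa v′ → ordinate v ≡ ordinate v′ → v ≡ v′
  neighbour-determined (true , a , y , z) (false , a′ , y′ , z₁) (false , _ , _ , z₂) e₁ e₂ refl refl =
    cong (λ z → false , a′ , y′ , z) (z-determined {a′} {y}
      (trans (sym (toWitness e₁)) (toWitness e₂)))
  neighbour-determined (false , a′ , y′ , z′) (true , a , y , z₁) (true , _ , _ , z₂) e₁ e₂ refl refl =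
    cong (λ z → true , a , y , z) (z-determined {a} {y′}
      (trans (toWitness e₁) (sym (toWitness e₂))))

  x-equal : ∀ u v v′ → T (link u v) → T (link u v′) → abscissa v ≡ abscissa v′ → proj₁ (line v) ≡ proj₁ (line v′)
  x-equal (true , _) (false , _) (false , _) _ _ refl = refl
  x-equal (false , _) (true , _) (true , _) _ _ refl = refl

  y-line : ∀ v → proj₁ (proj₂ (line v)) ≡ (ordinate v , F.0#)
  y-line (true , _) = refl
  y-line (false , _) = refl

  x-line : ∀ v → proj₁ (proj₁ (line v)) ≡ abscissa v
  x-line (true , _) = refl
  x-line (false , _) = refl

  slopes-distinct : ∀ u v v′ → T (link u v) → T (link u v′) → ordinate v ≢ ordinate u →
                    slope (line u) (line v) ≡ slope (line u) (line v′) → v ≡ v′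
  slopes-distinct u v v′ e e′ y≢ s = neighbour-determined u v v′ e e′ (cancelˡ (proj₁ both)) (cancelʳ (proj₂ both))
    where
    open SlopeCoordinates F g nonsquare using (slope-coordinates)

    cancelˡ : ∀ {x a b} → x F.- a ≡ x F.- b → a ≡ b
    cancelˡ {x} {a} {b} e = F.-‿≡0 (trans (solve 3 (λ x a b → a :- b := (x :- b) :- (x :- a)) refl x a b)
      (F.x≡y⇒x-y≡0 (sym e)))

    cancelʳ : ∀ {x a b} → a F.- x ≡ b F.- x → a ≡ b
    cancelʳ {x} {a} {b} e = F.-‿≡0 (trans (solve 3 (λ x a b → a :- b := (a :- x) :- (b :- x)) refl x a b)
      (F.x≡y⇒x-y≡0 e))

    both : abscissa u F.- abscissa v ≡ abscissa u F.- abscissa v′ × ordinate v F.- ordinate u ≡ ordinate v′ F.- ordinate u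
    both = cases u v v′ e e′ y≢ (slope-* (line u) (line v) (x-distinct u v e))
      (trans (cong (K._* (proj₁ (line u) K.- proj₁ (line v′))) s) (slope-* (line u) (line v′) (x-distinct u v′ e′)))
      where
      cases : ∀ u v v′ → T (link u v) → T (link u v′) → ordinate v ≢ ordinate u → ∀ {W} →
        W K.* (proj₁ (line u) K.- proj₁ (line v)) ≡ proj₁ (proj₂ (line v)) K.- proj₁ (proj₂ (line u)) →
        W K.* (proj₁ (line u) K.- proj₁ (line v′)) ≡ proj₁ (proj₂ (line v′)) K.- proj₁ (proj₂ (line u)) →
        abscissa u F.- abscissa v ≡ abscissa u F.- abscissa v′ × ordinate v F.- ordinate u ≡ ordinate v′ F.- ordinate u
      cases (true , _) (false , _) (false , _) _ _ y≢ {W} =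
        slope-coordinates W (F.-‿≢0 F.1≢0) (F.-‿inverseʳ F.0#) (F.-‿≢0 y≢)
      cases (false , _) (true , _) (true , _) _ _ y≢ {W} =
        slope-coordinates W (F.-‿≢0 (λ e → F.1≢0 (sym e))) (F.-‿inverseʳ F.0#) (F.-‿≢0 y≢)

  neighbours : List Vertex → Vertex → List Vertex
  neighbours V u = filter (λ v → T? (link u v)) V

  e : Vertex → Vertex → ℕ
  e u v = 𝟙 (link u v)

  e-sym : ∀ u v → e u v ≡ e v u
  e-sym (true , _) (true , _) = refl
  e-sym (true , _) (false , _) = refl
  e-sym (false , _) (true , _) = refl
  e-sym (false , _) (false , _) = refl

  module _ (as : List (F.Carrier)) where

    triples : List Triple
    triples = cartesianProduct as (cartesianProduct as as)

    vertices : List Vertex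
    vertices = map (tag true) triples ++ map (tag false) triples

    ∑-triples : ∀ h → ∑ triples h ≡ ∑ as (λ a → ∑ as (λ y → ∑ as (λ z → h (a , y , z))))
    ∑-triples h = trans (∑-product h as _) (∑-cong (λ a → ∑-product _ as as) as)

    ∑-exchange : ∀ (H : F.Carrier → F.Carrier → F.Carrier → F.Carrier → ℕ) →
      ∑ as (λ y → ∑ as λ z → ∑ as λ a → ∑ as λ y′ → H y z a y′) ≡ ∑ as (λ y → ∑ as λ z → ∑ as λ a → ∑ as λ y′ → H y′ z a y)
    ∑-exchange H = trans (∑-cong (λ y → pull (H y)) as) (trans (∑-swap _ as as)
      (∑-cong (λ y → sym (pull λ z a y′ → H y′ z a y)) as))
      where
      pull : ∀ (h : F.Carrier → F.Carrier → F.Carrier → ℕ) →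
        ∑ as (λ z → ∑ as λ a → ∑ as λ y′ → h z a y′) ≡ ∑ as (λ y′ → ∑ as λ z → ∑ as λ a → h z a y′)
      pull h = trans (∑-cong (λ z → ∑-swap _ as as) as) (∑-swap _ as as)

    -- Exchanging the middle entries permutes the pairs of triples, so there are as many incidences
    -- as coincidences.
    ∑-links : ∑ triples (λ t → ∑ triples (λ t′ → 𝟙 (G t t′))) ≡ ∑ triples (λ t → ∑ triples (λ t′ → 𝟙 (isYes (f t F.≟ f t′))))
    ∑-links = begin
      ∑ triples (λ t → ∑ triples (λ t′ → 𝟙 (G t t′))) ≡⟨ expand (λ t t′ → 𝟙 (G t t′)) ⟩
      ∑ as (λ a → ∑ as λ y → ∑ as λ z → ∑ as λ a′ → ∑ as λ y′ → ∑ as λ z′ → M (a , y′ , z) (a′ , y , z′))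
        ≡⟨ ∑-cong (λ a → ∑-exchange λ y z a′ y′ → ∑ as λ z′ → M (a , y′ , z) (a′ , y , z′)) as ⟩
      ∑ as (λ a → ∑ as λ y → ∑ as λ z → ∑ as λ a′ → ∑ as λ y′ → ∑ as λ z′ → M (a , y , z) (a′ , y′ , z′))
        ≡⟨ sym (expand M) ⟩
      ∑ triples (λ t → ∑ triples (M t)) ∎
      where
      M : Triple → Triple → ℕ
      M t t′ = 𝟙 (isYes (f t F.≟ f t′))

      expand : ∀ (h : Triple → Triple → ℕ) → ∑ triples (λ t → ∑ triples (h t)) ≡
        ∑ as (λ a → ∑ as λ y → ∑ as λ z → ∑ as λ a′ → ∑ as λ y′ → ∑ as λ z′ → h (a , y , z) (a′ , y′ , z′))
      expand h = trans (∑-triples _) (∑-cong (λ a → ∑-cong (λ y → ∑-cong (λ z → ∑-triples _) as) as) as)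

    ∑-edges : ∑ vertices (λ u → ∑ vertices (e u)) ≡ 2 ℕ.* ∑ triples (λ t → ∑ triples (λ t′ → 𝟙 (isYes (f t F.≟ f t′))))
    ∑-edges = begin
      ∑ vertices (λ u → ∑ vertices (e u)) ≡⟨ split (λ u → ∑ vertices (e u)) ⟩
      ∑ triples (λ t → ∑ vertices (e (true , t))) ℕ.+ ∑ triples (λ t → ∑ vertices (e (false , t)))
        ≡⟨ cong₂ ℕ._+_ (∑-cong from-true triples) (∑-cong from-false triples) ⟩
      S ℕ.+ ∑ triples (λ t′ → ∑ triples (λ t → 𝟙 (G t t′))) ≡⟨ cong (S ℕ.+_) (∑-swap _ triples triples) ⟩
      S ℕ.+ S ≡⟨ cong (S ℕ.+_) (sym (ℕ.+-identityʳ S)) ⟩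
      2 ℕ.* S ≡⟨ cong (2 ℕ.*_) ∑-links ⟩
      _ ∎
      where
      S = ∑ triples (λ t → ∑ triples (λ t′ → 𝟙 (G t t′)))

      from-true : ∀ t → ∑ vertices (e (true , t)) ≡ ∑ triples (λ t′ → 𝟙 (G t t′))
      from-true t = trans (∑-++ (e (true , t)) (map (tag true) triples) (map (tag false) triples))
        (cong₂ ℕ._+_ (trans (∑-map (tag true) (e (true , t)) triples) (∑-zero triples)) (∑-map (tag false) (e (true , t)) triples))

      from-false : ∀ t → ∑ vertices (e (false , t)) ≡ ∑ triples (λ t′ → 𝟙 (G t′ t))
      from-false t = trans (∑-++ (e (false , t)) (map (tag true) triples) (map (tag false) triples)) (trans
        (cong₂ ℕ._+_ (∑-map (tag true) (e (false , t)) triples) (trans (∑-map (tag false) (e (false , t)) triples) (∑-zero triples)))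
        (ℕ.+-identityʳ _))

      split : ∀ h → ∑ vertices h ≡ ∑ triples (λ t → h (true , t)) ℕ.+ ∑ triples (λ t → h (false , t))
      split h = trans (∑-++ h (map (tag true) triples) _) (cong₂ ℕ._+_ (∑-map _ h triples) (∑-map _ h triples))

    length-triples : length triples ≡ length as ℕ.* (length as ℕ.* length as)
    length-triples = trans (length-cartesianProductWith _,_ as (cartesianProduct as as))
      (cong (length as ℕ.*_) (length-cartesianProductWith _,_ as as))

    length-vertices : length vertices ≡ 2 ℕ.* length triples
    length-vertices = trans (List.length-++ (map (tag true) triples)) (cong₂ ℕ._+_ (List.length-map (tag true) triples)
      (trans (List.length-map (tag false) triples) (sym (ℕ.+-identityʳ (length triples)))))

    ∈-vertices : ∀ {v} → v ∈ vertices → abscissa v ∈ as × ordinate v ∈ as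
    ∈-vertices v∈ with ∈-++⁻ (map (tag true) triples) v∈
    ... | inj₁ i = coordinates (∈-map⁻ (tag true) i)
      where
      coordinates : ∀ {v} → (∃ λ t → t ∈ triples × v ≡ (true , t)) → abscissa v ∈ as × ordinate v ∈ as
      coordinates ((a , y , z) , t∈ , refl) with ∈-cartesianProduct⁻ as _ t∈
      ... | a∈ , yz∈ = a∈ , proj₁ (∈-cartesianProduct⁻ as as yz∈)
    ... | inj₂ i = coordinates (∈-map⁻ (tag false) i)
      where
      coordinates : ∀ {v} → (∃ λ t → t ∈ triples × v ≡ (false , t)) → abscissa v ∈ as × ordinate v ∈ as
      coordinates ((a , y , z) , t∈ , refl) with ∈-cartesianProduct⁻ as _ t∈
      ... | a∈ , yz∈ = a∈ , proj₁ (∈-cartesianProduct⁻ as as yz∈)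

    module _ (unique-as : Unique as) where

      vertices-unique : Unique vertices
      vertices-unique = Unique.++⁺ (Unique.map⁺ (cong proj₂) u) (Unique.map⁺ (cong proj₂) u) λ (i , j) →
        tags (∈-map⁻ (tag true) i) (∈-map⁻ (tag false) j)
        where
        u = Unique.cartesianProduct⁺ unique-as (Unique.cartesianProduct⁺ unique-as unique-as)
        tags : ∀ {v : Vertex} → (∃ λ t → t ∈ triples × v ≡ (true , t)) → (∃ λ t → t ∈ triples × v ≡ (false , t)) → ⊥
        tags (_ , _ , refl) (_ , _ , ())

      module _ (δ : ℕ) (deg<p : 3 ℕ.+ (δ ℕ.+ δ ℕ.+ δ ℕ.+ δ) < p)
               (core : Core e e-sym vertices (δ ℕ.+ δ ℕ.+ (δ ℕ.+ δ) ℕ.+ length as ℕ.+ length as)) where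
        private
          module C = Core core
          N = length as
          V = C.vertices

        -- Neighbours with the ordinate of `u` all meet its line at parameter 0 and are discarded.
        -- They are determined by their abscissa, so they number at most `N`; this accounts for one
        -- `length as` in the threshold, and collinear neighbours for the other.
        network : ∀ {u} → u ∈ V → Network (map line V) δ N deg<p (line u)
        network {u} u∈ = record
          { crossings = map crossing-at transverse
          ; unique = subst Unique (List.map-∘ transverse) (Unique-map (λ v → slope (line u) (line v)) transverse-unique
              λ {v} {v′} v∈ v′∈ → slopes-distinct u v v′ (linked v∈) (linked v′∈) (ordinate≢ v∈))
          ; crossing = All.map⁺ (All.tabulate λ {v} v∈ →
              slope-cross (line u) (line v) (x-distinct u v (linked v∈)) (incident u v (linked v∈)) ,
              ∈-map⁺ line (proj₁ (∈-filter⁻ (λ v → T? (link u v)) (proj₁ (∈-filter⁻ transverse? v∈)))))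
          ; many = subst (δ ℕ.+ δ ℕ.+ (δ ℕ.+ δ) ℕ.+ N <_) (sym (List.length-map crossing-at transverse)) many
          ; not-collinear = not-collinear }
          where
          crossing-at : Vertex → K.Carrier × Line
          crossing-at v = slope (line u) (line v) , line v

          near = neighbours V u
          parallel? = λ v → ordinate v F.≟ ordinate u
          transverse? = λ v → ¬? (parallel? v)
          transverse = filter transverse? near

          near-unique : Unique near
          near-unique = Unique.filter⁺ _ C.unique

          transverse-unique : Unique transverse
          transverse-unique = Unique.filter⁺ transverse? near-unique

          near-linked : ∀ {v} → v ∈ near → T (link u v)
          near-linked v∈ = proj₂ (∈-filter⁻ (λ v → T? (link u v)) {xs = V} v∈)

          near-coordinates : ∀ {v} → v ∈ near → abscissa v ∈ as × ordinate v ∈ as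
          near-coordinates v∈ = ∈-vertices (C.subset (proj₁ (∈-filter⁻ (λ v → T? (link u v)) {xs = V} v∈)))

          linked : ∀ {v} → v ∈ transverse → T (link u v)
          linked v∈ = near-linked (proj₁ (∈-filter⁻ transverse? v∈))

          ordinate≢ : ∀ {v} → v ∈ transverse → ordinate v ≢ ordinate u
          ordinate≢ v∈ = proj₂ (∈-filter⁻ transverse? {xs = near} v∈)

          few-parallel : length (filter parallel? near) ≤ N
          few-parallel = injective-length abscissa (Unique.filter⁺ parallel? near-unique)
            (λ v∈ → proj₁ (near-coordinates (proj₁ (∈-filter⁻ parallel? v∈))))
            λ {v} {v′} v∈ v′∈ a≡ → let i , y = ∈-filter⁻ parallel? {xs = near} v∈ ; i′ , y′ = ∈-filter⁻ parallel? {xs = near} v′∈ in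
              neighbour-determined u v v′ (near-linked i) (near-linked i′) a≡ (trans y (sym y′))

          many : δ ℕ.+ δ ℕ.+ (δ ℕ.+ δ) ℕ.+ N < length transverse
          many = ℕ.+-cancelˡ-< N _ _ (ℕ.<-≤-trans (ℕ.≤-<-trans (ℕ.≤-reflexive (ℕ.+-comm N _)) (C.degree u∈))
            (ℕ.≤-trans (ℕ.≤-reflexive (trans (∑-𝟙 (link u) V) (length-split parallel? near))) (ℕ.+-monoˡ-≤ _ few-parallel)))

          not-collinear : ∀ c k {ds} → Unique (map proj₁ ds) → (∀ {d} → d ∈ ds → d ∈ map crossing-at transverse) →
            All (λ d → K.1# K.+ (proj₁ (proj₂ d) K.- proj₁ (line u)) K.* (c K.+ proj₁ d K.* k) ≡ K.0#) ds → length ds ≤ N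
          -- On the plane line of the neighbours, abscissas separate the points if `k` is nonzero;
          -- otherwise the abscissa is constant and ordinates do. Both range over `as`.
          not-collinear c k {ds} uniq ds⊆ relation with k K.≟ K.0#
          ... | no k≢0 = injective-length (λ d → proj₁ (proj₁ (proj₂ d))) (Unique.map⁻ uniq)
                (λ d∈ → let v , v∈ , eq = vertex d∈ in
                  subst (_∈ as) (trans (sym (x-line v)) (cong (λ d → proj₁ (proj₁ (proj₂ d))) (sym eq)))
                    (proj₁ (near-coordinates (proj₁ (∈-filter⁻ transverse? v∈)))))
                λ d∈ d′∈ same → let v , v∈ , eq = vertex d∈ ; v′ , v′∈ , eq′ = vertex d′∈ in
                  trans eq (trans (cong crossing-at (abscissa-case v∈ v′∈ (on-line eq d∈ v∈) (on-line eq′ d′∈ v′∈)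
                    (trans (sym (x-line v)) (trans (cong (λ d → proj₁ (proj₁ (proj₂ d))) (sym eq))
                      (trans same (trans (cong (λ d → proj₁ (proj₁ (proj₂ d))) eq′) (x-line v′))))))) (sym eq′))
            where
            vertex : ∀ {d} → d ∈ ds → ∃ λ v → v ∈ transverse × d ≡ crossing-at v
            vertex d∈ = ∈-map⁻ crossing-at (ds⊆ d∈)

            on-line : ∀ {d v} → d ≡ crossing-at v → d ∈ ds → v ∈ transverse →
              K.1# K.+ (proj₁ (line v) K.- proj₁ (line u)) K.* c K.- (proj₁ (proj₂ (line v)) K.- proj₁ (proj₂ (line u))) K.* k ≡ K.0#
            on-line {v = v} refl d∈ v∈ = collinear (line u) (line v) (x-distinct u v (linked v∈)) (All.lookup relation d∈)

            abscissa-case : ∀ {v v′} → v ∈ transverse → v′ ∈ transverse →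
              K.1# K.+ (proj₁ (line v) K.- proj₁ (line u)) K.* c K.- (proj₁ (proj₂ (line v)) K.- proj₁ (proj₂ (line u))) K.* k ≡ K.0# →
              K.1# K.+ (proj₁ (line v′) K.- proj₁ (line u)) K.* c K.- (proj₁ (proj₂ (line v′)) K.- proj₁ (proj₂ (line u))) K.* k ≡ K.0# →
              abscissa v ≡ abscissa v′ → v ≡ v′
            abscissa-case {v} {v′} v∈ v′∈ h h′ a≡ = neighbour-determined u v v′ (linked v∈) (linked v′∈) a≡
              (cong proj₁ (trans (sym (y-line v)) (trans (same-x k≢0 h (subst (λ x → K.1# K.+ (x K.- _) K.* c K.- _ ≡ K.0#)
                (sym (x-equal u v v′ (linked v∈) (linked v′∈) a≡)) h′)) (y-line v′))))
          ... | yes k≡0 = injective-length (λ d → proj₁ (proj₁ (proj₂ (proj₂ d)))) (Unique.map⁻ uniq)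
                (λ d∈ → let v , v∈ , eq = vertex d∈ in
                  subst (_∈ as) (trans (cong proj₁ (sym (y-line v))) (cong (λ d → proj₁ (proj₁ (proj₂ (proj₂ d)))) (sym eq)))
                    (proj₂ (near-coordinates (proj₁ (∈-filter⁻ transverse? v∈)))))
                λ d∈ d′∈ same → let v , v∈ , eq = vertex d∈ ; v′ , v′∈ , eq′ = vertex d′∈ in
                  trans eq (trans (cong crossing-at (neighbour-determined u v v′ (linked v∈) (linked v′∈)
                    (trans (sym (x-line v)) (trans (cong proj₁ (same-y k≡0 (on-line eq d∈ v∈) (on-line eq′ d′∈ v′∈))) (x-line v′)))
                    (trans (cong proj₁ (sym (y-line v))) (trans (cong (λ d → proj₁ (proj₁ (proj₂ (proj₂ d)))) (sym eq))
                      (trans same (trans (cong (λ d → proj₁ (proj₁ (proj₂ (proj₂ d)))) eq′) (cong proj₁ (y-line v′)))))))) (sym eq′))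
            where
            vertex : ∀ {d} → d ∈ ds → ∃ λ v → v ∈ transverse × d ≡ crossing-at v
            vertex d∈ = ∈-map⁻ crossing-at (ds⊆ d∈)

            on-line : ∀ {d v} → d ≡ crossing-at v → d ∈ ds → v ∈ transverse →
              K.1# K.+ (proj₁ (line v) K.- proj₁ (line u)) K.* c K.- (proj₁ (proj₂ (line v)) K.- proj₁ (proj₂ (line u))) K.* k ≡ K.0#
            on-line {v = v} refl d∈ v∈ = collinear (line u) (line v) (x-distinct u v (linked v∈)) (All.lookup relation d∈)

        networks : ∀ {ℓ} → ℓ ∈ map line V → Network (map line V) δ N deg<p ℓ
        networks ℓ∈ with ∈-map⁻ line ℓ∈
        ... | u , u∈ , refl = network u∈

      -- The factor 6 comes from two lines for each triple and the factor 3 in `no-network`.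
      few-values-impossible : ∀ ss d → All (λ t → f t ∈ ss) triples → 0 < length triples →
        6 ℕ.* length triples ≤ suc d ℕ.* suc d → 3 ℕ.+ (3 ℕ.* d ℕ.+ 3 ℕ.* d ℕ.+ 3 ℕ.* d ℕ.+ 3 ℕ.* d) < p →
        let δ = 3 ℕ.* d ; θ = δ ℕ.+ δ ℕ.+ (δ ℕ.+ δ) ℕ.+ length as ℕ.+ length as in
        ¬ (suc (2 ℕ.* θ) ℕ.* length ss ≤ length triples)
      few-values-impossible ss d values 0<n size deg<p few =
        no-network (map line V) d (length as) bound deg<p (∈-map⁺ line (proj₂ (Core.nonempty core)))
          (networks (3 ℕ.* d) deg<p core)
        where
        θ = 3 ℕ.* d ℕ.+ 3 ℕ.* d ℕ.+ (3 ℕ.* d ℕ.+ 3 ℕ.* d) ℕ.+ length as ℕ.+ length as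
        n = length triples
        S = ∑ triples (λ t → ∑ triples (λ t′ → 𝟙 (isYes (f t F.≟ f t′))))

        dense : 2 ℕ.* θ ℕ.* length vertices < ∑ vertices (λ u → ∑ vertices (e u))
        dense = subst₂ _<_ (sym (trans (cong (2 ℕ.* θ ℕ.*_) length-vertices) (double θ n))) (sym ∑-edges)
          (ℕ.*-monoʳ-< 2 (many-coincidences θ n (length ss) S 0<n (second-moment F._≟_ f (suc (2 ℕ.* θ)) ss triples values) few))
          where
          double : ∀ θ n → 2 ℕ.* θ ℕ.* (2 ℕ.* n) ≡ 2 ℕ.* (2 ℕ.* θ ℕ.* n)
          double = solve-∀

        core : Core e e-sym vertices θ
        core = prune e e-sym _ vertices θ refl vertices-unique dense

        V = Core.vertices core

        bound : 3 ℕ.* length (map line V) ≤ suc d ℕ.* suc d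
        bound = ℕ.≤-trans (ℕ.*-monoʳ-≤ 3 (ℕ.≤-trans (ℕ.≤-reflexive (List.length-map line V))
          (ℕ.≤-trans (Core.small core) (ℕ.≤-reflexive length-vertices)))) (ℕ.≤-trans (ℕ.≤-reflexive (sym (ℕ.*-assoc 3 2 n))) size)

-- Numerical bounds and the theorem

open import Data.Nat using (_*_; _^_)
open import Data.Fin.Subset as Subset using (Subset; ∣_∣; inside; outside)
import Data.Fin.Subset.Properties as Subset
open import Data.Vec using ([]; _∷_)

module Arithmetic where
  open ≡ using (refl; sym; cong)
  open import Data.Nat using (_+_)
  open ℕ.≤-Reasoning

  square-cancel-≤ : ∀ a b → a * a ≤ b * b → a ≤ b
  square-cancel-≤ a b aa≤bb = ℕ.≮⇒≥ λ b<a → ℕ.<-irrefl refl (ℕ.<-≤-trans (ℕ.*-mono-< b<a b<a) aa≤bb)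

  sqrt : ∀ m → ∃ λ d → m ≤ suc d * suc d × d * d ≤ m
  sqrt zero = 0 , z≤n , z≤n
  sqrt (suc m) with sqrt m
  ... | d , m≤ , ≤m with suc m ℕ.≤? suc d * suc d
  ... | yes 1+m≤ = d , 1+m≤ , ℕ.≤-trans ≤m (ℕ.n≤1+n m)
  ... | no 1+m≰ = suc d , ℕ.≤-trans (s≤s m≤) (ℕ.*-mono-< (ℕ.n<1+n (suc d)) (ℕ.n<1+n (suc d))) ,
                  ℕ.≤-trans (ℕ.≤-pred (ℕ.≰⇒> 1+m≰)) (ℕ.n≤1+n m)

  sqrt-upper : ∀ d m → 0 < m → d * d ≤ m → suc d * suc d ≤ 4 * m
  sqrt-upper d m 0<m dd≤m = begin
    suc d * suc d ≡⟨ expand d ⟩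
    d * d + 2 * d + 1 ≤⟨ ℕ.+-mono-≤ (ℕ.+-mono-≤ dd≤m (ℕ.*-monoʳ-≤ 2 (ℕ.≤-trans (d≤dd d) dd≤m))) 0<m ⟩
    m + 2 * m + m ≡⟨ collect m ⟩
    4 * m ∎
    where
    expand : ∀ d → suc d * suc d ≡ d * d + 2 * d + 1
    expand = solve-∀
    collect : ∀ m → m + 2 * m + m ≡ 4 * m
    collect = solve-∀
    d≤dd : ∀ d → d ≤ d * d
    d≤dd zero = z≤n
    d≤dd (suc d) = ℕ.m≤m*n (suc d) (suc d)

  cube : ℕ → ℕ
  cube n = n * (n * n)

  ^3≡cube : ∀ n → n ^ 3 ≡ cube n
  ^3≡cube n = cong (λ k → n * (n * k)) (ℕ.*-identityʳ n)

  ^2≡square : ∀ n → n ^ 2 ≡ n * n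
  ^2≡square n = cong (n *_) (ℕ.*-identityʳ n)

  cube-mono : ∀ {m n} → m ≤ n → cube m ≤ cube n
  cube-mono m≤n = ℕ.*-mono-≤ m≤n (ℕ.*-mono-≤ m≤n m≤n)

  cube-* : ∀ a n → cube (a * n) ≡ cube a * cube n
  cube-* = identity
    where
    identity : ∀ a n → a * n * (a * n * (a * n)) ≡ a * (a * a) * (n * (n * n))
    identity = solve-∀

  threshold-bound : ∀ d N → N ≤ suc d →
    suc (2 * (3 * d + 3 * d + (3 * d + 3 * d) + N + N)) ≤ 28 * suc d
  threshold-bound d N N≤D = begin
    suc (2 * (3 * d + 3 * d + (3 * d + 3 * d) + N + N)) ≡⟨ left d N ⟩
    24 * d + 4 * N + 1 ≤⟨ ℕ.+-monoˡ-≤ 1 (ℕ.+-monoʳ-≤ (24 * d) (ℕ.*-monoʳ-≤ 4 N≤D)) ⟩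
    24 * d + 4 * suc d + 1 ≤⟨ ℕ.m≤m+n _ 23 ⟩
    24 * d + 4 * suc d + 1 + 23 ≡⟨ right d ⟩
    28 * suc d ∎
    where
    left : ∀ d N → suc (2 * (3 * d + 3 * d + (3 * d + 3 * d) + N + N)) ≡ 24 * d + 4 * N + 1
    left = solve-∀
    right : ∀ d → 24 * d + 4 * suc d + 1 + 23 ≡ 28 * suc d
    right = solve-∀

  degree-bound : ∀ d → 3 + (3 * d + 3 * d + 3 * d + 3 * d) < 12 * suc d
  degree-bound d = begin-strict
    3 + (3 * d + 3 * d + 3 * d + 3 * d) <⟨ ℕ.m<m+n _ (s≤s z≤n) ⟩
    3 + (3 * d + 3 * d + 3 * d + 3 * d) + 9 ≡⟨ identity d ⟩
    12 * suc d ∎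
    where
    identity : ∀ d → 3 + (3 * d + 3 * d + 3 * d + 3 * d) + 9 ≡ 12 * suc d
    identity = solve-∀

  -- The origin of 16: the estimate needs 12² · 24 = 3456 to be at most a cube, and 16³ = 4096.
  small-degree : ∀ {p M} N D → 16 * N ≤ M → M ^ 3 ≤ p ^ 2 → D * D ≤ 24 * cube N → 12 * D ≤ p
  small-degree {p} {M} N D N≤M M³≤p² D²≤ = square-cancel-≤ (12 * D) p (begin
    12 * D * (12 * D) ≡⟨ square-* 12 D ⟩
    12 * 12 * (D * D) ≤⟨ ℕ.*-monoʳ-≤ (12 * 12) D²≤ ⟩
    12 * 12 * (24 * cube N) ≡⟨ sym (ℕ.*-assoc (12 * 12) 24 (cube N)) ⟩
    12 * 12 * 24 * cube N ≤⟨ ℕ.*-monoˡ-≤ (cube N) (ℕ.≤ᵇ⇒≤ (12 * 12 * 24) (cube 16) tt) ⟩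
    cube 16 * cube N ≡⟨ sym (cube-* 16 N) ⟩
    cube (16 * N) ≤⟨ cube-mono N≤M ⟩
    cube M ≡⟨ sym (^3≡cube M) ⟩
    M ^ 3 ≤⟨ M³≤p² ⟩
    p ^ 2 ≡⟨ ^2≡square p ⟩
    p * p ∎)
    where
    square-* : ∀ a D → a * D * (a * D) ≡ a * a * (D * D)
    square-* = solve-∀

  -- With `D` of order √n, squaring the last hypothesis leaves a factor `n` to cancel; hence the
  -- exponent 3/2.
  values-bound : ∀ a b n D K → 0 < n → D * D ≤ b * n → n < a * D * K → n ≤ a * a * b * (K * K)
  values-bound a b n D K 0<n D²≤ n< = ℕ.*-cancelˡ-≤ n {{ℕ.>-nonZero 0<n}} (begin
    n * n ≤⟨ ℕ.*-mono-≤ (ℕ.<⇒≤ n<) (ℕ.<⇒≤ n<) ⟩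
    a * D * K * (a * D * K) ≡⟨ regroup a D K ⟩
    a * a * (K * K) * (D * D) ≤⟨ ℕ.*-monoʳ-≤ (a * a * (K * K)) D²≤ ⟩
    a * a * (K * K) * (b * n) ≡⟨ reorder (a * a) (K * K) b n ⟩
    n * (a * a * b * (K * K)) ∎)
    where
    regroup : ∀ a D K → a * D * K * (a * D * K) ≡ a * a * (K * K) * (D * D)
    regroup = solve-∀
    reorder : ∀ a k b n → a * k * (b * n) ≡ n * (a * b * k)
    reorder = solve-∀

  scaled-cube-bound : ∀ a b k c N M → M ≤ a * N ℕ.+ b → 0 < N → cube N ≤ c * k → cube M ≤ cube (a ℕ.+ b) * c * k
  scaled-cube-bound a b k c N M M≤ 0<N N³≤ = begin
    cube M ≤⟨ cube-mono (ℕ.≤-trans M≤ (ℕ.+-monoʳ-≤ (a * N) (ℕ.m≤m*n b N {{ℕ.>-nonZero 0<N}}))) ⟩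
    cube (a * N ℕ.+ b * N) ≡⟨ cong cube (sym (ℕ.*-distribʳ-+ N a b)) ⟩
    cube ((a ℕ.+ b) * N) ≡⟨ cube-* (a ℕ.+ b) N ⟩
    cube (a ℕ.+ b) * cube N ≤⟨ ℕ.*-monoʳ-≤ (cube (a ℕ.+ b)) N³≤ ⟩
    cube (a ℕ.+ b) * (c * k) ≡⟨ sym (ℕ.*-assoc (cube (a ℕ.+ b)) c k) ⟩
    cube (a ℕ.+ b) * c * k ∎

  abstract
    -- Abstract, because the normal form of c * x for a numeral c is a sum of c terms.
    c₁ c₂ : ℕ
    c₁ = 28 * 28 * 24
    c₂ = cube 31 * c₁

    c₂-positive : 0 < c₂
    c₂-positive = ℕ.≤ᵇ⇒≤ 1 (cube 31 * (28 * 28 * 24)) tt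

    cube-15≤c₂ : cube 15 ≤ c₂
    cube-15≤c₂ = ℕ.≤ᵇ⇒≤ (cube 15) (cube 31 * (28 * 28 * 24)) tt

    few-cubes : ∀ n D K → 0 < n → D * D ≤ 24 * n → n < 28 * D * K → n ≤ c₁ * (K * K)
    few-cubes = values-bound 28 24

    combine : ∀ k N M → M ≤ 16 * N ℕ.+ 15 → 0 < N → cube N ≤ c₁ * k → cube M ≤ c₂ * k
    combine k N M = scaled-cube-bound 16 15 k c₁ N M

open Arithmetic

-- From triples back to permanents

length-elems : ∀ {p} (A : Subset p) → length (elems A) ≡ ∣ A ∣
length-elems {p} A = count A (λ i → i) (Subset._∈? A) (λ _ → (λ i → i) , λ i → i)
  where
  open ≡ using (cong)
  -- Stated for a tabulated `f` and a general predicate, since the tail of `allFin` is not itself an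
  -- `allFin`.
  count : ∀ {n} {X : Set} (A : Subset n) (f : Fin n → X) {P : X → Set} (P? : ∀ x → Dec (P x)) →
    (∀ i → (P (f i) → i Subset.∈ A) × (i Subset.∈ A → P (f i))) → length (filter P? (List.tabulate f)) ≡ ∣ A ∣
  count [] f P? equiv = ≡.refl
  count (b ∷ A) f P? equiv with P? (f Fin.zero) | b | equiv Fin.zero
  ... | yes _ | inside | _ = cong suc (count A (λ i → f (Fin.suc i)) P? λ i → tail i)
    where
    tail : ∀ i → _
    tail i = (λ Pfi → Subset.drop-there (proj₁ (equiv (Fin.suc i)) Pfi)) , λ i∈ → proj₂ (equiv (Fin.suc i)) (Data.Vec.there i∈)
  ... | yes Pf0 | outside | to , _ with () ← to Pf0
  ... | no ¬Pf0 | inside | _ , from = ⊥-elim (¬Pf0 (from Data.Vec.here))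
  ... | no _ | outside | _ = count A (λ i → f (Fin.suc i)) P? λ i → tail i
    where
    tail : ∀ i → _
    tail i = (λ Pfi → Subset.drop-there (proj₁ (equiv (Fin.suc i)) Pfi)) , λ i∈ → proj₂ (equiv (Fin.suc i)) (Data.Vec.there i∈)

elems-unique : ∀ {p} (A : Subset p) → Unique (elems A)
elems-unique {p} A = Unique.filter⁺ (Subset._∈? A) (Unique.allFin⁺ p)

∈-perValues : ∀ p .{{_ : NonZero p}} (A : Subset p) {a b c d} → a ∈ elems A → b ∈ elems A → c ∈ elems A → d ∈ elems A →
  per2 p a b c d ∈ perValues p A
∈-perValues p A a∈ b∈ c∈ d∈ =
  ∈-concatMap⁺ _ (lose a∈ (∈-concatMap⁺ _ (lose b∈ (∈-concatMap⁺ _ (lose c∈ (∈-map⁺ _ d∈))))))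

nonzero-member : ∀ {A : Set} (z : A) (_≟_ : ∀ x y → Dec (x ≡ y)) {xs} → Unique xs → 2 ≤ length xs → ∃ λ x → x ∈ xs × x ≢ z
nonzero-member z _≟_ {x ∷ y ∷ xs} ((x≢y ∷ _) ∷ _) _ with x ≟ z
... | no x≢z = x , here ≡.refl , x≢z
... | yes ≡.refl = y , there (here ≡.refl) , λ y≡z → x≢y (≡.sym y≡z)
nonzero-member z _≟_ {x ∷ []} _ (s≤s ())

∈-take : ∀ {A : Set} n (xs : List A) {x} → x ∈ take n xs → x ∈ xs
∈-take (suc n) (x ∷ xs) (here e) = here e
∈-take (suc n) (x ∷ xs) (there i) = there (∈-take n xs i)

module _ (p : ℕ) .{{_ : NonZero p}} (prime : Prime p) (2<p : 2 < p) (A : Subset p) (small : ∣ A ∣ ^ 3 ≤ p ^ 2)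
         (N : ℕ) (0<N : 0 < N) (16N≤A : 16 * N ≤ ∣ A ∣) where
  open ≡ using (sym; trans; cong; subst)
  module P = PrimeField p prime

  private
    xs = elems A
    as = take N xs

    16N≤xs : 16 * N ≤ length xs
    16N≤xs = subst (16 * N ≤_) (sym (length-elems A)) 16N≤A

    2≤xs : 2 ≤ length xs
    2≤xs = ℕ.≤-trans (s≤s (s≤s z≤n)) (ℕ.≤-trans (ℕ.*-monoʳ-≤ 16 0<N) 16N≤xs)

    length-as : length as ≡ N
    length-as = trans (List.length-take N xs) (ℕ.m≤n⇒m⊓n≡m (ℕ.≤-trans (ℕ.m≤n*m N 16) 16N≤xs))

    pivot = nonzero-member P.[ 0 ] Fin._≟_ (elems-unique A) 2≤xs
    c₀ = proj₁ pivot

    char : ∀ n → suc n < p → FieldProperties.ι P.primeField (suc n) ≢ P.[ 0 ]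
    char n n<p e = P.[]≢0 (s≤s z≤n) n<p (trans (sym (P.ι-[] (suc n))) e)

    module C = Configuration P.primeField p char (proj₁ (P.nonsquare 2<p)) (proj₂ (P.nonsquare 2<p)) c₀ (proj₂ (proj₂ pivot))

    ss = map P.[_] (deduplicate ℕ._≟_ (perValues p A))

    values : All (λ t → C.f t ∈ ss) (C.triples as)
    values = All.tabulate λ { {a , d , z} t∈ →
      let a∈ , dz∈ = ∈-cartesianProduct⁻ as (cartesianProduct as as) t∈ ; d∈ , z∈ = ∈-cartesianProduct⁻ as as dz∈ in
      subst (_∈ ss) (value a d z) (∈-map⁺ P.[_] (∈-deduplicate⁺ ℕ._≟_
        (∈-perValues p A (∈-take N xs a∈) (proj₁ (proj₂ pivot)) (∈-take N xs z∈) (∈-take N xs d∈)))) }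
      where
      value : ∀ a d z → P.[ per2 p a c₀ z d ] ≡ C.f (a , d , z)
      value a d z = trans (P.[]-cong (m%n%n≡m%n (toℕ a * toℕ d ℕ.+ toℕ c₀ * toℕ z) p))
        (sym (P.[]-+ (toℕ a * toℕ d) (toℕ c₀ * toℕ z)))

    length-triples : length (C.triples as) ≡ cube N
    length-triples = trans (C.length-triples as) (cong cube length-as)

    0<N³ : 0 < cube N
    0<N³ = ℕ.*-mono-< 0<N (ℕ.*-mono-< 0<N 0<N)

  many-values : cube N ≤ c₁ * (g2 p A * g2 p A)
  many-values = few-cubes (cube N) (suc d) (g2 p A) 0<N³ D²≤ (ℕ.≰⇒> λ few →
      C.few-values-impossible as (Unique.take⁺ N (elems-unique A)) ss d values
        (subst (0 <_) (sym length-triples) 0<N³)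
        (subst (λ n → 6 * n ≤ suc d * suc d) (sym length-triples) upper)
        (ℕ.<-≤-trans (degree-bound d) (small-degree N (suc d) 16N≤A small D²≤))
        (ℕ.≤-trans (ℕ.*-mono-≤ (ℕ.≤-trans (ℕ.≤-reflexive (cong
             (λ n → suc (2 * (3 * d ℕ.+ 3 * d ℕ.+ (3 * d ℕ.+ 3 * d) ℕ.+ n ℕ.+ n))) length-as)) (threshold-bound d N N≤D))
             (ℕ.≤-reflexive (List.length-map P.[_] (deduplicate ℕ._≟_ (perValues p A)))))
          (ℕ.≤-trans few (ℕ.≤-reflexive (sym length-triples)))))
    where
    -- This choice gives 6 N³ ≤ (d + 1)² ≤ 24 N³.
    d = proj₁ (sqrt (6 * cube N))
    upper = proj₁ (proj₂ (sqrt (6 * cube N)))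
    lower = proj₂ (proj₂ (sqrt (6 * cube N)))

    D²≤ : suc d * suc d ≤ 24 * cube N
    D²≤ = ℕ.≤-trans (sqrt-upper d (6 * cube N) (ℕ.*-mono-< {0} {6} (s≤s z≤n) 0<N³) lower)
      (ℕ.≤-reflexive (sym (ℕ.*-assoc 4 6 (cube N))))

    N≤D : N ≤ suc d
    N≤D = square-cancel-≤ N (suc d) (ℕ.≤-trans (ℕ.≤-trans (ℕ.m≤n*m (N * N) N {{ℕ.>-nonZero 0<N}})
      (ℕ.m≤n*m (cube N) 6)) upper)

theorem1p4 : ∃ λ (c : ℕ) → 0 < c ×
    ((p : ℕ) → .{{_ : NonZero p}} → Prime p → ¬ (2 ∣ p) →
    (A : Subset p) → ∣ A ∣ ^ 3 ≤ p ^ 2 →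
    ∣ A ∣ ^ 3 ≤ c * (g2 p A ^ 2))
theorem1p4 = c₂ , c₂-positive , bound
  where
  open ≡ using (refl; sym; trans; cong; subst)
  open ℕ.≤-Reasoning

  module _ (p : ℕ) .{{_ : NonZero p}} (prime : Prime p) (odd : ¬ (2 ∣ p)) (A : Subset p) (small : ∣ A ∣ ^ 3 ≤ p ^ 2) where
    K = g2 p A

    2<p : 2 < p
    2<p = ℕ.≤∧≢⇒< (PrimeField.1<p p prime) λ { refl → odd ∣-refl }

    nonempty : 0 < ∣ A ∣ → 0 < K
    nonempty 0<A = first (elems A) refl
      where
      positive : ∀ {xs : List ℕ} {x} → x ∈ xs → 0 < length xs
      positive {_ ∷ _} _ = s≤s z≤n
      first : ∀ xs → xs ≡ elems A → 0 < K
      first [] e = ⊥-elim (ℕ.<-irrefl (trans (cong length e) (length-elems A)) 0<A)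
      first (a ∷ _) e = positive (∈-deduplicate⁺ ℕ._≟_ (∈-perValues p A a∈ a∈ a∈ a∈))
        where a∈ = subst (a ∈_) e (here refl)

    -- There is no room for a positive N with 16 N ≤ |A|. A single value of the permanent is enough,
    -- because 15³ ≤ `c₂`.
    bound-small : ∣ A ∣ ≤ 15 → Dec (∣ A ∣ ≡ 0) → ∣ A ∣ ^ 3 ≤ c₂ * (K ^ 2)
    bound-small _ (yes e) = ℕ.≤-trans (ℕ.≤-reflexive (cong (_^ 3) e)) z≤n
    bound-small A≤15 (no A≢0) = begin
      ∣ A ∣ ^ 3 ≡⟨ ^3≡cube ∣ A ∣ ⟩
      cube ∣ A ∣ ≤⟨ cube-mono A≤15 ⟩
      cube 15 ≤⟨ cube-15≤c₂ ⟩
      c₂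
        ≤⟨ ℕ.m≤m*n (c₂) (K ^ 2) {{ℕ.m^n≢0 K 2 {{ℕ.>-nonZero (nonempty (ℕ.n≢0⇒n>0 A≢0))}}}} ⟩
      c₂ * K ^ 2 ∎

    bound-large : ∀ N → 0 < N → ∣ A ∣ ≤ 16 * N ℕ.+ 15 → 16 * N ≤ ∣ A ∣ → ∣ A ∣ ^ 3 ≤ c₂ * (K ^ 2)
    bound-large N 0<N A≤ ≤A = begin
      ∣ A ∣ ^ 3 ≡⟨ ^3≡cube ∣ A ∣ ⟩
      cube ∣ A ∣ ≤⟨ combine (K * K) N ∣ A ∣ A≤ 0<N (many-values p prime 2<p A small N 0<N ≤A) ⟩
      c₂ * (K * K) ≡⟨ cong (c₂ *_) (sym (^2≡square K)) ⟩
      c₂ * K ^ 2 ∎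

    division : ∣ A ∣ ≡ 16 * (∣ A ∣ / 16) ℕ.+ ∣ A ∣ % 16
    division = trans (m≡m%n+[m/n]*n ∣ A ∣ 16) (trans (ℕ.+-comm (∣ A ∣ % 16) _) (cong (ℕ._+ ∣ A ∣ % 16) (ℕ.*-comm (∣ A ∣ / 16) 16)))

    bound : ∣ A ∣ ^ 3 ≤ c₂ * (K ^ 2)
    bound = cases (∣ A ∣ / 16) (∣ A ∣ % 16) division (ℕ.≤-pred (m%n<n ∣ A ∣ 16))
      where
      cases : ∀ N r → ∣ A ∣ ≡ 16 * N ℕ.+ r → r ≤ 15 → ∣ A ∣ ^ 3 ≤ c₂ * (K ^ 2)
      cases zero r e r≤15 = bound-small (ℕ.≤-trans (ℕ.≤-reflexive e) r≤15) (∣ A ∣ ℕ.≟ 0)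
      cases N@(suc _) r e r≤15 = bound-large N (s≤s z≤n)
        (ℕ.≤-trans (ℕ.≤-reflexive e) (ℕ.+-monoʳ-≤ (16 * N) r≤15)) (ℕ.≤-trans (ℕ.m≤m+n (16 * N) r) (ℕ.≤-reflexive (sym e)))
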